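{- For every integer $k \geq 2$, $\mathrm{NTIME}(2^{(k+\frac{1}{2})n}) \subseteq \textsc{Spec}_{2k+2}$.
   Context: For a positive integer $N$, $\mathsf{BINARY}(N)$ is its binary representation, and for $A\subseteq \mathbb{N}^+$, $\mathsf{BINARY}(A)$ is the set of binary representations of elements of $A$. For a function $T:\mathbb{N}\to\mathbb{N}$, $\mathrm{NTIME}(T(n))$ denotes the class of sets $A$ of positive integers such that $\mathsf{BINARY}(A)$ is accepted by a non-deterministic (possibly multi-tape) Turing machine running in time $O(T(n))$, where $n$ is the length of the input. First-order sentences are over finite relational vocabularies, with equality. For a first-order sentence $\Phi$, $\textsc{Spec}(\Phi)$ is the set of positive integers $n$ such that $\Phi$ has a model with universe of cardinality exactly $n$. For $k\geq1$, $\textsc{Spec}_k$ is the class of all $\textsc{Spec}(\Phi)$ with $\Phi$ a first-order sentence using at most $k$ distinct variables (variables may be reused). -}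

module Defs where

open import Data.Nat using (ℕ; zero; suc; _+_; _*_; _^_; _≤_)
open import Data.Bool using (Bool; true; false; if_then_else_; _∧_; _∨_; not)
open import Data.Empty using (⊥)
open import Data.Fin using (Fin; zero; suc)
open import Data.Integer as ℤ using (ℤ)
open import Data.List using (List; []; _∷_; length)
open import Data.List.Membership.Propositional using (_∈_)
open import Data.Vec using (Vec; []; _∷_; lookup; map; zipWith; replicate; tabulate)
open import Data.Product using (Σ; _×_; _,_; ∃)
open import Relation.Nullary using (¬_; does)
open import Relation.Binary.PropositionalEquality using (_≡_)

val : List Bool → ℕ → ℕ
val []            acc = acc
val (false ∷ bs)  acc = val bs (2 * acc)
val (true ∷ bs)   acc = val bs (1 + 2 * acc)

-- BinRep w N : w is BINARY(N), i.e. the binary representation of N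
-- (most significant bit first, no leading zeros, so N ≥ 1)
BinRep : List Bool → ℕ → Set
BinRep []           N = ⊥
BinRep (false ∷ bs) N = ⊥
BinRep (true ∷ bs)  N = val (true ∷ bs) 0 ≡ N

data Move : Set where
  L R S : Move

-- A machine with (suc tapes) two-way infinite tapes (tape zero is the
-- input tape), states Fin states, tape alphabet Fin (3 + extra)
-- where zero is the blank and suc zero / suc (suc zero) encode the
-- input bits 0 / 1.  The transition relation is finitely branching:
-- δ q a lists all admissible (new state, written symbols, head moves).
record NTM : Set where
  field
    tapes  : ℕ
    states : ℕ
    extra  : ℕ
    start  : Fin states
    accept : Fin states → Bool
    δ      : Fin states → Vec (Fin (3 + extra)) (suc tapes)
           → List (Fin states × Vec (Fin (3 + extra) × Move) (suc tapes))

module _ (M : NTM) where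
  open NTM M

  Γ : Set
  Γ = Fin (3 + extra)

  record Config : Set where
    constructor cfg
    field
      state : Fin states
      heads : Vec ℤ (suc tapes)
      tape  : Vec (ℤ → Γ) (suc tapes)
  open Config

  blank : Γ
  blank = zero

  bitSym : Bool → Γ
  bitSym false = suc zero
  bitSym true  = suc (suc zero)

  inputTape : List Bool → ℤ → Γ
  inputTape w (ℤ.-[1+ _ ]) = blank
  inputTape w (ℤ.+ i)      = go w i
    where
    go : List Bool → ℕ → Γ
    go []       _       = blank
    go (b ∷ bs) zero    = bitSym b
    go (b ∷ bs) (suc i) = go bs i

  initial : List Bool → Config
  initial w = cfg start (replicate _ (ℤ.+ 0))
                        (inputTape w ∷ replicate _ (λ _ → blank))

  read : Config → Vec Γ (suc tapes)
  read c = zipWith (λ f p → f p) (tape c) (heads c)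

  move : Move → ℤ → ℤ
  move L p = p ℤ.- ℤ.+ 1
  move R p = p ℤ.+ ℤ.+ 1
  move S p = p

  write : ℤ → Γ → (ℤ → Γ) → (ℤ → Γ)
  write p a f i = if does (i ℤ.≟ p) then a else f i

  apply : Fin states × Vec (Γ × Move) (suc tapes) → Config → Config
  apply (q , acts) c =
    cfg q (zipWith (λ am p → move (Data.Product.proj₂ am) p) acts (heads c))
          (zipWith (λ am fp → write (Data.Product.proj₂ fp)
                                    (Data.Product.proj₁ am)
                                    (Data.Product.proj₁ fp))
                   acts (zipWith _,_ (tape c) (heads c)))

  data Reach : ℕ → Config → Config → Set where
    done : ∀ {c} → Reach zero c c
    step : ∀ {t c c'} tr → tr ∈ δ (state c) (read c)
         → Reach t (apply tr c) c' → Reach (suc t) c c'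

  Accepts : List Bool → Set
  Accepts w = Σ ℕ λ t → Σ Config λ c → Reach t (initial w) c × accept (state c) ≡ true

  -- every computation path on input w has length ≤ bound (stated via
  -- a predicate on the length, to allow non-integral bounds)
  AllPathsWithin : (ℕ → Set) → List Bool → Set
  AllPathsWithin ok w = ∀ t c → Reach t (initial w) c → ok t

-- A ⊆ ℕ⁺ is in NTIME(2^{(p/q)n}) iff some NTM accepts exactly BINARY(A)
-- and runs in time O(2^{(p/q)n}), i.e. for some constant c every
-- computation path on an input of length n has length t ≤ c·2^{(p/q)n},
-- equivalently t^q ≤ d · 2^{p n} (d = c^q).
NTIME-2^ : (p q : ℕ) → (ℕ → Set) → Set
NTIME-2^ p q A =
  (∀ N → A N → 1 ≤ N) ×
  Σ NTM λ M → Σ ℕ λ d →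
    (∀ w → Accepts M w → Σ ℕ λ N → A N × BinRep w N) ×
    (∀ w N → A N → BinRep w N → Accepts M w) ×
    (∀ w → AllPathsWithin M (λ t → t ^ q ≤ d * 2 ^ (p * length w)) w)

record Vocab : Set where
  constructor voc
  field
    m  : ℕ
    ar : Fin m → ℕ
open Vocab

data Formula (k : ℕ) (σ : Vocab) : Set where
  _≐_  : Fin k → Fin k → Formula k σ
  rel  : (i : Fin (m σ)) → Vec (Fin k) (ar σ i) → Formula k σ
  ¬'   : Formula k σ → Formula k σ
  _∧'_ : Formula k σ → Formula k σ → Formula k σ
  _∨'_ : Formula k σ → Formula k σ → Formula k σ
  ∃'   : Fin k → Formula k σ → Formula k σ
  ∀'   : Fin k → Formula k σ → Formula k σ

ClosedUnder : ∀ {k σ} → (Fin k → Bool) → Formula k σ → Set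
ClosedUnder bd (x ≐ y)  = (bd x ≡ true) × (bd y ≡ true)
ClosedUnder bd (rel i xs) = ∀ j → bd (lookup xs j) ≡ true
ClosedUnder bd (¬' φ)   = ClosedUnder bd φ
ClosedUnder bd (φ ∧' ψ) = ClosedUnder bd φ × ClosedUnder bd ψ
ClosedUnder bd (φ ∨' ψ) = ClosedUnder bd φ × ClosedUnder bd ψ
ClosedUnder bd (∃' x φ) = ClosedUnder (λ y → does (y Data.Fin.≟ x) ∨ bd y) φ
ClosedUnder bd (∀' x φ) = ClosedUnder (λ y → does (y Data.Fin.≟ x) ∨ bd y) φ

Sentence : ∀ {k σ} → Formula k σ → Set
Sentence = ClosedUnder (λ _ → false)

Structure : Vocab → ℕ → Set
Structure σ n = (i : Fin (m σ)) → Vec (Fin n) (ar σ i) → Bool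

anyFin : ∀ {n} → (Fin n → Bool) → Bool
anyFin {zero}  f = false
anyFin {suc n} f = f zero ∨ anyFin (λ i → f (suc i))

allFin : ∀ {n} → (Fin n → Bool) → Bool
allFin {zero}  f = true
allFin {suc n} f = f zero ∧ allFin (λ i → f (suc i))

_[_≔_] : ∀ {k n} → (Fin k → Fin n) → Fin k → Fin n → (Fin k → Fin n)
(ρ [ x ≔ a ]) y = if does (y Data.Fin.≟ x) then a else ρ y

eval : ∀ {k σ n} → Structure σ n → Formula k σ → (Fin k → Fin n) → Bool
eval 𝔄 (x ≐ y)    ρ = does (ρ x Data.Fin.≟ ρ y)
eval 𝔄 (rel i xs) ρ = 𝔄 i (map ρ xs)
eval 𝔄 (¬' φ)     ρ = not (eval 𝔄 φ ρ)
eval 𝔄 (φ ∧' ψ)   ρ = eval 𝔄 φ ρ ∧ eval 𝔄 ψ ρ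
eval 𝔄 (φ ∨' ψ)   ρ = eval 𝔄 φ ρ ∨ eval 𝔄 ψ ρ
eval 𝔄 (∃' x φ)   ρ = anyFin (λ a → eval 𝔄 φ (ρ [ x ≔ a ]))
eval 𝔄 (∀' x φ)   ρ = allFin (λ a → eval 𝔄 φ (ρ [ x ≔ a ]))

-- 𝔄 ⊨ Φ for a sentence Φ (the assignment is irrelevant for sentences)
_⊨_ : ∀ {k σ n} → Structure σ n → Formula k σ → Set
_⊨_ {n = n} 𝔄 Φ = ∀ (ρ : _ → Fin n) → eval 𝔄 Φ ρ ≡ true

Spec : ∀ {k σ} → Formula k σ → ℕ → Set
Spec {σ = σ} Φ n = (1 ≤ n) × Σ (Structure σ n) λ 𝔄 → 𝔄 ⊨ Φ

InSpec : ℕ → (ℕ → Set) → Set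
InSpec k A = Σ Vocab λ σ → Σ (Formula k σ) λ Φ →
  Sentence Φ × (∀ n → (A n → Spec Φ n) × (Spec Φ n → A n))

{-# OPTIONS --safe #-}
-- A computation of time O(n^{k+1/2}) is a tiling of a space-time diagram with
-- O(n^{k+1/2}) rows and columns, where n is the number represented by the input.
-- With s = ⌊√n⌋, a row is named by k elements of the universe, a number below s
-- and a constant, and so is a column.  The two numbers below s are coded by one
-- element, so that a tile is given by relations in 2k + 1 variables.  One more
-- variable suffices to pass to the next row or column: the digits of a mixed
-- radix numeral are incremented one after the other, the spare variable holding
-- the new value of a digit while the variable of this digit is requantified.
-- The auxiliary relations (successor, pairing, …) are axiomatised mostly by
-- implications towards them.  This suffices: all conditions on tiles forbid
-- certain pairs of neighbours, so that they may be imposed on too many pairs, and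
-- any model contains a correct tiling.  Its size enters only through the linear
-- order and the input word, which is read off by halving n repeatedly.
module Submission where

open import Defs
open import Data.Nat as ℕ using (ℕ; zero; suc; _+_; _*_; _^_; _≤_; _<_; _≡ᵇ_; z≤n; s≤s; NonZero)
import Data.Nat.Properties as ℕ
open import Data.Nat.DivMod using (_/_; _%_; m≡m%n+[m/n]*n; m%n<n)
open import Data.Nat.Induction using (<-rec)
open import Data.Integer as ℤ using (ℤ; _⊖_; ∣_∣)
import Data.Integer.Properties as ℤ
open import Data.Bool using (Bool; true; false; if_then_else_; _∧_; _∨_; not)
import Data.Bool.Properties as Bool
open import Data.Empty using (⊥; ⊥-elim)
open import Data.Unit using (⊤; tt)
open import Data.Fin as Fin
  using (Fin; zero; suc; toℕ; fromℕ<; punchOut; _↑ˡ_; _↑ʳ_; splitAt; join; combine; remQuot)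
open import Data.Fin.Patterns
import Data.Fin.Properties as Fin
open import Data.List as List using (List; []; _∷_; length)
import Data.List.Properties as List
open import Data.List.Membership.Propositional using (_∈_; _∉_)
import Data.List.Membership.DecPropositional as DecMembership
open import Data.List.Membership.Propositional.Properties
  using (∈-allFin; ∈-++⁺ˡ; ∈-++⁺ʳ; ∈-++⁻; ∈-tabulate⁺; ∈-tabulate⁻)
open import Data.List.Relation.Unary.Any using (here; there)
open import Data.List.Relation.Unary.All as All using ([]; _∷_)
open import Data.List.Relation.Unary.Unique.Propositional using (Unique; []; _∷_)
import Data.List.Relation.Unary.Unique.Propositional.Properties as Unique
open import Data.Maybe using (Maybe; just; nothing; maybe′)
import Data.Maybe.Properties as Maybe
open import Data.Vec using (Vec; []; _∷_; lookup; map; zipWith; replicate; tabulate)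
import Data.Vec.Properties as Vec
open import Data.Product using (Σ; _×_; _,_; ∃; proj₁; proj₂)
open import Data.Sum as Sum using (_⊎_; inj₁; inj₂; [_,_]′)
open import Function using (_∘_; case_of_; id)
open import Function.Bundles using (mk⇔)
open import Relation.Nullary using (¬_; Dec; yes; no; does; proof; map′)
open import Relation.Nullary.Decidable using (_×-dec_; _→-dec_; ¬?; dec-false; does-⇔)
open import Relation.Nullary.Reflects using (Reflects; ofʸ; ofⁿ; _×-reflects_; _⊎-reflects_; _→-reflects_)
open import Relation.Binary.Definitions using (DecidableEquality; tri<; tri≈; tri>)
open import Relation.Binary.PropositionalEquality

-- If n has ℓ binary digits, then 2^ℓ ≤ 2n, and n ≤ 4s², so a run within the time bound is shorter
-- than n^k·s·D for a constant D; the digit below D goes into the names of the tile relations. In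
-- the model built from an accepting run, s is ⌊√n⌋, and the time bound makes the run fit. In an
-- arbitrary model, s is dictated by an element that satisfies `root` and may be far from √n; a
-- tiling of any size whose last row is halted still yields an accepting run. The delicate point is
-- the variable `mix`, which holds a digit of the row and a digit of the column: the relations that
-- step one of them must keep the other. In the built model these digits are u / s and u % s. An
-- element u ≥ s² is not a code, and its quotient is too large for a digit. The quotient is
-- therefore given to the row and the remainder to the column: columns stay in range, while rows may
-- exceed the last one, and the tiling behind the model has infinitely many rows.

-- Mixed radix numerals

+*-monoʳ-< : ∀ b {r r' q q'} → r < b → q < q' → r + b * q < r' + b * q'
+*-monoʳ-< b {r} {r'} {q} {q'} r<b q<q' = begin-strict
  r + b * q   <⟨ ℕ.+-monoˡ-< (b * q) r<b ⟩
  b + b * q   ≡⟨ ℕ.*-suc b q ⟨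
  b * suc q   ≤⟨ ℕ.*-monoʳ-≤ b q<q' ⟩
  b * q'      ≤⟨ ℕ.m≤n+m (b * q') r' ⟩
  r' + b * q' ∎
  where open ℕ.≤-Reasoning

+*-unique : ∀ b {r r' q q'} → r < b → r' < b → r + b * q ≡ r' + b * q' → r ≡ r' × q ≡ q'
+*-unique b {r} {r'} {q} {q'} r<b r'<b e with ℕ.<-cmp q q'
... | tri≈ _ refl _ = ℕ.+-cancelʳ-≡ (b * q) r r' e , refl
... | tri< q<q' _ _ = ⊥-elim (ℕ.<-irrefl e (+*-monoʳ-< b r<b q<q'))
... | tri> _ _ q'<q = ⊥-elim (ℕ.<-irrefl (sym e) (+*-monoʳ-< b r'<b q'<q))

module MixedRadix {C : Set} (_≟_ : DecidableEquality C) (base : C → ℕ) where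

  Digits : Set
  Digits = C → ℕ

  _[_↦_] : Digits → C → ℕ → Digits
  (δ [ c ↦ r ]) d = if does (d ≟ c) then r else δ d

  ↦-same : ∀ δ c r → (δ [ c ↦ r ]) c ≡ r
  ↦-same δ c r with c ≟ c
  ... | yes _ = refl
  ... | no ≢ = ⊥-elim (≢ refl)

  ↦-other : ∀ δ c r {d} → d ≢ c → (δ [ c ↦ r ]) d ≡ δ d
  ↦-other δ c r {d} d≢c with d ≟ c
  ... | yes e = ⊥-elim (d≢c e)
  ... | no _ = refl

  InRange : List C → Digits → Set
  InRange cs δ = ∀ {c} → c ∈ cs → δ c < base c

  ↦-range : ∀ {δ} c {r} → (∀ d → δ d < base d) → r < base c → ∀ d → (δ [ c ↦ r ]) d < base d
  ↦-range c δ< r< d with d ≟ c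
  ... | yes refl = r<
  ... | no _ = δ< d

  -- The digits of the list are given least significant first; the value a above
  -- the last of them is unbounded.
  num : List C → Digits → ℕ → ℕ
  num []       δ a = a
  num (c ∷ cs) δ a = δ c + base c * num cs δ a

  weight : List C → ℕ
  weight []       = 1
  weight (c ∷ cs) = base c * weight cs

  num-cong : ∀ cs {δ δ' a} → (∀ {c} → c ∈ cs → δ c ≡ δ' c) → num cs δ a ≡ num cs δ' a
  num-cong []       h = refl
  num-cong (c ∷ cs) h = cong₂ (λ r q → r + base c * q) (h (here refl)) (num-cong cs (h ∘ there))

  num-injective : ∀ cs {δ δ' a a'} → InRange cs δ → InRange cs δ' → num cs δ a ≡ num cs δ' a' →
    (∀ {c} → c ∈ cs → δ c ≡ δ' c) × a ≡ a'
  num-injective []       δ< δ'< e = (λ ()) , e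
  num-injective (c ∷ cs) δ< δ'< e with +*-unique (base c) (δ< (here refl)) (δ'< (here refl)) e
  ... | r , q with num-injective cs (δ< ∘ there) (δ'< ∘ there) q
  ... | rs , a = (λ { (here refl) → r ; (there m) → rs m }) , a

  num-zeros : ∀ cs {δ} a → (∀ {c} → c ∈ cs → δ c ≡ 0) → num cs δ a ≡ weight cs * a
  num-zeros []       a h = sym (ℕ.+-identityʳ a)
  num-zeros (c ∷ cs) a h = begin
    _ + base c * num cs _ a    ≡⟨ cong₂ (λ r q → r + base c * q) (h (here refl)) (num-zeros cs a (h ∘ there)) ⟩
    base c * (weight cs * a)   ≡⟨ ℕ.*-assoc (base c) (weight cs) a ⟨
    base c * weight cs * a     ∎
    where open ≡-Reasoning

  num-tops : ∀ cs {δ} a → (∀ {c} → c ∈ cs → suc (δ c) ≡ base c) → suc (num cs δ a) ≡ weight cs * suc a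
  num-tops []       a h = sym (ℕ.+-identityʳ (suc a))
  num-tops (c ∷ cs) {δ} a h = begin
    suc (δ c) + base c * num cs δ a  ≡⟨ cong (_+ base c * num cs δ a) (h (here refl)) ⟩
    base c + base c * num cs δ a     ≡⟨ ℕ.*-suc (base c) _ ⟨
    base c * suc (num cs δ a)        ≡⟨ cong (base c *_) (num-tops cs a (h ∘ there)) ⟩
    base c * (weight cs * suc a)     ≡⟨ ℕ.*-assoc (base c) (weight cs) (suc a) ⟨
    base c * weight cs * suc a       ∎
    where open ≡-Reasoning

  weight*≤num : ∀ cs δ a → weight cs * a ≤ num cs δ a
  weight*≤num []       δ a = ℕ.≤-reflexive (ℕ.+-identityʳ a)
  weight*≤num (c ∷ cs) δ a = begin
    base c * weight cs * a     ≡⟨ ℕ.*-assoc (base c) (weight cs) a ⟩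
    base c * (weight cs * a)   ≤⟨ ℕ.*-monoʳ-≤ (base c) (weight*≤num cs δ a) ⟩
    base c * num cs δ a        ≤⟨ ℕ.m≤n+m _ (δ c) ⟩
    δ c + base c * num cs δ a  ∎
    where open ℕ.≤-Reasoning

  num<weight* : ∀ cs {δ} → InRange cs δ → ∀ {a D} → a < D → num cs δ a < weight cs * D
  num<weight* []       δ< {a} {D} a<D = subst (a <_) (sym (ℕ.+-identityʳ D)) a<D
  num<weight* (c ∷ cs) {δ} δ< {a} {D} a<D = begin-strict
    δ c + base c * num cs δ a     <⟨ ℕ.+-monoˡ-< _ (δ< (here refl)) ⟩
    base c + base c * num cs δ a  ≡⟨ ℕ.*-suc (base c) _ ⟨
    base c * suc (num cs δ a)     ≤⟨ ℕ.*-monoʳ-≤ (base c) (num<weight* cs (δ< ∘ there) a<D) ⟩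
    base c * (weight cs * D)      ≡⟨ ℕ.*-assoc (base c) (weight cs) D ⟨
    base c * weight cs * D        ∎
    where open ℕ.≤-Reasoning

  -- A number within the tiling has its top value below the constant D, so that this value can index
  -- a relation symbol.
  num<⇒< : ∀ cs δ {a D} → num cs δ a < weight cs * D → a < D
  num<⇒< cs δ {a} {D} h = ℕ.*-cancelˡ-< (weight cs) a D (ℕ.≤-<-trans (weight*≤num cs δ a) h)

  -- Repeated division with remainder. Digits outside the list are inherited from `δ₀`, so that the
  -- numerals of the row and of the column can be entered into one assignment, one after the other.
  digits : (∀ c → NonZero (base c)) → ∀ {cs} → Unique cs → (δ₀ : Digits) → (∀ d → δ₀ d < base d) → ∀ t →
    Σ Digits λ δ → Σ ℕ λ a → (∀ d → δ d < base d) × num cs δ a ≡ t × (∀ {c} → c ∉ cs → δ c ≡ δ₀ c)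
  digits nz [] δ₀ δ₀< t = δ₀ , t , δ₀< , refl , λ _ → refl
  digits nz {c ∷ cs} (c∉ ∷ u) δ₀ δ₀< t with digits nz u δ₀ δ₀< ((t / base c) {{nz c}})
  ... | δ , a , δ< , e , out = δ [ c ↦ r ] , a , ↦-range {δ} c δ< r<b , value , out'
    where
    instance
      nzc : NonZero (base c)
      nzc = nz c
    r = t % base c
    r<b : r < base c
    r<b = m%n<n t (base c)
    value : num (c ∷ cs) (δ [ c ↦ r ]) a ≡ t
    value = begin
      (δ [ c ↦ r ]) c + base c * num cs (δ [ c ↦ r ]) a
        ≡⟨ cong₂ (λ r q → r + base c * q) (↦-same δ c r)
             (num-cong cs λ d∈ → ↦-other δ c r (λ d≡c → All.lookup c∉ d∈ (sym d≡c))) ⟩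
      r + base c * num cs δ a   ≡⟨ cong (λ q → r + base c * q) e ⟩
      r + base c * (t / base c) ≡⟨ cong (r +_) (ℕ.*-comm (base c) _) ⟩
      r + (t / base c) * base c ≡⟨ m≡m%n+[m/n]*n t (base c) ⟨
      t ∎
      where open ≡-Reasoning
    out' : ∀ {d} → d ∉ c ∷ cs → (δ [ c ↦ r ]) d ≡ δ₀ d
    out' d∉ = trans (↦-other δ c r (d∉ ∘ here)) (out (d∉ ∘ there))

-- First-order logic with a spare variable

record Code (A : Set) : Set where
  field
    size    : ℕ
    enc     : A → Fin size
    dec     : Fin size → A
    dec-enc : ∀ a → dec (enc a) ≡ a

  enc-injective : ∀ {a b} → enc a ≡ enc b → a ≡ b
  enc-injective {a} {b} eq = trans (sym (dec-enc a)) (trans (cong dec eq) (dec-enc b))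

  decEq : DecidableEquality A
  decEq a b = map′ enc-injective (cong enc) (enc a Fin.≟ enc b)

open Code

fin-code : ∀ n → Code (Fin n)
fin-code n = record { size = n ; enc = id ; dec = id ; dec-enc = λ _ → refl }

bool-code : Code Bool
bool-code = record
  { size = 2
  ; enc = λ { false → 0F ; true → 1F }
  ; dec = λ { 0F → false ; 1F → true }
  ; dec-enc = λ { false → refl ; true → refl } }

move-code : Code Move
move-code = record
  { size = 3
  ; enc = λ { L → 0F ; R → 1F ; S → 2F }
  ; dec = λ { 0F → L ; 1F → R ; 2F → S }
  ; dec-enc = λ { L → refl ; R → refl ; S → refl } }

infixr 4 _×-code_
infixr 3 _⊎-code_

_×-code_ : ∀ {A B} → Code A → Code B → Code (A × B)
_×-code_ {A} {B} α β = record
  { size = size α * size β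
  ; enc = λ (a , b) → combine (enc α a) (enc β b)
  ; dec = λ i → dec α (proj₁ (remQuot {size α} (size β) i)) , dec β (proj₂ (remQuot {size α} (size β) i))
  ; dec-enc = λ (a , b) → trans
      (cong (λ p → dec α (proj₁ p) , dec β (proj₂ p)) (Fin.remQuot-combine (enc α a) (enc β b)))
      (cong₂ _,_ (dec-enc α a) (dec-enc β b)) }

_⊎-code_ : ∀ {A B} → Code A → Code B → Code (A ⊎ B)
_⊎-code_ {A} {B} α β = record
  { size = size α + size β
  ; enc = λ x → join (size α) (size β) (Sum.map (enc α) (enc β) x)
  ; dec = λ i → Sum.map (dec α) (dec β) (splitAt (size α) i)
  ; dec-enc = λ x → trans
      (cong (Sum.map (dec α) (dec β)) (Fin.splitAt-join (size α) (size β) (Sum.map (enc α) (enc β) x)))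
      (decode x) }
  where
  decode : ∀ x → Sum.map (dec α) (dec β) (Sum.map (enc α) (enc β) x) ≡ x
  decode (inj₁ a) = cong inj₁ (dec-enc α a)
  decode (inj₂ b) = cong inj₂ (dec-enc β b)

retract-code : ∀ {A B : Set} (f : A → B) (g : B → A) → (∀ a → g (f a) ≡ a) → Code B → Code A
retract-code f g gf β = record
  { size = size β
  ; enc = enc β ∘ f
  ; dec = g ∘ dec β
  ; dec-enc = λ a → trans (cong g (dec-enc β (f a))) (gf a) }

vec-code : ∀ {A} → Code A → ∀ n → Code (Vec A n)
vec-code α zero = retract-code (λ _ → 0F) (λ _ → []) (λ { [] → refl }) (fin-code 1)
vec-code α (suc n) = retract-code (λ { (a ∷ v) → a , v }) (λ (a , v) → a ∷ v) (λ { (_ ∷ _) → refl })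
  (α ×-code vec-code α n)

data Var (k : ℕ) : Set where
  aux mix : Var k
  tv pv   : Fin k → Var k

infix 4 _≟ᵛ_

_≟ᵛ_ : ∀ {k} → DecidableEquality (Var k)
aux  ≟ᵛ aux  = yes refl
aux  ≟ᵛ mix  = no λ ()
aux  ≟ᵛ tv _ = no λ ()
aux  ≟ᵛ pv _ = no λ ()
mix  ≟ᵛ aux  = no λ ()
mix  ≟ᵛ mix  = yes refl
mix  ≟ᵛ tv _ = no λ ()
mix  ≟ᵛ pv _ = no λ ()
tv _ ≟ᵛ aux  = no λ ()
tv _ ≟ᵛ mix  = no λ ()
tv i ≟ᵛ tv j = map′ (cong tv) (λ { refl → refl }) (i Fin.≟ j)
tv _ ≟ᵛ pv _ = no λ ()
pv _ ≟ᵛ aux  = no λ ()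
pv _ ≟ᵛ mix  = no λ ()
pv _ ≟ᵛ tv _ = no λ ()
pv i ≟ᵛ pv j = map′ (cong pv) (λ { refl → refl }) (i Fin.≟ j)

upd : ∀ {k} {U : Set} → (Var k → U) → Var k → U → Var k → U
upd ρ x a y = if does (y ≟ᵛ x) then a else ρ y

upd-same : ∀ {k} {U : Set} (ρ : Var k → U) x a → upd ρ x a x ≡ a
upd-same ρ x a with x ≟ᵛ x
... | yes _ = refl
... | no x≢x = ⊥-elim (x≢x refl)

upd-other : ∀ {k} {U : Set} (ρ : Var k → U) x a y → y ≢ x → upd ρ x a y ≡ ρ y
upd-other ρ x a y y≢x with y ≟ᵛ x
... | yes y≡x = ⊥-elim (y≢x y≡x)
... | no _ = refl

-- An element of the universe is read as a digit in three ways: by its rank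
-- (std), or, as the code of a pair of numbers below √n, by the first (hi) or
-- second (lo) number.
pattern std = 0F
pattern hi  = 1F
pattern lo  = 2F

Fix : Set
Fix = (Fin 4 × Fin 3) ⊎ Fin 8

pattern stp κ  = inj₁ (0F , κ)
pattern wrp κ  = inj₁ (1F , κ)
pattern zer κ  = inj₁ (2F , κ)
pattern top κ  = inj₁ (3F , κ)
pattern less   = inj₂ 0F
pattern root   = inj₂ 1F
pattern pair   = inj₂ 2F
pattern child₀ = inj₂ 3F
pattern child₁ = inj₂ 4F
pattern bit₀   = inj₂ 5F
pattern bit₁   = inj₂ 6F
pattern path   = inj₂ 7F

module Logic (k' : ℕ) {TName : Set} (tcode : Code TName) where

  k K : ℕ
  k = suc (suc k')
  K = 2 + (k + k)

  V : Set
  V = Var k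

  infix  6 _≈_
  infixr 5 _∧ᶠ_
  infixr 4 _∨ᶠ_
  infixr 3 _⇒_

  -- Finite conjunctions and disjunctions run over any coded type, and decided propositions are
  -- atoms. This lets the axioms range over tiles; `tr` expands both into plain formulas.
  data Fm : Set₁ where
    _≈_            : V → V → Fm
    fix            : Fix → V → V → V → Fm
    til            : TName → Fm
    ⌜_⌝            : {A : Set} → Dec A → Fm
    _∧ᶠ_ _∨ᶠ_ _⇒_  : Fm → Fm → Fm
    ∃ᶠ ∀ᶠ          : V → Fm → Fm
    ⋀ ⋁            : {A : Set} → Code A → (A → Fm) → Fm

  -- The spare variable aux is not an argument of the tile relations.
  record Interp (n : ℕ) : Set₁ where
    field
      Fixᴵ    : Fix → Fin n → Fin n → Fin n → Set
      Fixᴵ?   : ∀ f a b c → Dec (Fixᴵ f a b c)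
      Tilᴵ    : TName → (V → Fin n) → Set
      Tilᴵ?   : ∀ r ρ → Dec (Tilᴵ r ρ)
      Tilᴵ-cong : ∀ r {ρ ρ'} → (∀ x → x ≢ aux → ρ x ≡ ρ' x) → Tilᴵ r ρ → Tilᴵ r ρ'

  ⟦_⟧ : ∀ {n} → Interp n → Fm → (V → Fin n) → Set
  ⟦ I ⟧ (x ≈ y)       ρ = ρ x ≡ ρ y
  ⟦ I ⟧ (fix f x y z) ρ = Interp.Fixᴵ I f (ρ x) (ρ y) (ρ z)
  ⟦ I ⟧ (til r)       ρ = Interp.Tilᴵ I r ρ
  ⟦ I ⟧ (⌜_⌝ {A} _)   ρ = A
  ⟦ I ⟧ (φ ∧ᶠ ψ)      ρ = ⟦ I ⟧ φ ρ × ⟦ I ⟧ ψ ρ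
  ⟦ I ⟧ (φ ∨ᶠ ψ)      ρ = ⟦ I ⟧ φ ρ ⊎ ⟦ I ⟧ ψ ρ
  ⟦ I ⟧ (φ ⇒ ψ)       ρ = ⟦ I ⟧ φ ρ → ⟦ I ⟧ ψ ρ
  ⟦ I ⟧ (∃ᶠ x φ)      ρ = ∃ λ a → ⟦ I ⟧ φ (upd ρ x a)
  ⟦ I ⟧ (∀ᶠ x φ)      ρ = ∀ a → ⟦ I ⟧ φ (upd ρ x a)
  ⟦ I ⟧ (⋀ {A} _ f)   ρ = (a : A) → ⟦ I ⟧ (f a) ρ
  ⟦ I ⟧ (⋁ {A} _ f)   ρ = Σ A λ a → ⟦ I ⟧ (f a) ρ

  -- Translation into formulas with 2k + 2 variables

  venc : V → Fin K
  venc aux    = 0F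
  venc mix    = 1F
  venc (tv i) = suc (suc (i ↑ˡ k))
  venc (pv i) = suc (suc (k ↑ʳ i))

  vdec : Fin K → V
  vdec 0F = aux
  vdec 1F = mix
  vdec (suc (suc j)) = [ tv , pv ]′ (splitAt k j)

  vdec-venc : ∀ x → vdec (venc x) ≡ x
  vdec-venc aux    = refl
  vdec-venc mix    = refl
  vdec-venc (tv i) = cong [ tv , pv ]′ (Fin.splitAt-↑ˡ k i k)
  vdec-venc (pv i) = cong [ tv , pv ]′ (Fin.splitAt-↑ʳ k k i)

  venc-injective : ∀ {x y} → venc x ≡ venc y → x ≡ y
  venc-injective {x} {y} eq = trans (sym (vdec-venc x)) (trans (cong vdec eq) (vdec-venc y))

  2+ᶠ : Fin (k + k) → Fin K
  2+ᶠ j = suc (suc j)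

  rcode : Code (Fix ⊎ TName)
  rcode = (fin-code 4 ×-code fin-code 3 ⊎-code fin-code 8) ⊎-code tcode

  -- All symbols have the same arity. Shorter argument lists are padded: those of the fixed
  -- relations by repeating the last argument, those of the tiles by putting `mix` also in the place
  -- of `aux`.
  σ : Vocab
  σ = voc (size rcode) (λ _ → K)

  fix-args : Fin K → Fin K → Fin K → Vec (Fin K) K
  fix-args x y z = x ∷ y ∷ z ∷ replicate _ z

  til-args : Vec (Fin K) K
  til-args = 1F ∷ tabulate suc

  ⊤ᶠ : Formula K σ
  ⊤ᶠ = 0F ≐ 0F

  bigAnd bigOr : ∀ m → (Fin m → Formula K σ) → Formula K σ
  bigAnd zero    f = ⊤ᶠ
  bigAnd (suc m) f = f zero ∧' bigAnd m (f ∘ suc)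
  bigOr zero    f = ¬' ⊤ᶠ
  bigOr (suc m) f = f zero ∨' bigOr m (f ∘ suc)

  tr : Fm → Formula K σ
  tr (x ≈ y)       = venc x ≐ venc y
  tr (fix f x y z) = rel (enc rcode (inj₁ f)) (fix-args (venc x) (venc y) (venc z))
  tr (til r)       = rel (enc rcode (inj₂ r)) til-args
  tr ⌜ d ⌝         = if does d then ⊤ᶠ else ¬' ⊤ᶠ
  tr (φ ∧ᶠ ψ)      = tr φ ∧' tr ψ
  tr (φ ∨ᶠ ψ)      = tr φ ∨' tr ψ
  tr (φ ⇒ ψ)       = ¬' (tr φ) ∨' tr ψ
  tr (∃ᶠ x φ)      = ∃' (venc x) (tr φ)
  tr (∀ᶠ x φ)      = ∀' (venc x) (tr φ)
  tr (⋀ α f)       = bigAnd (size α) (λ i → tr (f (dec α i)))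
  tr (⋁ α f)       = bigOr (size α) (λ i → tr (f (dec α i)))

  anyFin-reflects : ∀ {n} {P : Fin n → Set} {f : Fin n → Bool} →
    (∀ a → Reflects (P a) (f a)) → Reflects (∃ P) (anyFin f)
  anyFin-reflects {zero} r = ofⁿ λ ()
  anyFin-reflects {suc n} {P} {f} r with f zero | r zero
  ... | true  | ofʸ p = ofʸ (zero , p)
  ... | false | ofⁿ ¬p with anyFin (f ∘ suc) | anyFin-reflects {n} {P ∘ suc} {f ∘ suc} (r ∘ suc)
  ... | true  | ofʸ (a , p) = ofʸ (suc a , p)
  ... | false | ofⁿ ¬q = ofⁿ λ { (zero , p) → ¬p p ; (suc a , p) → ¬q (a , p) }

  allFin-reflects : ∀ {n} {P : Fin n → Set} {f : Fin n → Bool} →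
    (∀ a → Reflects (P a) (f a)) → Reflects (∀ a → P a) (allFin f)
  allFin-reflects {zero} r = ofʸ λ ()
  allFin-reflects {suc n} {P} {f} r with f zero | r zero
  ... | false | ofⁿ ¬p = ofⁿ λ q → ¬p (q zero)
  ... | true  | ofʸ p with allFin (f ∘ suc) | allFin-reflects {n} {P ∘ suc} {f ∘ suc} (r ∘ suc)
  ... | false | ofⁿ ¬q = ofⁿ λ q → ¬q (q ∘ suc)
  ... | true  | ofʸ q = ofʸ λ { zero → p ; (suc a) → q a }

  reflects-map : ∀ {P Q : Set} {b} → (P → Q) → (Q → P) → Reflects P b → Reflects Q b
  reflects-map f g (ofʸ p)  = ofʸ (f p)
  reflects-map f g (ofⁿ ¬p) = ofⁿ (¬p ∘ g)

  module _ {n : ℕ} (𝔄 : Structure σ n) where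

    ⊤ᶠ-true : ∀ ρ → eval 𝔄 ⊤ᶠ ρ ≡ true
    ⊤ᶠ-true ρ with ρ 0F Fin.≟ ρ 0F
    ... | yes _ = refl
    ... | no ρ≢ρ = ⊥-elim (ρ≢ρ refl)

    eval-bigAnd : ∀ m f ρ → eval 𝔄 (bigAnd m f) ρ ≡ allFin (λ i → eval 𝔄 (f i) ρ)
    eval-bigAnd zero    f ρ = ⊤ᶠ-true ρ
    eval-bigAnd (suc m) f ρ = cong (eval 𝔄 (f zero) ρ ∧_) (eval-bigAnd m (f ∘ suc) ρ)

    eval-bigOr : ∀ m f ρ → eval 𝔄 (bigOr m f) ρ ≡ anyFin (λ i → eval 𝔄 (f i) ρ)
    eval-bigOr zero    f ρ = cong not (⊤ᶠ-true ρ)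
    eval-bigOr (suc m) f ρ = cong (eval 𝔄 (f zero) ρ ∨_) (eval-bigOr m (f ∘ suc) ρ)

    record Realizes (I : Interp n) : Set where
      open Interp I
      field
        fix-reflects : ∀ f x y z ρ → Reflects (Fixᴵ f (ρ x) (ρ y) (ρ z))
          (𝔄 (enc rcode (inj₁ f)) (map ρ (fix-args x y z)))
        til-reflects : ∀ r ρ → Reflects (Tilᴵ r (ρ ∘ venc))
          (𝔄 (enc rcode (inj₂ r)) (map ρ til-args))

    module _ {I : Interp n} (real : Realizes I) where
      open Interp I
      open Realizes real

      upd-venc : ∀ {ρ : V → Fin n} {ρ' : Fin K → Fin n} x a → (∀ y → ρ' (venc y) ≡ ρ y) →
        ∀ y → (ρ' [ venc x ≔ a ]) (venc y) ≡ upd ρ x a y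
      upd-venc x a agree y with venc y Fin.≟ venc x | y ≟ᵛ x
      ... | yes _ | yes _ = refl
      ... | no _  | no _ = agree y
      ... | yes e | no y≢x = ⊥-elim (y≢x (venc-injective e))
      ... | no ≢  | yes refl = ⊥-elim (≢ refl)

      tr-reflects : ∀ φ ρ ρ' → (∀ x → ρ' (venc x) ≡ ρ x) →
        Reflects (⟦ I ⟧ φ ρ) (eval 𝔄 (tr φ) ρ')
      tr-reflects (x ≈ y) ρ ρ' agree =
        reflects-map (λ e → trans (sym (agree x)) (trans e (agree y)))
                     (λ e → trans (agree x) (trans e (sym (agree y))))
                     (proof (ρ' (venc x) Fin.≟ ρ' (venc y)))
      tr-reflects (fix f x y z) ρ ρ' agree
        rewrite sym (agree x) | sym (agree y) | sym (agree z) =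
        fix-reflects f (venc x) (venc y) (venc z) ρ'
      tr-reflects (til r) ρ ρ' agree =
        reflects-map (Tilᴵ-cong r (λ x _ → agree x)) (Tilᴵ-cong r (λ x _ → sym (agree x)))
          (til-reflects r ρ')
      tr-reflects ⌜ yes a ⌝ ρ ρ' agree rewrite ⊤ᶠ-true ρ' = ofʸ a
      tr-reflects ⌜ no ¬a ⌝ ρ ρ' agree rewrite ⊤ᶠ-true ρ' = ofⁿ ¬a
      tr-reflects (φ ∧ᶠ ψ) ρ ρ' agree = tr-reflects φ ρ ρ' agree ×-reflects tr-reflects ψ ρ ρ' agree
      tr-reflects (φ ∨ᶠ ψ) ρ ρ' agree = tr-reflects φ ρ ρ' agree ⊎-reflects tr-reflects ψ ρ ρ' agree
      tr-reflects (φ ⇒ ψ) ρ ρ' agree = tr-reflects φ ρ ρ' agree →-reflects tr-reflects ψ ρ ρ' agree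
      tr-reflects (∃ᶠ x φ) ρ ρ' agree =
        anyFin-reflects λ a → tr-reflects φ (upd ρ x a) _ (upd-venc {ρ} {ρ'} x a agree)
      tr-reflects (∀ᶠ x φ) ρ ρ' agree =
        allFin-reflects λ a → tr-reflects φ (upd ρ x a) _ (upd-venc {ρ} {ρ'} x a agree)
      tr-reflects (⋀ α f) ρ ρ' agree rewrite eval-bigAnd (size α) (λ i → tr (f (dec α i))) ρ' =
        reflects-map (λ h a → subst (λ a → ⟦ I ⟧ (f a) ρ) (dec-enc α a) (h (enc α a)))
                     (λ h i → h (dec α i))
                     (allFin-reflects λ i → tr-reflects (f (dec α i)) ρ ρ' agree)
      tr-reflects (⋁ α f) ρ ρ' agree rewrite eval-bigOr (size α) (λ i → tr (f (dec α i))) ρ' =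
        reflects-map (λ (i , h) → dec α i , h)
                     (λ (a , h) → enc α a , subst (λ a → ⟦ I ⟧ (f a) ρ) (sym (dec-enc α a)) h)
                     (anyFin-reflects λ i → tr-reflects (f (dec α i)) ρ ρ' agree)

  -- Universal closure, and passage between structures and interpretations

  close : List (Fin K) → Formula K σ → Formula K σ
  close []       φ = φ
  close (x ∷ xs) φ = ∀' x (close xs φ)

  all-bound-closed : ∀ {bd} → (∀ x → bd x ≡ true) → (φ : Formula K σ) → ClosedUnder bd φ
  all-bound-closed b (x ≐ y)    = b x , b y
  all-bound-closed b (rel i xs) = λ j → b (lookup xs j)
  all-bound-closed b (¬' φ)     = all-bound-closed b φ
  all-bound-closed b (φ ∧' ψ)   = all-bound-closed b φ , all-bound-closed b ψ
  all-bound-closed b (φ ∨' ψ)   = all-bound-closed b φ , all-bound-closed b ψ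
  all-bound-closed b (∃' x φ)   =
    all-bound-closed (λ y → trans (cong (does (y Fin.≟ x) ∨_) (b y)) (Bool.∨-zeroʳ _)) φ
  all-bound-closed b (∀' x φ)   =
    all-bound-closed (λ y → trans (cong (does (y Fin.≟ x) ∨_) (b y)) (Bool.∨-zeroʳ _)) φ

  close-closed : ∀ {bd} xs → (∀ x → x ∈ xs ⊎ bd x ≡ true) → ∀ φ → ClosedUnder bd (close xs φ)
  close-closed []       b φ = all-bound-closed (λ x → case b x of λ { (inj₁ ()) ; (inj₂ e) → e }) φ
  close-closed {bd} (x ∷ xs) b φ = close-closed xs b' φ
    where
    b' : ∀ y → y ∈ xs ⊎ does (y Fin.≟ x) ∨ bd y ≡ true
    b' y with b y
    ... | inj₁ (there y∈xs) = inj₁ y∈xs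
    ... | inj₂ e = inj₂ (trans (cong (does (y Fin.≟ x) ∨_) e) (Bool.∨-zeroʳ _))
    ... | inj₁ (here refl) with y Fin.≟ y
    ...   | yes _ = inj₂ refl
    ...   | no y≢y = ⊥-elim (y≢y refl)

  -- The tile axioms are written for one point of the diagram, whose coordinates are free variables;
  -- the closure imposes them at every point.
  sentence : Fm → Formula K σ
  sentence φ = close (List.allFin K) (tr φ)

  sentence-closed : ∀ φ → Sentence (sentence φ)
  sentence-closed φ = close-closed (List.allFin K) (λ x → inj₁ (∈-allFin x)) (tr φ)

  allFin-true : ∀ {n} (f : Fin n → Bool) → allFin f ≡ true → ∀ a → f a ≡ true
  allFin-true f e zero    with f zero
  ... | true = refl
  allFin-true f e (suc a) with f zero
  ... | true = allFin-true (f ∘ suc) e a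

  allFin-intro : ∀ {n} (f : Fin n → Bool) → (∀ a → f a ≡ true) → allFin f ≡ true
  allFin-intro {zero}  f h = refl
  allFin-intro {suc n} f h rewrite h zero = allFin-intro (f ∘ suc) (h ∘ suc)

  -- Each quantifier is instantiated with the value that the assignment already has. Updating by
  -- this value is the identity only pointwise, hence the second assignment.
  close-elim : ∀ {n} (𝔄 : Structure σ n) xs φ ρ → eval 𝔄 (close xs φ) ρ ≡ true →
    ∃ λ ρ' → (∀ x → ρ' x ≡ ρ x) × eval 𝔄 φ ρ' ≡ true
  close-elim 𝔄 [] φ ρ e = ρ , (λ _ → refl) , e
  close-elim 𝔄 (x ∷ xs) φ ρ e with close-elim 𝔄 xs φ (ρ [ x ≔ ρ x ]) (allFin-true _ e (ρ x))
  ... | ρ' , agree , t = ρ' , (λ y → trans (agree y) (idle y)) , t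
    where
    idle : ∀ y → (ρ [ x ≔ ρ x ]) y ≡ ρ y
    idle y with y Fin.≟ x
    ... | yes refl = refl
    ... | no _ = refl

  close-intro : ∀ {n} (𝔄 : Structure σ n) xs φ → (∀ ρ → eval 𝔄 φ ρ ≡ true) →
    ∀ ρ → eval 𝔄 (close xs φ) ρ ≡ true
  close-intro 𝔄 []       φ h ρ = h ρ
  close-intro 𝔄 (x ∷ xs) φ h ρ = allFin-intro _ λ a → close-intro 𝔄 xs φ h (ρ [ x ≔ a ])

  reflects-true : ∀ {P : Set} {b} → Reflects P b → b ≡ true → P
  reflects-true (ofʸ p) _ = p

  true-reflects : ∀ {P : Set} {b} → Reflects P b → P → b ≡ true
  true-reflects (ofʸ _)  _ = refl
  true-reflects (ofⁿ ¬p) p = ⊥-elim (¬p p)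

  -- The number 0F of `aux` does not occur in `til-args`. Its value here is a default that keeps
  -- `aux` out of the range, so that agreement of two assignments off `aux` carries over to all
  -- arguments.
  shift : Fin K → V
  shift 0F = mix
  shift (suc j) = vdec (suc j)

  shift-aux : ∀ x → shift x ≢ aux
  shift-aux 0F ()
  shift-aux 1F ()
  shift-aux (suc (suc j)) e with splitAt k j
  shift-aux (suc (suc j)) () | inj₁ _
  shift-aux (suc (suc j)) () | inj₂ _

  module _ {n : ℕ} (𝔄 : Structure σ n) where

    interp : Interp n
    interp = record
      { Fixᴵ  = λ f a b c → 𝔄 (enc rcode (inj₁ f)) (a ∷ b ∷ c ∷ replicate _ c) ≡ true
      ; Fixᴵ? = λ f a b c → _ Bool.≟ true
      ; Tilᴵ  = λ r ρ → 𝔄 (enc rcode (inj₂ r)) (map (ρ ∘ shift) til-args) ≡ true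
      ; Tilᴵ? = λ r ρ → _ Bool.≟ true
      ; Tilᴵ-cong = λ r {ρ} {ρ'} agree t → trans
          (cong (𝔄 (enc rcode (inj₂ r))) (sym (Vec.map-cong (λ x → agree (shift x) (shift-aux x)) til-args))) t }

    ≡true-reflects : ∀ b → Reflects (b ≡ true) b
    ≡true-reflects true  = ofʸ refl
    ≡true-reflects false = ofⁿ λ ()

    venc-vdec : ∀ x → venc (vdec x) ≡ x
    venc-vdec 0F = refl
    venc-vdec 1F = refl
    venc-vdec (suc (suc j)) with splitAt k j in eq
    ... | inj₁ i = cong 2+ᶠ (Fin.splitAt⁻¹-↑ˡ {k} {k} {j} eq)
    ... | inj₂ i = cong 2+ᶠ (Fin.splitAt⁻¹-↑ʳ {k} {k} {j} eq)

    interp-realized : Realizes 𝔄 interp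
    interp-realized = record
      { fix-reflects = λ f x y z ρ →
          subst (λ v → Reflects (Interp.Fixᴵ interp f (ρ x) (ρ y) (ρ z))
                         (𝔄 (enc rcode (inj₁ f)) (ρ x ∷ ρ y ∷ ρ z ∷ v)))
                (sym (Vec.map-replicate ρ z _)) (≡true-reflects _)
      ; til-reflects = λ r ρ →
          subst (λ v → Reflects (𝔄 (enc rcode (inj₂ r)) (ρ 1F ∷ v) ≡ true)
                          (𝔄 (enc rcode (inj₂ r)) (map ρ til-args)))
                (trans (sym (Vec.tabulate-∘ ρ suc))
                  (trans (sym (Vec.tabulate-cong (λ j → cong ρ (venc-vdec (suc j)))))
                    (Vec.tabulate-∘ (ρ ∘ venc ∘ shift) suc)))
                (≡true-reflects _) }

    model-sound : ∀ φ → 𝔄 ⊨ sentence φ → ∀ ρ → ⟦ interp ⟧ φ ρ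
    model-sound φ sat ρ with close-elim 𝔄 (List.allFin K) (tr φ) (ρ ∘ vdec) (sat (ρ ∘ vdec))
    ... | ρ' , agree , t = reflects-true
      (tr-reflects 𝔄 interp-realized φ ρ ρ' (λ x → trans (agree (venc x)) (cong ρ (vdec-venc x)))) t

  module _ {n : ℕ} (I : Interp n) where
    open Interp I

    decide : Fix ⊎ TName → Vec (Fin n) K → Bool
    decide (inj₁ f) (a ∷ b ∷ c ∷ _) = does (Fixᴵ? f a b c)
    decide (inj₂ r) v               = does (Tilᴵ? r (lookup v ∘ venc))

    structure : Structure σ n
    structure i v = decide (dec rcode i) v

    structure-realizes : Realizes structure I
    structure-realizes = record { fix-reflects = fix-case ; til-reflects = til-case }
      where
      fix-case : ∀ f x y z ρ → Reflects (Fixᴵ f (ρ x) (ρ y) (ρ z))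
        (structure (enc rcode (inj₁ f)) (map ρ (fix-args x y z)))
      fix-case f x y z ρ = subst (λ i → Reflects (Fixᴵ f (ρ x) (ρ y) (ρ z)) (decide i (map ρ (fix-args x y z))))
        (sym (dec-enc rcode (inj₁ f))) (proof (Fixᴵ? f (ρ x) (ρ y) (ρ z)))
      til-lookup : ∀ (ρ : Fin K → Fin n) x → x ≢ aux → lookup (map ρ til-args) (venc x) ≡ ρ (venc x)
      til-lookup ρ aux x≢aux = ⊥-elim (x≢aux refl)
      til-lookup ρ mix _ = refl
      til-lookup ρ (tv i) _ = trans (Vec.lookup-map (i ↑ˡ k) ρ (tabulate 2+ᶠ)) (cong ρ (Vec.lookup∘tabulate 2+ᶠ (i ↑ˡ k)))
      til-lookup ρ (pv i) _ = trans (Vec.lookup-map (k ↑ʳ i) ρ (tabulate 2+ᶠ)) (cong ρ (Vec.lookup∘tabulate 2+ᶠ (k ↑ʳ i)))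
      til-case : ∀ r ρ → Reflects (Tilᴵ r (ρ ∘ venc)) (structure (enc rcode (inj₂ r)) (map ρ til-args))
      til-case r ρ = subst (λ i → Reflects (Tilᴵ r (ρ ∘ venc)) (decide i (map ρ til-args))) (sym (dec-enc rcode (inj₂ r)))
        (reflects-map (Tilᴵ-cong r (λ x ≢ → til-lookup ρ x ≢)) (Tilᴵ-cong r (λ x ≢ → sym (til-lookup ρ x ≢)))
          (proof (Tilᴵ? r (lookup (map ρ til-args) ∘ venc))))

    model-complete : ∀ φ → (∀ ρ → ⟦ I ⟧ φ ρ) → structure ⊨ sentence φ
    model-complete φ h = close-intro structure (List.allFin K) (tr φ) λ ρ' →
      true-reflects (tr-reflects structure structure-realizes φ (ρ' ∘ venc) ρ' (λ _ → refl)) (h (ρ' ∘ venc))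

-- Runs of Turing machines as tilings

look : List Bool → ℕ → Maybe Bool
look [] _ = nothing
look (b ∷ bs) zero = just b
look (b ∷ bs) (suc i) = look bs i

-- `scan` is the function local to `inputTape`, which has no accessible name;
-- it is found by unification in `scan-≡`.
mutual
  scan : (M : NTM) → List Bool → ℕ → List Bool → ℕ → Γ M
  scan = _

  scan-≡ : ∀ M b bs i → inputTape M (b ∷ bs) (ℤ.+ suc i) ≡ scan M (b ∷ bs) (suc i) bs i
  scan-≡ M b bs i with b ∷ bs | suc i
  ... | _ | _ = refl

scan-look : ∀ M w₀ i₀ w i → scan M w₀ i₀ w i ≡ maybe′ (bitSym M) (blank M) (look w i)
scan-look M w₀ i₀ [] i = refl
scan-look M w₀ i₀ (b ∷ bs) zero = refl
scan-look M w₀ i₀ (b ∷ bs) (suc i) = scan-look M w₀ i₀ bs i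

inputTape-look : ∀ M w i → inputTape M w (ℤ.+ i) ≡ maybe′ (bitSym M) (blank M) (look w i)
inputTape-look M w i = scan-look M w i w i

-- All that the logic has to know of the machine. The constraints are decidable because they are
-- evaluated while the sentence is being written; only their truth values enter it.
record TileSystem : Set₁ where
  field
    Tile      : Set
    tile-code : Code Tile
    Good First Last Start Halt : Tile → Set
    Horiz Vert : Tile → Tile → Set
    Sym  : Maybe Bool → Tile → Set
    Head : Bool → Tile → Set
    good?  : ∀ x → Dec (Good x)
    first? : ∀ x → Dec (First x)
    last?  : ∀ x → Dec (Last x)
    start? : ∀ x → Dec (Start x)
    halt?  : ∀ x → Dec (Halt x)
    horiz? : ∀ x y → Dec (Horiz x y)
    vert?  : ∀ x y → Dec (Vert x y)
    sym?   : ∀ m x → Dec (Sym m x)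
    head?  : ∀ b x → Dec (Head b x)

-- Tilings of o rows (time) by 2o columns (tape cells), the input word being
-- written from column o on in row 0.  The rows t on which the constraints are
-- imposed are given by ok, so that infinitely many rows are possible too.
record Tiling (𝒯 : TileSystem) (ok : ℕ → Set) (o : ℕ) (w : List Bool) : Set where
  open TileSystem 𝒯
  field
    τ     : ℕ → ℕ → Tile
    good  : ∀ {t p} → ok t → p < o + o → Good (τ t p)
    vert  : ∀ {t p} → ok (suc t) → p < o + o → Vert (τ t p) (τ (suc t) p)
    horiz : ∀ {t p} → ok t → suc p < o + o → Horiz (τ t p) (τ t (suc p))
    first : ∀ {t} → ok t → First (τ t 0)
    last  : ∀ {t p} → ok t → suc p ≡ o + o → Last (τ t p)
    started : ∀ {p} → p < o + o → Start (τ 0 p)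
    head  : ∀ {p} → p < o + o → Head (p ≡ᵇ o) (τ 0 p)
    input : ∀ {i} → o + i < o + o → Sym (look w i) (τ 0 (o + i))
    left  : ∀ {p} → p < o → Sym nothing (τ 0 p)
    halt  : ∀ {t p} → suc t ≡ o → p < o + o → Halt (τ t p)

lookup-ext : ∀ {A : Set} {n} {xs ys : Vec A n} → (∀ j → lookup xs j ≡ lookup ys j) → xs ≡ ys
lookup-ext {xs = xs} {ys} h =
  trans (sym (Vec.tabulate∘lookup xs)) (trans (Vec.tabulate-cong h) (Vec.tabulate∘lookup ys))

≡ᵇ-refl : ∀ m → (m ≡ᵇ m) ≡ true
≡ᵇ-refl zero = refl
≡ᵇ-refl (suc m) = ≡ᵇ-refl m

<⇒≡ᵇ-false : ∀ {m n} → m < n → (n ≡ᵇ m) ≡ false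
<⇒≡ᵇ-false {zero}  (s≤s _) = refl
<⇒≡ᵇ-false {suc m} (s≤s h) = <⇒≡ᵇ-false h

<⇒≡ᵇ-falseˡ : ∀ {m n} → m < n → (m ≡ᵇ n) ≡ false
<⇒≡ᵇ-falseˡ {zero}  (s≤s _) = refl
<⇒≡ᵇ-falseˡ {suc m} (s≤s h) = <⇒≡ᵇ-falseˡ h

module TM (M : NTM) where
  open NTM M
  open Config

  H : ℕ
  H = suc tapes

  Act : Set
  Act = Fin states × Vec (Γ M × Move) H

  act-code : Code Act
  act-code = fin-code states ×-code vec-code (fin-code (3 + extra) ×-code move-code) H

  -- The global data of a configuration, copied into every tile of its row and kept constant by
  -- `Horiz`. The nondeterministic choice `ac` is thus made once per row and is known wherever a
  -- head stands.
  record Row : Set where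
    constructor row
    field
      st : Fin states
      rd : Vec (Γ M) H
      ac : Act
      ht : Bool
  open Row

  -- hp, hc, hn: is the head on the previous, this, the next cell?
  record MTile : Set where
    constructor tile
    field
      rw       : Row
      sy       : Vec (Γ M) H
      hp hc hn : Vec Bool H
  open MTile

  row-code : Code Row
  row-code = retract-code (λ r → st r , rd r , ac r , ht r) (λ (a , b , c , d) → row a b c d) (λ _ → refl)
    (fin-code states ×-code vec-code (fin-code (3 + extra)) H ×-code act-code ×-code bool-code)

  mtile-code : Code MTile
  mtile-code = retract-code (λ x → rw x , sy x , hp x , hc x , hn x) (λ (a , b , c , d , e) → tile a b c d e)
    (λ _ → refl)
    (row-code ×-code vec-code (fin-code (3 + extra)) H
      ×-code vec-code bool-code H ×-code vec-code bool-code H ×-code vec-code bool-code H)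

  written : MTile → Fin H → Γ M
  written x j = proj₁ (lookup (proj₂ (ac (rw x))) j)

  mv : MTile → Fin H → Move
  mv x j = proj₂ (lookup (proj₂ (ac (rw x))) j)

  -- A head that moves left arrives here from the next cell, one that moves right from the previous
  -- cell.
  moved : Move → Bool → Bool → Bool → Bool
  moved L p c n = n
  moved R p c n = p
  moved S p c n = c

  private
    _≟b_ = Bool._≟_
    _≟m_ = Code.decEq move-code

  M-tiles : TileSystem
  M-tiles = record
    { Tile = MTile
    ; tile-code = mtile-code
    ; Good  = λ x → (ht (rw x) ≡ true → accept (st (rw x)) ≡ true)
                  × (ht (rw x) ≡ false → ac (rw x) ∈ δ (st (rw x)) (rd (rw x)))
                  × (∀ j → lookup (hc x) j ≡ true → lookup (sy x) j ≡ lookup (rd (rw x)) j)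
    ; First = λ x → ∀ j → lookup (hp x) j ≡ false × ¬ (lookup (hc x) j ≡ true × mv x j ≡ L)
    ; Last  = λ x → ∀ j → lookup (hn x) j ≡ false × ¬ (lookup (hc x) j ≡ true × mv x j ≡ R)
    ; Start = λ x → st (rw x) ≡ start × (∀ j → lookup (sy x) (suc j) ≡ blank M)
    ; Halt  = λ x → ht (rw x) ≡ true
    ; Horiz = λ x y → rw x ≡ rw y
                    × (∀ j → lookup (hc x) j ≡ lookup (hp y) j × lookup (hn x) j ≡ lookup (hc y) j)
    -- A halted row is already a proof of acceptance, and so it puts no condition on the row after
    -- it.
    ; Vert  = λ x y → ht (rw x) ≡ false →
        st (rw y) ≡ proj₁ (ac (rw x))
        × (∀ j → lookup (sy y) j ≡ (if lookup (hc x) j then written x j else lookup (sy x) j)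
               × lookup (hc y) j ≡ moved (mv x j) (lookup (hp x) j) (lookup (hc x) j) (lookup (hn x) j))
    ; Sym   = λ m x → lookup (sy x) zero ≡ maybe′ (bitSym M) (blank M) m
    ; Head  = λ b x → ∀ j → lookup (hc x) j ≡ b
    ; good?  = λ x → (ht (rw x) ≟b true →-dec accept (st (rw x)) ≟b true)
        ×-dec (ht (rw x) ≟b false →-dec DecMembership._∈?_ (Code.decEq act-code) (ac (rw x)) _)
        ×-dec Fin.all? λ j → lookup (hc x) j ≟b true →-dec lookup (sy x) j Fin.≟ lookup (rd (rw x)) j
    ; first? = λ x → Fin.all? λ j →
        lookup (hp x) j ≟b false ×-dec ¬? (lookup (hc x) j ≟b true ×-dec mv x j ≟m L)
    ; last?  = λ x → Fin.all? λ j →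
        lookup (hn x) j ≟b false ×-dec ¬? (lookup (hc x) j ≟b true ×-dec mv x j ≟m R)
    ; start? = λ x → st (rw x) Fin.≟ start ×-dec Fin.all? λ j → lookup (sy x) (suc j) Fin.≟ blank M
    ; halt?  = λ x → ht (rw x) ≟b true
    ; horiz? = λ x y → Code.decEq row-code (rw x) (rw y) ×-dec Fin.all? λ j →
        lookup (hc x) j ≟b lookup (hp y) j ×-dec lookup (hn x) j ≟b lookup (hc y) j
    ; vert?  = λ x y → ht (rw x) ≟b false →-dec
        (st (rw y) Fin.≟ proj₁ (ac (rw x)) ×-dec Fin.all? λ j →
          lookup (sy y) j Fin.≟ _ ×-dec lookup (hc y) j ≟b _)
    ; sym?   = λ m x → lookup (sy x) zero Fin.≟ _
    ; head?  = λ b x → Fin.all? λ j → lookup (hc x) j ≟b b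
    }

  module _ (o : ℕ) where

    -- The columns show the cells from -o to o - 1. A head starting at cell 0, in column `o`, cannot
    -- leave them in fewer than `o` steps.
    pos : ℕ → ℤ
    pos p = p ⊖ o

    pos-suc : ∀ p → pos (suc p) ≡ pos p ℤ.+ ℤ.+ 1
    pos-suc p = sym (trans (ℤ.distribˡ-⊖-+-pos 1 p o) (cong (_⊖ o) (ℕ.+-comm p 1)))

    +1-1 : ∀ z → z ℤ.+ ℤ.+ 1 ℤ.- ℤ.+ 1 ≡ z
    +1-1 z = trans (ℤ.+-assoc z (ℤ.+ 1) (ℤ.- ℤ.+ 1)) (ℤ.+-identityʳ z)

    -1+1 : ∀ z → z ℤ.- ℤ.+ 1 ℤ.+ ℤ.+ 1 ≡ z
    -1+1 z = trans (ℤ.+-assoc z (ℤ.- ℤ.+ 1) (ℤ.+ 1)) (ℤ.+-identityʳ z)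

    pos-pred : ∀ p → pos (suc p) ℤ.- ℤ.+ 1 ≡ pos p
    pos-pred p = trans (cong (ℤ._- ℤ.+ 1) (pos-suc p)) (+1-1 (pos p))

    pos-injective : ∀ {p q} → pos p ≡ pos q → p ≡ q
    pos-injective {p} {q} e with ℕ.<-cmp p q
    ... | tri< p<q _ _ = ⊥-elim (ℤ.<-irrefl e (ℤ.⊖-monoˡ-< o p<q))
    ... | tri≈ _ p≡q _ = p≡q
    ... | tri> _ _ q<p = ⊥-elim (ℤ.<-irrefl (sym e) (ℤ.⊖-monoˡ-< o q<p))

    pos-≥ : ∀ i → pos (o + i) ≡ ℤ.+ i
    pos-≥ i = trans (ℤ.⊖-≥ (ℕ.m≤m+n o i)) (cong ℤ.+_ (ℕ.m+n∸m≡n o i))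

    inputTape-< : ∀ w {p} → p < o → inputTape M w (pos p) ≡ blank M
    inputTape-< w {p} p<o with o ℕ.∸ p | ℤ.⊖-< p<o | ℕ.m<n⇒0<n∸m p<o
    ... | suc m | e | _ rewrite e = refl

    pos-o : pos o ≡ ℤ.+ 0
    pos-o = ℤ.n⊖n≡0 o

    does-pos : ∀ p q → does (pos p ℤ.≟ pos q) ≡ (p ≡ᵇ q)
    does-pos p q = does-⇔ (mk⇔ pos-injective (cong pos)) (pos p ℤ.≟ pos q) (p ℕ.≟ q)

    snoc : ∀ {t c c'} tr → Reach M t c c' → tr ∈ δ (state c') (read M c') → Reach M (suc t) c (apply M tr c')
    snoc tr done m = step tr m done
    snoc tr (step tr' m' r) m = step tr' m' (snoc tr r m)

    -- From a tiling to an accepting run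

    module Sound (0<o : 0 < o) {w} (𝒯 : Tiling M-tiles (_< o) o w) where
      open Tiling 𝒯

      0<2o : 0 < o + o
      0<2o = ℕ.<-≤-trans 0<o (ℕ.m≤m+n o o)

      row-const : ∀ {t} p → t < o → p < o + o → rw (τ t p) ≡ rw (τ t 0)
      row-const zero    t<o p< = refl
      row-const (suc p) t<o p< =
        trans (sym (proj₁ (horiz t<o p<))) (row-const p t<o (ℕ.<-trans (ℕ.n<1+n p) p<))

      -- The tapes are compared on the visible cells only. By `hpos<` these are the only cells that
      -- are read or written.
      record Matches (t : ℕ) (c : Config M) : Set where
        field
          hpos    : Fin H → ℕ
          hpos<   : ∀ j → hpos j < o + o
          heads≡  : ∀ j → lookup (heads c) j ≡ pos (hpos j)
          state≡  : ∀ {p} → p < o + o → st (rw (τ t p)) ≡ state c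
          symbol≡ : ∀ {p} → p < o + o → ∀ j → lookup (sy (τ t p)) j ≡ lookup (tape c) j (pos p)
          head≡   : ∀ {p} → p < o + o → ∀ j → lookup (hc (τ t p)) j ≡ (p ≡ᵇ hpos j)

      matches-initial : Matches 0 (initial M w)
      matches-initial = record
        { hpos    = λ _ → o
        ; hpos<   = λ _ → o<2o
        ; heads≡  = λ j → trans (Vec.lookup-replicate j (ℤ.+ 0)) (sym pos-o)
        ; state≡  = λ p< → proj₁ (started p<)
        ; symbol≡ = symbol
        ; head≡   = λ p< j → head p< j }
        where
        o<2o : o < o + o
        o<2o = ℕ.m<m+n o 0<o
        symbol : ∀ {p} → p < o + o → ∀ j →
          lookup (sy (τ 0 p)) j ≡ lookup (tape (initial M w)) j (pos p)
        symbol {p} p< zero with ℕ.<-≤-connex p o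
        ... | inj₁ p<o = trans (left p<o) (sym (inputTape-< w p<o))
        ... | inj₂ o≤p with ℕ.m≤n⇒∃[o]m+o≡n o≤p
        ...   | i , refl = trans (input p<) (sym (trans (cong (inputTape M w) (pos-≥ i)) (inputTape-look M w i)))
        symbol {p} p< (suc j) = trans (proj₂ (started p<) j)
          (sym (cong (λ f → f (pos p)) (Vec.lookup-replicate j (λ _ → blank M))))

      module Step {t} (t+1<o : suc t < o) {c} (m : Matches t c) (running : ht (rw (τ t 0)) ≡ false) where
        open Matches m

        t<o : t < o
        t<o = ℕ.<-trans (ℕ.n<1+n t) t+1<o

        r : Row
        r = rw (τ t 0)

        running-at : ∀ {p} → p < o + o → ht (rw (τ t p)) ≡ false
        running-at {p} p< = trans (cong ht (row-const p t<o p<)) running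

        head-here : ∀ j → lookup (hc (τ t (hpos j))) j ≡ true
        head-here j = trans (head≡ (hpos< j) j) (≡ᵇ-refl (hpos j))

        rd≡read : rd r ≡ read M c
        rd≡read = lookup-ext λ j → begin
          lookup (rd r) j                          ≡⟨ cong (λ r → lookup (rd r) j) (row-const (hpos j) t<o (hpos< j)) ⟨
          lookup (rd (rw (τ t (hpos j)))) j        ≡⟨ proj₂ (proj₂ (good t<o (hpos< j))) j (head-here j) ⟨
          lookup (sy (τ t (hpos j))) j             ≡⟨ symbol≡ (hpos< j) j ⟩
          lookup (tape c) j (pos (hpos j))         ≡⟨ cong (lookup (tape c) j) (heads≡ j) ⟨
          lookup (tape c) j (lookup (heads c) j)   ≡⟨ Vec.lookup-zipWith (λ f p → f p) j (tape c) (heads c) ⟨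
          lookup (read M c) j                      ∎
          where open ≡-Reasoning

        admissible : ac r ∈ δ (state c) (read M c)
        admissible = subst₂ (λ q a → ac r ∈ δ q a) (state≡ 0<2o) rd≡read
          (proj₁ (proj₂ (good t<o 0<2o)) running)

        c⁺ : Config M
        c⁺ = apply M (ac r) c

        act : Fin H → Γ M × Move
        act j = lookup (proj₂ (ac r)) j

        act-at : ∀ {p} → p < o + o → ∀ j → lookup (proj₂ (ac (rw (τ t p)))) j ≡ act j
        act-at {p} p< j = cong (λ r → lookup (proj₂ (ac r)) j) (row-const p t<o p<)

        -- The constraints in the first and the last column keep the heads inside the tiling.
        Moved : Fin H → Move → Set
        Moved j m = Σ ℕ λ h → h < o + o × pos h ≡ move M m (pos (hpos j))
          × (∀ {p} → p < o + o →
              moved m (lookup (hp (τ t p)) j) (lookup (hc (τ t p)) j) (lookup (hn (τ t p)) j) ≡ (p ≡ᵇ h))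

        move-head : ∀ j m → proj₂ (act j) ≡ m → Moved j m
        move-head j S e = hpos j , hpos< j , refl , λ p< → head≡ p< j
        -- The facts about `hpos j` are abstracted along with it: in column 0 the move contradicts
        -- `First`, and elsewhere the new position is the predecessor.
        move-head j L e with hpos j | hpos< j | head≡ {hpos j} (hpos< j) j | (λ {p} p< → head≡ {p} p< j)
        ... | zero  | _  | at | _ = ⊥-elim (proj₂ (first t<o j) (at , trans (cong proj₂ (act-at 0<2o j)) e))
        ... | suc q | q< | _  | hd = q , q<2o , sym (pos-pred q) , new
          where
          q<2o = ℕ.<-trans (ℕ.n<1+n q) q<
          new : ∀ {p} → p < o + o → lookup (hn (τ t p)) j ≡ (p ≡ᵇ q)
          new {p} p< with ℕ.m≤n⇒m<n∨m≡n p<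
          ... | inj₁ p+1< = trans (proj₂ (proj₂ (horiz t<o p+1<) j)) (hd p+1<)
          ... | inj₂ p+1≡ = trans (proj₁ (last t<o p+1≡ j))
            (sym (<⇒≡ᵇ-false (ℕ.≤-pred (subst (suc q <_) (sym p+1≡) q<))))
        move-head j R e with ℕ.m≤n⇒m<n∨m≡n (hpos< j)
        ... | inj₂ h+1≡ = ⊥-elim (proj₂ (last t<o h+1≡ j) (head-here j , trans (cong proj₂ (act-at (hpos< j) j)) e))
        ... | inj₁ h+1< = suc (hpos j) , h+1< , pos-suc (hpos j) , new
          where
          new : ∀ {p} → p < o + o → lookup (hp (τ t p)) j ≡ (p ≡ᵇ suc (hpos j))
          new {zero} p< = proj₁ (first t<o j)
          new {suc p} p< = trans (sym (proj₁ (proj₂ (horiz t<o p<) j))) (head≡ (ℕ.<-trans (ℕ.n<1+n p) p<) j)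

        moved-head : ∀ j → Moved j (proj₂ (act j))
        moved-head j = move-head j (proj₂ (act j)) refl

        matches-step : Matches (suc t) c⁺
        matches-step = record
          { hpos = λ j → proj₁ (moved-head j)
          ; hpos< = λ j → proj₁ (proj₂ (moved-head j))
          ; heads≡ = λ j → trans (Vec.lookup-zipWith _ j (proj₂ (ac r)) (heads c))
              (trans (cong (move M (proj₂ (act j))) (heads≡ j)) (sym (proj₁ (proj₂ (proj₂ (moved-head j))))))
          ; state≡ = λ {p} p< → trans (proj₁ (vert t+1<o p< (running-at p<)))
              (cong (λ r → proj₁ (ac r)) (row-const p t<o p<))
          ; symbol≡ = symbol
          ; head≡ = λ {p} p< j → trans (proj₂ (proj₂ (vert t+1<o p< (running-at p<)) j))
              (trans (cong (λ a → moved (proj₂ a) (lookup (hp (τ t p)) j) (lookup (hc (τ t p)) j) (lookup (hn (τ t p)) j))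
                       (act-at p< j))
                (proj₂ (proj₂ (proj₂ (moved-head j))) p<)) }
          where
          symbol : ∀ {p} → p < o + o → ∀ j → lookup (sy (τ (suc t) p)) j ≡ lookup (tape c⁺) j (pos p)
          symbol {p} p< j = begin
            lookup (sy (τ (suc t) p)) j
              ≡⟨ proj₁ (proj₂ (vert t+1<o p< (running-at p<)) j) ⟩
            (if lookup (hc (τ t p)) j then written (τ t p) j else lookup (sy (τ t p)) j)
              ≡⟨ cong (λ b → if b then written (τ t p) j else lookup (sy (τ t p)) j)
                   (trans (head≡ p< j) (sym (does-pos p (hpos j)))) ⟩
            (if does (pos p ℤ.≟ pos (hpos j)) then written (τ t p) j else lookup (sy (τ t p)) j)
              ≡⟨ cong₂ (λ a s → if does (pos p ℤ.≟ pos (hpos j)) then a else s)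
                   (cong proj₁ (act-at p< j)) (symbol≡ p< j) ⟩
            (if does (pos p ℤ.≟ pos (hpos j)) then proj₁ (act j) else lookup (tape c) j (pos p))
              ≡⟨ cong (λ h → if does (pos p ℤ.≟ h) then proj₁ (act j) else lookup (tape c) j (pos p)) (heads≡ j) ⟨
            write M (lookup (heads c) j) (proj₁ (act j)) (lookup (tape c) j) (pos p)
              ≡⟨ cong (λ fp → write M (proj₂ fp) (proj₁ (act j)) (proj₁ fp) (pos p))
                   (Vec.lookup-zipWith _,_ j (tape c) (heads c)) ⟨
            write M (proj₂ (lookup (zipWith _,_ (tape c) (heads c)) j)) (proj₁ (act j))
                    (proj₁ (lookup (zipWith _,_ (tape c) (heads c)) j)) (pos p)
              ≡⟨ cong (λ (f : ℤ → Γ M) → f (pos p)) (Vec.lookup-zipWith _ j (proj₂ (ac r)) (zipWith _,_ (tape c) (heads c))) ⟨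
            lookup (tape c⁺) j (pos p) ∎
            where open ≡-Reasoning

      halted-accepts : ∀ {t c} → t < o → Reach M t (initial M w) c → Matches t c → ht (rw (τ t 0)) ≡ true → Accepts M w
      halted-accepts {t} {c} t<o r m h = t , c , r ,
        trans (cong accept (sym (Matches.state≡ m 0<2o))) (proj₁ (good t<o 0<2o) h)

      -- The rows are followed until one of them is marked as halted. `Good` makes its state
      -- accepting, and later rows are ignored.
      simulate : ∀ t → t < o → Accepts M w ⊎ Σ (Config M) λ c → Reach M t (initial M w) c × Matches t c
      simulate zero    t<o = inj₂ (initial M w , done , matches-initial)
      simulate (suc t) t<o with simulate t (ℕ.<-trans (ℕ.n<1+n t) t<o)
      ... | inj₁ acc = inj₁ acc
      ... | inj₂ (c , run , m) with ht (rw (τ t 0)) in eq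
      ...   | true  = inj₁ (halted-accepts (ℕ.<-trans (ℕ.n<1+n t) t<o) run m eq)
      ...   | false = inj₂ (c⁺ , snoc _ run admissible , matches-step)
        where open Step t<o m eq

      accepts : Accepts M w
      accepts with ℕ.m≤n⇒∃[o]m+o≡n 0<o
      ... | t , refl with simulate t (ℕ.n<1+n t)
      ...   | inj₁ acc = acc
      ...   | inj₂ (c , r , m) = halted-accepts (ℕ.n<1+n t) r m (halt refl 0<2o)

    -- From an accepting run to a tiling

    snapshot : Config M → Act → Bool → ℕ → MTile
    snapshot c a b p = tile (row (state c) (read M c) a b) (map (λ f → f (pos p)) (tape c))
      (map (λ z → does (z ℤ.≟ pos p ℤ.- ℤ.+ 1)) (heads c))
      (map (λ z → does (z ℤ.≟ pos p)) (heads c))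
      (map (λ z → does (z ℤ.≟ pos p ℤ.+ ℤ.+ 1)) (heads c))

    -- A halted row must carry some action too. All heads stand still, so that `Last` tolerates a
    -- head that has come to rest in the last column.
    idle : Config M → Act
    idle c = state c , replicate H (blank M , S)

    -- After the end of the run its final configuration is repeated, marked as halted; rows
    -- therefore exist for every index.
    history : ∀ {t c c'} → Reach M t c c' → ℕ → ℕ → MTile
    history {c = c} done i p = snapshot c (idle c) true p
    history {c = c} (step tr _ r) zero p = snapshot c tr false p
    history (step tr _ r) (suc i) p = history r i p

    history-zero : ∀ {t c c'} (r : Reach M t c c') p → Σ Act λ a → Σ Bool λ b → history r 0 p ≡ snapshot c a b p
    history-zero done p = _ , _ , refl
    history-zero (step _ _ _) p = _ , _ , refl

    snapshot-horiz : ∀ c a b p → TileSystem.Horiz M-tiles (snapshot c a b p) (snapshot c a b (suc p))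
    snapshot-horiz c a b p = refl , λ j →
        cong (λ z → lookup (map (λ y → does (y ℤ.≟ z)) (heads c)) j) (sym (pos-pred p))
      , cong (λ z → lookup (map (λ y → does (y ℤ.≟ z)) (heads c)) j) (sym (pos-suc p))

    history-horiz : ∀ {t c c'} (r : Reach M t c c') i p →
      TileSystem.Horiz M-tiles (history r i p) (history r i (suc p))
    history-horiz done i p = snapshot-horiz _ _ _ p
    history-horiz (step _ _ r) zero p = snapshot-horiz _ _ _ p
    history-horiz (step _ _ r) (suc i) p = history-horiz r i p

    snapshot-reads : ∀ c a b p j → lookup (hc (snapshot c a b p)) j ≡ true →
      lookup (sy (snapshot c a b p)) j ≡ lookup (read M c) j
    snapshot-reads c a b p j e
      rewrite Vec.lookup-map j (λ z → does (z ℤ.≟ pos p)) (heads c)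
            | Vec.lookup-map j (λ (f : ℤ → Γ M) → f (pos p)) (tape c)
            | Vec.lookup-zipWith (λ f p → f p) j (tape c) (heads c)
      with lookup (heads c) j ℤ.≟ pos p
    ... | yes h≡p = cong (lookup (tape c) j) (sym h≡p)

    history-good : ∀ {t c c'} (r : Reach M t c c') → accept (state c') ≡ true →
      ∀ i p → TileSystem.Good M-tiles (history r i p)
    history-good {c = c} done acc i p = (λ _ → acc) , (λ ()) , snapshot-reads c (idle c) true p
    history-good {c = c} (step tr m r) acc zero p = (λ ()) , (λ _ → m) , snapshot-reads c tr false p
    history-good (step _ _ r) acc (suc i) p = history-good r acc i p

    does-move : ∀ m z P → does (move M m z ℤ.≟ P)
      ≡ moved m (does (z ℤ.≟ P ℤ.- ℤ.+ 1)) (does (z ℤ.≟ P)) (does (z ℤ.≟ P ℤ.+ ℤ.+ 1))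
    does-move S z P = refl
    does-move L z P = does-⇔ (mk⇔ (λ e → trans (sym (-1+1 z)) (cong (ℤ._+ ℤ.+ 1) e))
                                    (λ e → trans (cong (ℤ._- ℤ.+ 1) e) (+1-1 P)))
      (move M L z ℤ.≟ P) (z ℤ.≟ P ℤ.+ ℤ.+ 1)
    does-move R z P = does-⇔ (mk⇔ (λ e → trans (sym (+1-1 z)) (cong (ℤ._- ℤ.+ 1) e))
                                    (λ e → trans (cong (ℤ._+ ℤ.+ 1) e) (-1+1 P)))
      (move M R z ℤ.≟ P) (z ℤ.≟ P ℤ.- ℤ.+ 1)

    snapshot-vert : ∀ c tr a b p → TileSystem.Vert M-tiles (snapshot c tr false p) (snapshot (apply M tr c) a b p)
    snapshot-vert c tr a b p _ = refl , λ j → symbol j , head j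
      where
      symbol : ∀ j → lookup (sy (snapshot (apply M tr c) a b p)) j ≡
        (if lookup (hc (snapshot c tr false p)) j then proj₁ (lookup (proj₂ tr) j)
         else lookup (sy (snapshot c tr false p)) j)
      symbol j
        rewrite Vec.lookup-map j (λ (f : ℤ → Γ M) → f (pos p)) (tape (apply M tr c))
              | Vec.lookup-zipWith (λ am fp → write M (proj₂ fp) (proj₁ am) (proj₁ fp)) j (proj₂ tr)
                  (zipWith _,_ (tape c) (heads c))
              | Vec.lookup-zipWith _,_ j (tape c) (heads c)
              | Vec.lookup-map j (λ z → does (z ℤ.≟ pos p)) (heads c)
              | Vec.lookup-map j (λ (f : ℤ → Γ M) → f (pos p)) (tape c)
        = cong (λ b → if b then proj₁ (lookup (proj₂ tr) j) else lookup (tape c) j (pos p))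
            (does-⇔ (mk⇔ sym sym) (pos p ℤ.≟ lookup (heads c) j) (lookup (heads c) j ℤ.≟ pos p))
      head : ∀ j → lookup (hc (snapshot (apply M tr c) a b p)) j ≡
        moved (proj₂ (lookup (proj₂ tr) j)) (lookup (hp (snapshot c tr false p)) j)
          (lookup (hc (snapshot c tr false p)) j) (lookup (hn (snapshot c tr false p)) j)
      head j
        rewrite Vec.lookup-map j (λ z → does (z ℤ.≟ pos p)) (heads (apply M tr c))
              | Vec.lookup-zipWith (λ am q → move M (proj₂ am) q) j (proj₂ tr) (heads c)
              | Vec.lookup-map j (λ z → does (z ℤ.≟ pos p)) (heads c)
              | Vec.lookup-map j (λ z → does (z ℤ.≟ pos p ℤ.- ℤ.+ 1)) (heads c)
              | Vec.lookup-map j (λ z → does (z ℤ.≟ pos p ℤ.+ ℤ.+ 1)) (heads c)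
        = does-move (proj₂ (lookup (proj₂ tr) j)) (lookup (heads c) j) (pos p)

    history-vert : ∀ {t c c'} (r : Reach M t c c') i p →
      TileSystem.Vert M-tiles (history r i p) (history r (suc i) p)
    history-vert done i p = λ ()
    history-vert {c = c} (step tr _ r) zero p with history-zero r p
    ... | a , b , e = subst (TileSystem.Vert M-tiles (snapshot c tr false p)) (sym e) (snapshot-vert c tr a b p)
    history-vert (step _ _ r) (suc i) p = history-vert r i p

    Within : ℕ → Config M → Set
    Within b c = ∀ j → ∣ lookup (heads c) j ∣ ≤ b

    within-step : ∀ {b c} tr → Within b c → Within (suc b) (apply M tr c)
    within-step {b} {c} tr h j
      rewrite Vec.lookup-zipWith (λ am q → move M (proj₂ am) q) j (proj₂ tr) (heads c) =
      bound (proj₂ (lookup (proj₂ tr) j)) (lookup (heads c) j) (h j)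
      where
      bound : ∀ m z → ∣ z ∣ ≤ b → ∣ move M m z ∣ ≤ suc b
      bound S z h = ℕ.≤-trans h (ℕ.n≤1+n b)
      bound R z h = ℕ.≤-trans (ℤ.∣i+j∣≤∣i∣+∣j∣ z (ℤ.+ 1)) (subst (_≤ suc b) (ℕ.+-comm 1 ∣ z ∣) (s≤s h))
      bound L z h = ℕ.≤-trans (ℤ.∣i+j∣≤∣i∣+∣j∣ z (ℤ.- ℤ.+ 1)) (subst (_≤ suc b) (ℕ.+-comm 1 ∣ z ∣) (s≤s h))

    far-false : ∀ z P → ∣ z ∣ < o → o ≤ ∣ P ∣ → does (z ℤ.≟ P) ≡ false
    far-false z P z<o o≤P = dec-false (z ℤ.≟ P) λ { refl → ℕ.<⇒≱ z<o o≤P }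

    ∣pos-0∣ : ∣ pos 0 ∣ ≡ o
    ∣pos-0∣ = trans (cong ∣_∣ (ℤ.⊖-≤ {0} {o} z≤n)) (ℤ.∣-i∣≡∣i∣ (ℤ.+ o))

    ∣pos-0-1∣ : o ≤ ∣ pos 0 ℤ.- ℤ.+ 1 ∣
    ∣pos-0-1∣ = subst (o ≤_) (sym (trans (cong (λ z → ∣ z ℤ.- ℤ.+ 1 ∣) (ℤ.⊖-≤ {0} {o} z≤n))
      (trans (cong ∣_∣ (sym (ℤ.neg-distrib-+ (ℤ.+ o) (ℤ.+ 1)))) (ℤ.∣-i∣≡∣i∣ (ℤ.+ o ℤ.+ ℤ.+ 1))))) (ℕ.m≤m+n o 1)

    pos-last+1 : ∀ {p} → suc p ≡ o + o → pos p ℤ.+ ℤ.+ 1 ≡ ℤ.+ o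
    pos-last+1 {p} e = trans (sym (pos-suc p)) (trans (cong pos e) (pos-≥ o))

    snapshot-first : ∀ {b c} a h → Within b c → b < o → TileSystem.First M-tiles (snapshot c a h 0)
    snapshot-first {b} {c} a h wi b<o j
      rewrite Vec.lookup-map j (λ z → does (z ℤ.≟ pos 0 ℤ.- ℤ.+ 1)) (heads c)
            | Vec.lookup-map j (λ z → does (z ℤ.≟ pos 0)) (heads c)
      = far-false (lookup (heads c) j) (pos 0 ℤ.- ℤ.+ 1) z<o ∣pos-0-1∣
      , λ (t , _) → case trans (sym t)
          (far-false (lookup (heads c) j) (pos 0) z<o (ℕ.≤-reflexive (sym ∣pos-0∣))) of λ ()
      where z<o = ℕ.≤-<-trans (wi j) b<o

    -- Here b bounds the distance of the heads from cell 0 and t counts the steps still to come. A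
    -- step raises b and lowers t, so the sum stays below `o`.
    history-first : ∀ {t c c' b} (r : Reach M t c c') → Within b c → b + t < o → ∀ i →
      TileSystem.First M-tiles (history r i 0)
    history-first {c = c} {b = b} done wi b+t<o i =
      snapshot-first {c = c} (idle c) true wi (subst (_< o) (ℕ.+-identityʳ b) b+t<o)
    history-first {c = c} {b = b} (step tr _ r) wi b+t<o zero =
      snapshot-first {c = c} tr false wi (ℕ.≤-<-trans (ℕ.m≤m+n b _) b+t<o)
    history-first {suc t} {c = c} {b = b} (step tr _ r) wi b+t<o (suc i) =
      history-first r (within-step {c = c} tr wi) (subst (_< o) (ℕ.+-suc b t) b+t<o) i

    snapshot-last : ∀ {b c} a h {p} → Within b c → b < o → suc p ≡ o + o →
      (∀ j → lookup (heads c) j ≡ pos p → proj₂ (lookup (proj₂ a) j) ≢ R) →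
      TileSystem.Last M-tiles (snapshot c a h p)
    snapshot-last {b} {c} a h {p} wi b<o e noR j
      rewrite Vec.lookup-map j (λ z → does (z ℤ.≟ pos p ℤ.+ ℤ.+ 1)) (heads c)
            | Vec.lookup-map j (λ z → does (z ℤ.≟ pos p)) (heads c)
      = trans (cong (λ z → does (lookup (heads c) j ℤ.≟ z)) (pos-last+1 e))
          (far-false (lookup (heads c) j) (ℤ.+ o) z<o ℕ.≤-refl)
      , not-right
      where
      z<o = ℕ.≤-<-trans (wi j) b<o
      not-right : ¬ (does (lookup (heads c) j ℤ.≟ pos p) ≡ true × proj₂ (lookup (proj₂ a) j) ≡ R)
      not-right (t , r) with lookup (heads c) j ℤ.≟ pos p | noR j
      ... | yes at | no-r = no-r at r

    -- The last column is cell o - 1, which lies within reach, unlike cell -o in the first column. A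
    -- head can be there only when no step is left, and then `idle` keeps it still.
    history-last : ∀ {t c c' b} (r : Reach M t c c') → Within b c → b + t < o → ∀ i {p} → suc p ≡ o + o →
      TileSystem.Last M-tiles (history r i p)
    history-last {c = c} {b = b} done wi b+t<o i e =
      snapshot-last {c = c} (idle c) true wi (subst (_< o) (ℕ.+-identityʳ b) b+t<o) e λ j _ r →
        case trans (sym r) (cong proj₂ (Vec.lookup-replicate j (blank M , S))) of λ ()
    history-last {suc t} {c = c} {b = b} (step tr _ r) wi b+t<o zero {p} e =
      snapshot-last {c = c} tr false wi (ℕ.≤-<-trans (ℕ.m≤m+n b _) b+t<o) e λ j at isR → ℕ.<⇒≱ b+t<o (begin
        o                                          ≡⟨ cong ∣_∣ (pos-last+1 e) ⟨
        ∣ pos p ℤ.+ ℤ.+ 1 ∣                        ≡⟨ cong (λ z → ∣ z ℤ.+ ℤ.+ 1 ∣) at ⟨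
        ∣ lookup (heads c) j ℤ.+ ℤ.+ 1 ∣           ≤⟨ ℤ.∣i+j∣≤∣i∣+∣j∣ (lookup (heads c) j) (ℤ.+ 1) ⟩
        ∣ lookup (heads c) j ∣ + 1                 ≤⟨ ℕ.+-mono-≤ (wi j) (s≤s z≤n) ⟩
        b + suc t                                  ∎)
      where open ℕ.≤-Reasoning
    history-last {suc t} {c = c} {b = b} (step tr _ r) wi b+t<o (suc i) e =
      history-last r (within-step {c = c} tr wi) (subst (_< o) (ℕ.+-suc b t) b+t<o) i e

    history-halt : ∀ {t c c'} (r : Reach M t c c') i p → t ≤ i → TileSystem.Halt M-tiles (history r i p)
    history-halt done i p t≤i = refl
    history-halt (step _ _ r) (suc i) p (s≤s t≤i) = history-halt r i p t≤i

    run-tiling : ∀ {w t c} → Reach M t (initial M w) c → accept (state c) ≡ true → t < o →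
      Tiling M-tiles (λ _ → ⊤) o w
    run-tiling {w} {t} r acc t<o = record
      { τ = history r
      ; good = λ {i} {p} _ _ → history-good r acc i p
      ; vert = λ {i} {p} _ _ → history-vert r i p
      ; horiz = λ {i} {p} _ _ → history-horiz r i p
      ; first = λ {i} _ → history-first r within-0 t<o i
      ; last = λ {i} _ e → history-last r within-0 t<o i e
      ; started = λ {p} _ → st-0 p , λ j → trans (cong (λ s → lookup s (suc j)) (sy-0 p))
          (trans (Vec.lookup-map j (λ (f : ℤ → Γ M) → f (pos p)) (replicate _ (λ _ → blank M)))
            (cong (λ f → f (pos p)) (Vec.lookup-replicate j (λ _ → blank M))))
      ; head = λ {p} _ j → trans (cong (λ h → lookup h j) (hc-0 p))
          (trans (Vec.lookup-map j (λ z → does (z ℤ.≟ pos p)) (replicate _ (ℤ.+ 0)))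
            (trans (cong (λ z → does (z ℤ.≟ pos p)) (trans (Vec.lookup-replicate j (ℤ.+ 0)) (sym pos-o)))
              (trans (does-⇔ (mk⇔ sym sym) (pos o ℤ.≟ pos p) (pos p ℤ.≟ pos o)) (does-pos p o))))
      ; input = λ {i} _ → trans (cong (λ s → lookup s zero) (sy-0 (o + i)))
          (trans (cong (inputTape M w) (pos-≥ i)) (inputTape-look M w i))
      ; left = λ {p} p<o → trans (cong (λ s → lookup s zero) (sy-0 p)) (inputTape-< w p<o)
      ; halt = λ {i} {p} e _ → history-halt r i p (ℕ.≤-pred (subst (t <_) (sym e) t<o))
      }
      where
      within-0 : Within 0 (initial M w)
      within-0 j = ℕ.≤-reflexive (cong ∣_∣ (Vec.lookup-replicate j (ℤ.+ 0)))
      sy-0 : ∀ p → sy (history r 0 p) ≡ map (λ f → f (pos p)) (tape (initial M w))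
      sy-0 p with history-zero r p
      ... | _ , _ , e = cong sy e
      hc-0 : ∀ p → hc (history r 0 p) ≡ map (λ z → does (z ℤ.≟ pos p)) (heads (initial M w))
      hc-0 p with history-zero r p
      ... | _ , _ , e = cong hc e
      st-0 : ∀ p → Row.st (rw (history r 0 p)) ≡ start
      st-0 p with history-zero r p
      ... | _ , _ , e = cong (λ x → Row.st (rw x)) e

-- The axioms

-- The digits of a point: `tc` and `hc` belong to the row, `pc` and `gc` to the column. The digits
-- `hc` and `gc` are those below s, and both are stored in `mix`.
data Coord (k : ℕ) : Set where
  tc pc : Fin k → Coord k
  hc gc : Coord k

_≟ᶜ_ : ∀ {k} → DecidableEquality (Coord k)
tc i ≟ᶜ tc j = map′ (cong tc) (λ { refl → refl }) (i Fin.≟ j)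
tc _ ≟ᶜ pc _ = no λ ()
tc _ ≟ᶜ hc   = no λ ()
tc _ ≟ᶜ gc   = no λ ()
pc _ ≟ᶜ tc _ = no λ ()
pc i ≟ᶜ pc j = map′ (cong pc) (λ { refl → refl }) (i Fin.≟ j)
pc _ ≟ᶜ hc   = no λ ()
pc _ ≟ᶜ gc   = no λ ()
hc   ≟ᶜ tc _ = no λ ()
hc   ≟ᶜ pc _ = no λ ()
hc   ≟ᶜ hc   = yes refl
hc   ≟ᶜ gc   = no λ ()
gc   ≟ᶜ tc _ = no λ ()
gc   ≟ᶜ pc _ = no λ ()
gc   ≟ᶜ hc   = no λ ()
gc   ≟ᶜ gc   = yes refl

kind : ∀ {k} → Coord k → Fin 3
kind (tc _) = std
kind (pc _) = std
kind hc     = hi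
kind gc     = lo

cvar : ∀ {k} → Coord k → Var k
cvar (tc i) = tv i
cvar (pc i) = pv i
cvar hc     = mix
cvar gc     = mix

cvar≢aux : ∀ {k} (c : Coord k) → cvar c ≢ aux
cvar≢aux (tc _) ()
cvar≢aux (pc _) ()
cvar≢aux hc ()
cvar≢aux gc ()

base : ∀ {k} → ℕ → ℕ → Coord k → ℕ
base n s (tc _) = n
base n s (pc _) = n
base n s hc     = s
base n s gc     = s

line : ∀ {k m} → (Fin m → Coord k) → Coord k → List (Coord k)
line f c = List.tabulate f List.++ c ∷ []

∈-line⁻ : ∀ {k m} (f : Fin m → Coord k) {c d} → d ∈ line f c → ∃ (λ i → d ≡ f i) ⊎ d ≡ c
∈-line⁻ f m with ∈-++⁻ (List.tabulate f) m
... | inj₁ m = inj₁ (∈-tabulate⁻ {f = f} m)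
... | inj₂ (here e) = inj₂ e

∈-line⁺ˡ : ∀ {k m} (f : Fin m → Coord k) {c} i → f i ∈ line f c
∈-line⁺ˡ f i = ∈-++⁺ˡ {xs = List.tabulate f} (∈-tabulate⁺ {f = f} i)

∈-line⁺ʳ : ∀ {k m} (f : Fin m → Coord k) {c} → c ∈ line f c
∈-line⁺ʳ f = ∈-++⁺ʳ (List.tabulate f) (here refl)

line-unique : ∀ {k m} (f : Fin m → Coord k) {c} → (∀ {i j} → f i ≡ f j → i ≡ j) → (∀ i → f i ≢ c) →
  Unique (line f c)
line-unique f {c} f-injective f≢c = Unique.++⁺ {xs = List.tabulate f} (Unique.tabulate⁺ {f = f} f-injective) ([] ∷ []) disjoint
  where
  disjoint : ∀ {d} → ¬ (d ∈ List.tabulate f × d ∈ c ∷ [])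
  disjoint (m , here refl) with ∈-tabulate⁻ {f = f} m
  ... | i , e = f≢c i (sym e)

abstract
  time tail : ∀ k → List (Coord (suc k))
  time k = line tc hc
  tail k = line (pc ∘ suc) gc

-- The lowest digit is set apart: the input word has at most n letters and lies in cells that differ
-- in this digit only.
space : ∀ k → List (Coord (suc k))
space k = pc 0F ∷ tail k

abstract
  ∈-space⁻ : ∀ k {c} → c ∈ space k → ∃ (λ i → c ≡ pc i) ⊎ c ≡ gc
  ∈-space⁻ k = ∈-line⁻ pc

  ∈-tail⁻ : ∀ k {c} → c ∈ tail k → ∃ (λ i → c ≡ pc (suc i)) ⊎ c ≡ gc
  ∈-tail⁻ k = ∈-line⁻ (pc ∘ suc)

  time-unique : ∀ k → Unique (time k)
  time-unique k = line-unique tc (λ { refl → refl }) λ _ ()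

  space-unique : ∀ k → Unique (space k)
  space-unique k = line-unique pc (λ { refl → refl }) λ _ ()

  time-space-disjoint : ∀ k {c} → c ∈ time k → c ∉ space k
  time-space-disjoint k t s with ∈-line⁻ tc t | ∈-space⁻ k s
  ... | inj₁ (_ , refl) | inj₁ (_ , ())
  ... | inj₁ (_ , refl) | inj₂ ()
  ... | inj₂ refl | inj₁ (_ , ())

  coord-cases : ∀ k (c : Coord (suc k)) → c ∈ time k ⊎ c ∈ space k
  coord-cases k (tc i) = inj₁ (∈-line⁺ˡ tc i)
  coord-cases k hc     = inj₁ (∈-line⁺ʳ tc)
  coord-cases k (pc i) = inj₂ (∈-line⁺ˡ pc i)
  coord-cases k gc     = inj₂ (∈-line⁺ʳ pc)

module _ (n s : ℕ) {k : ℕ} where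
  open MixedRadix {Coord (suc k)} _≟ᶜ_ (base n s)

  abstract
    weight-tabulate : ∀ m (f : Fin m → Coord (suc k)) c → (∀ i → base n s (f i) ≡ n) →
      weight (line f c) ≡ n ^ m * base n s c
    weight-tabulate zero    f c h = ℕ.*-comm (base n s c) 1
    weight-tabulate (suc m) f c h =
      trans (cong₂ _*_ (h zero) (weight-tabulate m (f ∘ suc) c (h ∘ suc))) (sym (ℕ.*-assoc n (n ^ m) _))

    weight-time : weight (time k) ≡ n ^ suc k * s
    weight-time = weight-tabulate (suc k) tc hc λ _ → refl

    weight-space : weight (space k) ≡ n ^ suc k * s
    weight-space = weight-tabulate (suc k) pc gc λ _ → refl

module Segment (n s D : ℕ) (k : ℕ) (0<n : 0 < n) (0<s : 0 < s) where
  open MixedRadix {Coord (suc k)} _≟ᶜ_ (base n s)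

  0<base : (c : Coord (suc k)) → 0 < base n s c
  0<base (tc _) = 0<n
  0<base (pc _) = 0<n
  0<base hc     = 0<s
  0<base gc     = 0<s

  origin : ℕ
  origin = weight (space k) * D

  origin≡ : origin ≡ n * (weight (tail k) * D)
  origin≡ = ℕ.*-assoc n (weight (tail k)) D

  -- The origin has top value D and only zero digits, so the n columns that start there are told
  -- apart by the lowest digit alone. `num-segment` is the converse.
  segment-num : ∀ {δ b} → b ≡ D → (∀ {c} → c ∈ tail k → δ c ≡ 0) → num (space k) δ b ≡ origin + δ (pc 0F)
  segment-num {δ} {b} refl z = begin
    δ (pc 0F) + n * num (tail k) δ b     ≡⟨ cong (λ q → δ (pc 0F) + n * q) (num-zeros (tail k) b z) ⟩
    δ (pc 0F) + n * (weight (tail k) * b) ≡⟨ ℕ.+-comm (δ (pc 0F)) _ ⟩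
    n * (weight (tail k) * b) + δ (pc 0F) ≡⟨ cong (_+ δ (pc 0F)) origin≡ ⟨
    origin + δ (pc 0F)                    ∎
    where open ≡-Reasoning

  num-segment : ∀ {δ b i} → InRange (space k) δ → num (space k) δ b ≡ origin + i → i < n →
    δ (pc 0F) ≡ i × b ≡ D × (∀ {c} → c ∈ tail k → δ c ≡ 0)
  num-segment {δ} {b} {i} δ< e i<n
    with r , q ← +*-unique n {δ (pc 0F)} {i} {num (tail k) δ b} {weight (tail k) * D} (δ< (here refl)) i<n
                   (trans e (trans (cong (_+ i) origin≡) (ℕ.+-comm _ i)))
    with zs , b≡D ← num-injective (tail k) {δ} {λ _ → 0} {b} {D} (δ< ∘ there) (λ {c} _ → 0<base c)
                   (trans q (sym (num-zeros (tail k) D λ _ → refl)))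
    = r , b≡D , zs

module Axioms (k' : ℕ) (𝒯 : TileSystem) (D₀ : ℕ) where
  open TileSystem 𝒯

  D E : ℕ
  D = suc D₀
  E = D + D

  -- The top values of row and column are below constants and become part of the name of a tile
  -- relation, at no cost in variables.
  open Logic k' {Tile × Fin D × Fin E} (tile-code ×-code fin-code D ×-code fin-code E) public

  tds pds : List (Coord k)
  tds = time (suc k')
  pds = space (suc k')

  -- All relations but the tiles are ternary; those of lower arity repeat an argument.
  un : Fix → V → Fm
  un f x = fix f x x x

  bin : Fix → V → V → Fm
  bin f x y = fix f x y y

  -- These variables are distinct because k ≥ 2.
  pattern x₁ = tv 0F
  pattern x₂ = tv 1F
  pattern x₃ = aux
  pattern x₄ = mix
  pattern x₅ = pv 0F

  ⊥ᶠ : Fm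
  ⊥ᶠ = ⌜ no (λ (x : ⊥) → x) ⌝

  -- `zer std` is characterised in both directions, because `input-axioms` also draws conclusions
  -- from a digit not being 0. The last clause of `pair-axioms` serves the same purpose for
  -- `zer lo`.
  order-axioms : Fm
  order-axioms =
      (∀ᶠ x₁ (bin less x₁ x₁ ⇒ ⊥ᶠ))
    ∧ᶠ (∀ᶠ x₁ (∀ᶠ x₂ (∀ᶠ x₃ (bin less x₁ x₂ ⇒ bin less x₂ x₃ ⇒ bin less x₁ x₃))))
    ∧ᶠ (∀ᶠ x₁ (∀ᶠ x₂ (x₁ ≈ x₂ ∨ᶠ bin less x₁ x₂ ∨ᶠ bin less x₂ x₁)))
    ∧ᶠ (∀ᶠ x₁ ((∀ᶠ x₂ (bin less x₂ x₁ ⇒ ⊥ᶠ)) ⇒ un (zer std) x₁))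
    ∧ᶠ (∀ᶠ x₁ (∀ᶠ x₂ (un (zer std) x₁ ⇒ bin less x₂ x₁ ⇒ ⊥ᶠ)))
    ∧ᶠ (∀ᶠ x₁ ((∀ᶠ x₂ (bin less x₁ x₂ ⇒ ⊥ᶠ)) ⇒ un (top std) x₁))
    ∧ᶠ (∀ᶠ x₁ (∀ᶠ x₂ (bin less x₁ x₂ ⇒ (∀ᶠ x₃ (bin less x₁ x₃ ⇒ bin less x₃ x₂ ⇒ ⊥ᶠ)) ⇒ bin (stp std) x₁ x₂)))
    ∧ᶠ (∀ᶠ x₁ (∀ᶠ x₂ (un (top std) x₁ ⇒ un (zer std) x₂ ⇒ bin (wrp std) x₁ x₂)))

  -- pair x₁ x₂ x₄ : x₄ is the code of the pair (x₁ , x₂); root is the largest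
  -- number occurring in a pair.
  pair-axioms : Fm
  pair-axioms =
      (∃ᶠ x₁ (un root x₁))
    ∧ᶠ (∀ᶠ x₁ (∀ᶠ x₂ (∀ᶠ x₃ (un root x₃ ⇒ (bin less x₃ x₁ ⇒ ⊥ᶠ) ⇒ (bin less x₃ x₂ ⇒ ⊥ᶠ) ⇒ ∃ᶠ x₄ (fix pair x₁ x₂ x₄)))))
    ∧ᶠ (∀ᶠ x₁ (∀ᶠ x₂ (∀ᶠ x₃ (∀ᶠ x₄ (∀ᶠ x₅ (fix pair x₁ x₂ x₄ ⇒ fix pair x₃ x₂ x₅ ⇒
          (bin (stp std) x₁ x₃ ⇒ bin (stp hi) x₄ x₅)
          ∧ᶠ (un root x₁ ⇒ un (zer std) x₃ ⇒ bin (wrp hi) x₄ x₅)))))))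
    ∧ᶠ (∀ᶠ x₁ (∀ᶠ x₂ (∀ᶠ x₃ (∀ᶠ x₄ (∀ᶠ x₅ (fix pair x₂ x₁ x₄ ⇒ fix pair x₂ x₃ x₅ ⇒
          (bin (stp std) x₁ x₃ ⇒ bin (stp lo) x₄ x₅)
          ∧ᶠ (un root x₁ ⇒ un (zer std) x₃ ⇒ bin (wrp lo) x₄ x₅)))))))
    ∧ᶠ (∀ᶠ x₁ (∀ᶠ x₂ (∀ᶠ x₄ (fix pair x₁ x₂ x₄ ⇒
          (un (zer std) x₁ ⇒ un (zer hi) x₄) ∧ᶠ (un root x₁ ⇒ un (top hi) x₄)
          ∧ᶠ (un (zer std) x₂ ⇒ un (zer lo) x₄) ∧ᶠ (un root x₂ ⇒ un (top lo) x₄)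
          ∧ᶠ (un (zer lo) x₄ ⇒ un (zer std) x₂)))))

  -- child₀ and child₁ are v ↦ 2v + 1 and v ↦ 2v + 2.  Since the element v stands
  -- for the number v + 1, these append a binary digit.  path i v says that the
  -- bits at the positions 0, …, i represent v + 1.
  binary-axioms : Fm
  binary-axioms =
      (∀ᶠ x₁ (∀ᶠ x₂ (un (zer std) x₁ ⇒ bin (stp std) x₁ x₂ ⇒ bin child₀ x₁ x₂)))
    ∧ᶠ (∀ᶠ x₁ (∀ᶠ x₂ (∀ᶠ x₃ (∀ᶠ x₄ (∀ᶠ x₅ (bin child₀ x₁ x₂ ⇒ bin (stp std) x₁ x₃ ⇒
          bin (stp std) x₂ x₄ ⇒ bin (stp std) x₄ x₅ ⇒ bin child₀ x₃ x₅))))))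
    ∧ᶠ (∀ᶠ x₁ (∀ᶠ x₂ (∀ᶠ x₃ (bin child₀ x₁ x₂ ⇒ bin (stp std) x₂ x₃ ⇒ bin child₁ x₁ x₃))))
    ∧ᶠ (∀ᶠ x₁ (∀ᶠ x₂ (∀ᶠ x₃ (∀ᶠ x₄ (bin path x₁ x₂ ⇒ bin (stp std) x₃ x₁ ⇒
          (bin child₀ x₄ x₂ ⇒ un bit₀ x₁ ∧ᶠ bin path x₃ x₄)
          ∧ᶠ (bin child₁ x₄ x₂ ⇒ un bit₁ x₁ ∧ᶠ bin path x₃ x₄))))))
    -- The leading bit is 1, and halving arrives at the number 1 exactly at position 0; this
    -- excludes leading zeros.
    ∧ᶠ (∀ᶠ x₁ (∀ᶠ x₂ (bin path x₁ x₂ ⇒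
          (un (zer std) x₁ ⇒ un (zer std) x₂ ∧ᶠ un bit₁ x₁) ∧ᶠ (un (zer std) x₂ ⇒ un (zer std) x₁))))
    -- The witness is the position of the last bit. The largest element stands for n, the size of
    -- the universe.
    ∧ᶠ (∃ᶠ x₁ ((∀ᶠ x₂ (un (top std) x₂ ⇒ bin path x₁ x₂))
          ∧ᶠ (∀ᶠ x₃ (bin less x₁ x₃ ⇒ (un bit₀ x₃ ⇒ ⊥ᶠ) ∧ᶠ (un bit₁ x₃ ⇒ ⊥ᶠ)))))

  assign : Fix → Coord k → Fm → Fm
  assign f c φ = ∃ᶠ aux (bin f (cvar c) aux ∧ᶠ ∃ᶠ (cvar c) (cvar c ≈ aux ∧ᶠ φ))

  -- φ is evaluated after incrementing the numeral with digits cs, and carry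
  -- if the numeral overflows to 0.
  Next : List (Coord k) → Fm → Fm → Fm
  Next []       carry φ = carry
  Next (c ∷ cs) carry φ = assign (stp (kind c)) c φ ∨ᶠ assign (wrp (kind c)) c (Next cs carry φ)

  Each : Fin 4 → List (Coord k) → Fm
  Each r []       = ⌜ yes tt ⌝
  Each r (c ∷ cs) = un (inj₁ (r , kind c)) (cvar c) ∧ᶠ Each r cs

  pattern zeros = 2F
  pattern tops  = 3F

  -- An overflow of all digits raises the top value in the name of the relation. After the last row
  -- or column no such index exists, and the formula is false.
  next-time next-space : Tile → Fin D → Fin E → Fm
  next-time y a b = Next tds
    (⋁ (fin-code D) λ a' → ⌜ toℕ a' ℕ.≟ suc (toℕ a) ⌝ ∧ᶠ til (y , a' , b)) (til (y , a , b))
  next-space y a b = Next pds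
    (⋁ (fin-code E) λ b' → ⌜ toℕ b' ℕ.≟ suc (toℕ b) ⌝ ∧ᶠ til (y , a , b')) (til (y , a , b))

  input-segment : Fin E → Fm
  input-segment b = ⌜ toℕ b ℕ.≟ D ⌝ ∧ᶠ Each zeros (tail (suc k'))

  -- The n cells from the origin on are enough for the input, since a number has no more binary
  -- digits than its value.
  input-axioms : Tile → Fin E → Fm
  input-axioms x b = ⌜ start? x ⌝
    ∧ᶠ (input-segment b ⇒
           (un (zer std) (pv 0F) ⇒ ⌜ head? true x ⌝)
        ∧ᶠ ((un (zer std) (pv 0F) ⇒ ⊥ᶠ) ⇒ ⌜ head? false x ⌝)
        ∧ᶠ (un bit₀ (pv 0F) ⇒ ⌜ sym? (just false) x ⌝)
        ∧ᶠ (un bit₁ (pv 0F) ⇒ ⌜ sym? (just true) x ⌝)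
        ∧ᶠ ((un bit₀ (pv 0F) ⇒ ⊥ᶠ) ⇒ (un bit₁ (pv 0F) ⇒ ⊥ᶠ) ⇒ ⌜ sym? nothing x ⌝))
    ∧ᶠ ((input-segment b ⇒ ⊥ᶠ) ⇒ ⌜ head? false x ⌝ ∧ᶠ ⌜ sym? nothing x ⌝)

  -- Several tiles may hold at one point. The constraints bind every tile that holds against every
  -- neighbour that holds, so any choice of one tile per point is a tiling, and uniqueness is not
  -- axiomatised.
  tile-axioms : Fm
  tile-axioms =
    (⋀ (fin-code D) λ a → ⋀ (fin-code E) λ b →
         (⋁ tile-code λ x → til (x , a , b))
      ∧ᶠ (⋀ tile-code λ x → til (x , a , b) ⇒
             ⌜ good? x ⌝
          ∧ᶠ (⋀ tile-code λ y → next-time y a b ⇒ ⌜ vert? x y ⌝)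
          ∧ᶠ (⋀ tile-code λ y → next-space y a b ⇒ ⌜ horiz? x y ⌝)
          ∧ᶠ (⌜ toℕ b ℕ.≟ 0 ⌝ ⇒ Each zeros pds ⇒ ⌜ first? x ⌝)
          ∧ᶠ (⌜ suc (toℕ b) ℕ.≟ E ⌝ ⇒ Each tops pds ⇒ ⌜ last? x ⌝)
          ∧ᶠ (⌜ toℕ a ℕ.≟ 0 ⌝ ⇒ Each zeros tds ⇒ input-axioms x b)
          ∧ᶠ (⌜ suc (toℕ a) ℕ.≟ D ⌝ ⇒ Each tops tds ⇒ ⌜ halt? x ⌝)))

  axioms : Fm
  axioms = order-axioms ∧ᶠ pair-axioms ∧ᶠ binary-axioms ∧ᶠ tile-axioms

  module _ {n : ℕ} (I : Interp n) where
    open Interp I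

    assign-elim : ∀ f c φ ρ → ⟦ I ⟧ (assign f c φ) ρ →
      ∃ λ u → Fixᴵ f (ρ (cvar c)) u u × ⟦ I ⟧ φ (upd (upd ρ aux u) (cvar c) u)
    assign-elim f c φ ρ (u , r , v , e , h) =
      u , subst (λ v → Fixᴵ f v u u) (upd-other ρ aux u (cvar c) (cvar≢aux c)) r
        , subst (λ v → ⟦ I ⟧ φ (upd (upd ρ aux u) (cvar c) v)) v≡u h
      where
      v≡u : v ≡ u
      v≡u = trans (sym (upd-same (upd ρ aux u) (cvar c) v))
        (trans e (upd-other (upd ρ aux u) (cvar c) v aux (cvar≢aux c ∘ sym)))

    assign-intro : ∀ f c φ ρ u → Fixᴵ f (ρ (cvar c)) u u → ⟦ I ⟧ φ (upd (upd ρ aux u) (cvar c) u) →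
      ⟦ I ⟧ (assign f c φ) ρ
    assign-intro f c φ ρ u r h =
      u , subst (λ v → Fixᴵ f v u u) (sym (upd-other ρ aux u (cvar c) (cvar≢aux c))) r
        , u , trans (upd-same (upd ρ aux u) (cvar c) u)
                    (sym (upd-other (upd ρ aux u) (cvar c) u aux (cvar≢aux c ∘ sym)))
        , h

    each-elim : ∀ r cs ρ → ⟦ I ⟧ (Each r cs) ρ → ∀ {c} → c ∈ cs →
      Fixᴵ (inj₁ (r , kind c)) (ρ (cvar c)) (ρ (cvar c)) (ρ (cvar c))
    each-elim r (c ∷ cs) ρ (h , hs) (here refl) = h
    each-elim r (c ∷ cs) ρ (h , hs) (there m)   = each-elim r cs ρ hs m

    each-intro : ∀ r cs ρ → (∀ {c} → c ∈ cs →
      Fixᴵ (inj₁ (r , kind c)) (ρ (cvar c)) (ρ (cvar c)) (ρ (cvar c))) → ⟦ I ⟧ (Each r cs) ρ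
    each-intro r []       ρ h = tt
    each-intro r (c ∷ cs) ρ h = h (here refl) , each-intro r cs ρ (h ∘ there)

-- The model given by a tiling

-- value i is the number represented by the bits 0, …, i of w.
record Prefixes (w : List Bool) (n : ℕ) : Set where
  field
    end       : ℕ
    value     : ℕ → ℕ
    zeroth    : look w 0 ≡ just true × value 0 ≡ 1
    next      : ∀ {i} → i < end → Σ Bool λ b → look w (suc i) ≡ just b
                × value (suc i) ≡ (if b then suc (2 * value i) else 2 * value i)
    total     : value end ≡ n
    after-end : ∀ {i} → end < i → look w i ≡ nothing

module Model (k' : ℕ) (𝒯 : TileSystem) (D₀ n₁ s₁ : ℕ) (s²≤n : suc s₁ * suc s₁ ≤ suc n₁)
  (w : List Bool) (w≈n : Prefixes w (suc n₁)) where

  open TileSystem 𝒯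
  open Axioms k' 𝒯 D₀
  open Prefixes w≈n

  n s : ℕ
  n = suc n₁
  s = suc s₁

  open MixedRadix {Coord k} _≟ᶜ_ (base n s)
  open Segment n s D (suc k') (s≤s z≤n) (s≤s z≤n)

  module WithTiling (T : Tiling 𝒯 (λ _ → ⊤) (weight pds * D) w) where
    open Tiling T

    dv : Fin 3 → Fin n → ℕ
    dv std u = toℕ u
    dv hi  u = toℕ u / s
    dv lo  u = toℕ u % s

    max : Fin 3 → ℕ
    max std = n
    max hi  = s
    max lo  = s

    -- The digit that shares the variable with the one being changed; steps and wraps have to
    -- preserve it.
    other : Fin 3 → Fin n → Fin n → Set
    other std u v = ⊤
    other hi  u v = dv lo u ≡ dv lo v
    other lo  u v = dv hi u ≡ dv hi v

    other? : ∀ κ u v → Dec (other κ u v)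
    other? std u v = yes tt
    other? hi  u v = _ ℕ.≟ _
    other? lo  u v = _ ℕ.≟ _

    max-kind : (c : Coord k) → max (kind c) ≡ base n s c
    max-kind (tc _) = refl
    max-kind (pc _) = refl
    max-kind hc     = refl
    max-kind gc     = refl

    δ : (V → Fin n) → Digits
    δ ρ c = dv (kind c) (ρ (cvar c))

    Fixed : Fix → Fin n → Fin n → Fin n → Set
    Fixed (stp κ) u v _ = dv κ v ≡ suc (dv κ u) × other κ u v
    Fixed (wrp κ) u v _ = suc (dv κ u) ≡ max κ × dv κ v ≡ 0 × other κ u v
    Fixed (zer κ) u _ _ = dv κ u ≡ 0
    Fixed (top κ) u _ _ = suc (dv κ u) ≡ max κ
    Fixed less u v _    = toℕ u < toℕ v
    Fixed root u _ _    = suc (toℕ u) ≡ s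
    Fixed pair u v z    = dv hi z ≡ toℕ u × dv lo z ≡ toℕ v
    Fixed child₀ u v _  = toℕ v ≡ suc (2 * toℕ u)
    Fixed child₁ u v _  = toℕ v ≡ suc (suc (2 * toℕ u))
    Fixed bit₀ u _ _    = look w (toℕ u) ≡ just false
    Fixed bit₁ u _ _    = look w (toℕ u) ≡ just true
    Fixed path u v _    = toℕ u ≤ end × value (toℕ u) ≡ suc (toℕ v)

    Fixed? : ∀ f u v z → Dec (Fixed f u v z)
    Fixed? (stp κ) u v _ = dv κ v ℕ.≟ _ ×-dec other? κ u v
    Fixed? (wrp κ) u v _ = _ ℕ.≟ max κ ×-dec dv κ v ℕ.≟ 0 ×-dec other? κ u v
    Fixed? (zer κ) u _ _ = dv κ u ℕ.≟ 0
    Fixed? (top κ) u _ _ = _ ℕ.≟ max κ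
    Fixed? less u v _    = toℕ u ℕ.<? toℕ v
    Fixed? root u _ _    = _ ℕ.≟ s
    Fixed? pair u v z    = dv hi z ℕ.≟ toℕ u ×-dec dv lo z ℕ.≟ toℕ v
    Fixed? child₀ u v _  = toℕ v ℕ.≟ _
    Fixed? child₁ u v _  = toℕ v ℕ.≟ _
    Fixed? bit₀ u _ _    = Maybe.≡-dec Bool._≟_ _ _
    Fixed? bit₁ u _ _    = Maybe.≡-dec Bool._≟_ _ _
    Fixed? path u v _    = toℕ u ℕ.≤? end ×-dec value (toℕ u) ℕ.≟ _

    -- For u ≥ s² in `mix` the digit u / s is too large, and the row may lie past the last one.
    -- Steps still add exactly one, which is what the vertical constraints are about. Columns stay
    -- in range, as `lo` is a remainder.
    at-time : (V → Fin n) → Fin D → ℕ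
    at-time ρ a = num tds (δ ρ) (toℕ a)

    at-cell : (V → Fin n) → Fin E → ℕ
    at-cell ρ b = num pds (δ ρ) (toℕ b)

    model : Interp n
    model = record
      { Fixᴵ = Fixed
      ; Fixᴵ? = Fixed?
      ; Tilᴵ = λ (x , a , b) ρ → x ≡ τ (at-time ρ a) (at-cell ρ b)
      ; Tilᴵ? = λ (x , a , b) ρ → Code.decEq tile-code x _
      ; Tilᴵ-cong = λ (x , a , b) {ρ} {ρ'} agree e → trans e
          (cong₂ τ (num-cong tds λ {c} _ → cong (dv (kind c)) (agree (cvar c) (cvar≢aux c)))
                   (num-cong pds λ {c} _ → cong (dv (kind c)) (agree (cvar c) (cvar≢aux c)))) }

    order-holds : ∀ ρ → ⟦ model ⟧ order-axioms ρ
    order-holds ρ =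
        (λ a → ℕ.<-irrefl refl)
      , (λ a b c → ℕ.<-trans)
      , (λ a b → total-order a b)
      , (λ a none → smallest a none)
      , (λ a b a≡0 b<a → ℕ.n≮0 (subst (toℕ b <_) a≡0 b<a))
      , (λ a none → greatest a none)
      , (λ a b a<b none → successor a b a<b none , tt)
      , (λ a b a-top b-zero → a-top , b-zero , tt)
      where
      total-order : ∀ a b → a ≡ b ⊎ toℕ a < toℕ b ⊎ toℕ b < toℕ a
      total-order a b with ℕ.<-cmp (toℕ a) (toℕ b)
      ... | tri< l _ _ = inj₂ (inj₁ l)
      ... | tri≈ _ e _ = inj₁ (Fin.toℕ-injective e)
      ... | tri> _ _ g = inj₂ (inj₂ g)
      smallest : ∀ a → (∀ b → toℕ b < toℕ a → ⊥) → toℕ a ≡ 0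
      smallest zero    none = refl
      smallest (suc a) none = ⊥-elim (none zero (s≤s z≤n))
      greatest : ∀ a → (∀ b → toℕ a < toℕ b → ⊥) → suc (toℕ a) ≡ n
      greatest a none with ℕ.m≤n⇒m<n∨m≡n (Fin.toℕ<n a)
      ... | inj₂ e = e
      ... | inj₁ l = ⊥-elim (none (fromℕ< l) (subst (toℕ a <_) (sym (Fin.toℕ-fromℕ< l)) (ℕ.n<1+n _)))
      successor : ∀ a b → toℕ a < toℕ b → (∀ c → toℕ a < toℕ c → toℕ c < toℕ b → ⊥) → toℕ b ≡ suc (toℕ a)
      successor a b a<b none with ℕ.m≤n⇒m<n∨m≡n a<b
      ... | inj₂ e = sym e
      ... | inj₁ l = ⊥-elim (none c (subst (toℕ a <_) (sym c≡) (ℕ.n<1+n _)) (subst (_< toℕ b) (sym c≡) l))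
        where
        c : Fin n
        c = fromℕ< (ℕ.<-trans l (Fin.toℕ<n b))
        c≡ : toℕ c ≡ suc (toℕ a)
        c≡ = Fin.toℕ-fromℕ< (ℕ.<-trans l (Fin.toℕ<n b))

    pair-holds : ∀ ρ → ⟦ model ⟧ pair-axioms ρ
    pair-holds ρ =
        (fromℕ< s≤n , cong suc (Fin.toℕ-fromℕ< s≤n))
      , (λ a b c c≡ c≮a c≮b → code a b
          (ℕ.≤-<-trans (ℕ.≮⇒≥ c≮a) (ℕ.≤-reflexive c≡)) (ℕ.≤-<-trans (ℕ.≮⇒≥ c≮b) (ℕ.≤-reflexive c≡)))
      , (λ a b c d e (h₁ , l₁) (h₂ , l₂) →
            (λ (c≡ , _) → trans h₂ (trans c≡ (cong suc (sym h₁))) , trans l₁ (sym l₂))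
          , (λ a≡ c≡ → trans (cong suc h₁) a≡ , trans h₂ c≡ , trans l₁ (sym l₂)))
      , (λ a b c d e (h₁ , l₁) (h₂ , l₂) →
            (λ (c≡ , _) → trans l₂ (trans c≡ (cong suc (sym l₁))) , trans h₁ (sym h₂))
          , (λ a≡ c≡ → trans (cong suc l₁) a≡ , trans l₂ c≡ , trans h₁ (sym h₂)))
      , (λ a b d (h , l) →
            (λ a≡ → trans h a≡) , (λ a≡ → trans (cong suc h) a≡)
          , (λ b≡ → trans l b≡) , (λ b≡ → trans (cong suc l) b≡)
          , (λ d≡ → trans (sym l) d≡))
      where
      s≤n : s ≤ n
      s≤n = ℕ.≤-trans (ℕ.m≤m*n s s) s²≤n
      code : ∀ (a b : Fin n) → toℕ a < s → toℕ b < s → Σ (Fin n) λ z → dv hi z ≡ toℕ a × dv lo z ≡ toℕ b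
      code a b a<s b<s = fromℕ< z<n , proj₂ parts , proj₁ parts
        where
        z<n : toℕ b + s * toℕ a < n
        z<n = begin-strict
          toℕ b + s * toℕ a   <⟨ ℕ.+-monoˡ-< _ b<s ⟩
          s + s * toℕ a       ≡⟨ ℕ.*-suc s (toℕ a) ⟨
          s * suc (toℕ a)     ≤⟨ ℕ.*-monoʳ-≤ s a<s ⟩
          s * s               ≤⟨ s²≤n ⟩
          n                   ∎
          where open ℕ.≤-Reasoning
        z = toℕ (fromℕ< z<n)
        parts : z % s ≡ toℕ b × z / s ≡ toℕ a
        parts = +*-unique s (m%n<n z s) b<s (begin
          z % s + s * (z / s)   ≡⟨ cong (z % s +_) (ℕ.*-comm s (z / s)) ⟩
          z % s + z / s * s     ≡⟨ m≡m%n+[m/n]*n z s ⟨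
          z                     ≡⟨ Fin.toℕ-fromℕ< z<n ⟩
          toℕ b + s * toℕ a     ∎)
          where open ≡-Reasoning

    -- Each further bit at least doubles a positive value and so adds at least one. The consequence
    -- `end<n` makes every position of the word an element of the universe.
    value-positive : ∀ {i} → i ≤ end → i < value i
    value-positive {zero}  _ = ℕ.≤-reflexive (sym (proj₂ zeroth))
    value-positive {suc i} i<e with next i<e
    ... | b , _ , e = ℕ.<-≤-trans (subst (_< value i + 1) (ℕ.+-comm i 1) (ℕ.+-monoˡ-< 1 (value-positive {i} (ℕ.<⇒≤ i<e))))
          (ℕ.≤-trans (double b) (ℕ.≤-reflexive (sym e)))
      where
      doubled : value i + 1 ≤ 2 * value i
      doubled = ℕ.+-monoʳ-≤ (value i)
        (ℕ.≤-trans (ℕ.≤-trans (s≤s z≤n) (value-positive {i} (ℕ.<⇒≤ i<e))) (ℕ.m≤m+n (value i) 0))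
      double : ∀ b → value i + 1 ≤ (if b then suc (2 * value i) else 2 * value i)
      double false = doubled
      double true  = ℕ.m≤n⇒m≤1+n doubled

    end<n : end < n
    end<n = subst (end <_) total (value-positive ℕ.≤-refl)

    binary-holds : ∀ ρ → ⟦ model ⟧ binary-axioms ρ
    binary-holds ρ =
        (λ a b a≡0 (b≡ , _) → trans b≡ (cong suc (trans a≡0 (sym (cong (2 *_) a≡0)))))
      , (λ a b c d e b≡ (c≡ , _) (d≡ , _) (e≡ , _) → begin
          toℕ e                        ≡⟨ e≡ ⟩
          suc (toℕ d)                  ≡⟨ cong suc d≡ ⟩
          suc (suc (toℕ b))            ≡⟨ cong (λ x → suc (suc x)) b≡ ⟩
          suc (suc (suc (2 * toℕ a)))  ≡⟨ cong suc (ℕ.*-suc 2 (toℕ a)) ⟨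
          suc (2 * suc (toℕ a))        ≡⟨ cong (λ x → suc (2 * x)) c≡ ⟨
          suc (2 * toℕ c)              ∎)
      , (λ a b c b≡ (c≡ , _) → trans c≡ (cong suc b≡))
      , (λ a b c d (a≤ , v≡) (a≡ , _) →
            (λ b≡ → path₀ a b c d a≤ v≡ a≡ b≡) , (λ b≡ → path₁ a b c d a≤ v≡ a≡ b≡))
      , (λ a b (a≤ , v≡) →
            (λ a≡0 → ℕ.suc-injective (trans (sym v≡) (trans (cong value a≡0) (proj₂ zeroth)))
                   , trans (cong (look w) a≡0) (proj₁ zeroth))
          , (λ b≡0 → ℕ.n<1⇒n≡0 (subst (toℕ a <_) (trans v≡ (cong suc b≡0)) (value-positive a≤))))
      , last-bit
      , (λ b b≡ → ℕ.≤-reflexive last-bit≡ , trans (cong value last-bit≡) (trans total (sym b≡)))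
      , (λ c e<c → absent {false} c e<c , absent {true} c e<c)
      where
      open ≡-Reasoning
      last-bit : Fin n
      last-bit = fromℕ< end<n
      last-bit≡ : toℕ last-bit ≡ end
      last-bit≡ = Fin.toℕ-fromℕ< end<n
      absent : ∀ {b} (c : Fin n) → toℕ last-bit < toℕ c → look w (toℕ c) ≡ just b → ⊥
      absent c e<c e with trans (sym e) (after-end (subst (_< toℕ c) last-bit≡ e<c))
      ... | ()
      step-back : ∀ (a c : Fin n) → toℕ a ≤ end → toℕ a ≡ suc (toℕ c) → toℕ c < end
      step-back a c a≤ a≡ = subst (_≤ end) a≡ a≤
      path₀ : ∀ (a b c d : Fin n) → toℕ a ≤ end → value (toℕ a) ≡ suc (toℕ b) → toℕ a ≡ suc (toℕ c) →
        toℕ b ≡ suc (2 * toℕ d) → look w (toℕ a) ≡ just false × toℕ c ≤ end × value (toℕ c) ≡ suc (toℕ d)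
      path₀ a b c d a≤ v≡ a≡ b≡ with next (step-back a c a≤ a≡)
      ... | false , l , e = trans (cong (look w) a≡) l , ℕ.<⇒≤ (step-back a c a≤ a≡) ,
        ℕ.*-cancelˡ-≡ (value (toℕ c)) (suc (toℕ d)) 2 (begin
          2 * value (toℕ c)        ≡⟨ e ⟨
          value (suc (toℕ c))      ≡⟨ cong value a≡ ⟨
          value (toℕ a)            ≡⟨ v≡ ⟩
          suc (toℕ b)              ≡⟨ cong suc b≡ ⟩
          suc (suc (2 * toℕ d))    ≡⟨ ℕ.*-suc 2 (toℕ d) ⟨
          2 * suc (toℕ d)          ∎)
      ... | true , l , e = ⊥-elim (ℕ.even≢odd (suc (toℕ d)) (value (toℕ c)) (begin
          2 * suc (toℕ d)          ≡⟨ ℕ.*-suc 2 (toℕ d) ⟩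
          suc (suc (2 * toℕ d))    ≡⟨ cong suc b≡ ⟨
          suc (toℕ b)              ≡⟨ v≡ ⟨
          value (toℕ a)            ≡⟨ cong value a≡ ⟩
          value (suc (toℕ c))      ≡⟨ e ⟩
          suc (2 * value (toℕ c))  ∎))
      path₁ : ∀ (a b c d : Fin n) → toℕ a ≤ end → value (toℕ a) ≡ suc (toℕ b) → toℕ a ≡ suc (toℕ c) →
        toℕ b ≡ suc (suc (2 * toℕ d)) → look w (toℕ a) ≡ just true × toℕ c ≤ end × value (toℕ c) ≡ suc (toℕ d)
      path₁ a b c d a≤ v≡ a≡ b≡ with next (step-back a c a≤ a≡)
      ... | true , l , e = trans (cong (look w) a≡) l , ℕ.<⇒≤ (step-back a c a≤ a≡) ,
        ℕ.*-cancelˡ-≡ (value (toℕ c)) (suc (toℕ d)) 2 (ℕ.suc-injective (begin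
          suc (2 * value (toℕ c))  ≡⟨ e ⟨
          value (suc (toℕ c))      ≡⟨ cong value a≡ ⟨
          value (toℕ a)            ≡⟨ v≡ ⟩
          suc (toℕ b)              ≡⟨ cong suc b≡ ⟩
          suc (suc (suc (2 * toℕ d))) ≡⟨ cong suc (ℕ.*-suc 2 (toℕ d)) ⟨
          suc (2 * suc (toℕ d))    ∎))
      ... | false , l , e = ⊥-elim (ℕ.even≢odd (value (toℕ c)) (suc (toℕ d)) (begin
          2 * value (toℕ c)        ≡⟨ e ⟨
          value (suc (toℕ c))      ≡⟨ cong value a≡ ⟨
          value (toℕ a)            ≡⟨ v≡ ⟩
          suc (toℕ b)              ≡⟨ cong suc b≡ ⟩
          suc (suc (suc (2 * toℕ d))) ≡⟨ cong suc (ℕ.*-suc 2 (toℕ d)) ⟨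
          suc (2 * suc (toℕ d))    ∎))

    -- Only `hc` and `gc` have a variable in common, and for them `other` says that the second digit
    -- is kept.
    digit-shared : (c d : Coord k) → d ≢ c → cvar d ≡ cvar c →
      ∀ {u v} → other (kind c) u v → dv (kind d) v ≡ dv (kind d) u
    digit-shared (tc i) (tc j) d≢c refl o = ⊥-elim (d≢c refl)
    digit-shared (pc i) (pc j) d≢c refl o = ⊥-elim (d≢c refl)
    digit-shared hc hc d≢c e o = ⊥-elim (d≢c refl)
    digit-shared gc gc d≢c e o = ⊥-elim (d≢c refl)
    digit-shared hc gc d≢c e o = sym o
    digit-shared gc hc d≢c e o = sym o

    set : (V → Fin n) → Coord k → Fin n → V → Fin n
    set ρ c u = upd (upd ρ aux u) (cvar c) u

    set-same : ∀ ρ c u → δ (set ρ c u) c ≡ dv (kind c) u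
    set-same ρ c u = cong (dv (kind c)) (upd-same (upd ρ aux u) (cvar c) u)

    set-other : ∀ ρ c u d → d ≢ c → other (kind c) (ρ (cvar c)) u → δ (set ρ c u) d ≡ δ ρ d
    set-other ρ c u d d≢c o with cvar d ≟ᵛ cvar c
    ... | yes e = trans (digit-shared c d d≢c e {ρ (cvar c)} {u} o) (cong (λ x → dv (kind d) (ρ x)) (sym e))
    ... | no ≢  = cong (dv (kind d)) (upd-other ρ aux u (cvar d) (cvar≢aux d))

    next-num : ∀ {cs} → Unique cs → ∀ carry φ ρ → ⟦ model ⟧ (Next cs carry φ) ρ →
      Σ (V → Fin n) λ ρ' → (∀ {d} → d ∉ cs → δ ρ' d ≡ δ ρ d)
        × ((⟦ model ⟧ φ ρ' × ∀ a → num cs (δ ρ') a ≡ suc (num cs (δ ρ) a))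
         ⊎ (⟦ model ⟧ carry ρ' × ∀ a → num cs (δ ρ') (suc a) ≡ suc (num cs (δ ρ) a)))
    next-num [] carry φ ρ h = ρ , (λ _ → refl) , inj₂ (h , λ _ → refl)
    next-num {c ∷ cs} (c∉ ∷ uniq) carry φ ρ (inj₁ h) with assign-elim model (stp (kind c)) c φ ρ h
    ... | u , (u≡ , o) , φρ' = set ρ c u , (λ d∉ → set-other ρ c u _ (d∉ ∘ here) o) , inj₁ (φρ' , λ a →
      cong₂ (λ r q → r + base n s c * q) (trans (set-same ρ c u) u≡)
        (num-cong cs λ {d} d∈ → set-other ρ c u d (λ { refl → All.lookup c∉ d∈ refl }) o))
    next-num {c ∷ cs} (c∉ ∷ uniq) carry φ ρ (inj₂ h) with assign-elim model (wrp (kind c)) c (Next cs carry φ) ρ h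
    ... | u , (top≡ , u≡0 , o) , h' with next-num uniq carry φ (set ρ c u) h'
    ... | ρ' , same , result = ρ' , (λ d∉ → trans (same (d∉ ∘ there)) (set-other ρ c u _ (d∉ ∘ here) o)) , finish result
      where
      value' : ∀ {q a} → q ≡ suc (num cs (δ (set ρ c u)) a) → δ ρ' c + base n s c * q ≡ suc (num (c ∷ cs) (δ ρ) a)
      value' {q} {a} e = begin
        δ ρ' c + base n s c * q
          ≡⟨ cong₂ (λ r q → r + base n s c * q)
               (trans (same λ c∈ → All.lookup c∉ c∈ refl) (trans (set-same ρ c u) u≡0)) e ⟩
        base n s c * suc (num cs (δ (set ρ c u)) a)
          ≡⟨ cong (λ q → base n s c * suc q)
               (num-cong cs λ {d} d∈ → set-other ρ c u d (λ { refl → All.lookup c∉ d∈ refl }) o) ⟩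
        base n s c * suc (num cs (δ ρ) a)
          ≡⟨ ℕ.*-suc (base n s c) _ ⟩
        base n s c + base n s c * num cs (δ ρ) a
          ≡⟨ cong (_+ base n s c * num cs (δ ρ) a) (trans top≡ (max-kind c)) ⟨
        suc (δ ρ c + base n s c * num cs (δ ρ) a) ∎
        where open ≡-Reasoning
      finish : _ → _
      finish (inj₁ (hφ , e)) = inj₁ (hφ , λ a → value' (e a))
      finish (inj₂ (h , e)) = inj₂ (h , λ a → value' (e a))

    space-range : ∀ ρ → InRange pds (δ ρ)
    space-range ρ {c} m with ∈-space⁻ (suc k') m
    ... | inj₁ (i , refl) = Fin.toℕ<n (ρ (pv i))
    ... | inj₂ refl = m%n<n (toℕ (ρ mix)) s

    O : ℕ
    O = weight pds * D

    cell< : ∀ ρ b → at-cell ρ b < O + O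
    cell< ρ b = subst (at-cell ρ b <_) (ℕ.*-distribˡ-+ (weight pds) D D)
      (num<weight* pds (space-range ρ) (Fin.toℕ<n b))

    digit-zero : ∀ {cs} ρ → ⟦ model ⟧ (Each zeros cs) ρ → ∀ {c} → c ∈ cs → δ ρ c ≡ 0
    digit-zero {cs} ρ h m = each-elim model zeros cs ρ h m

    digit-top : ∀ {cs} ρ → ⟦ model ⟧ (Each tops cs) ρ → ∀ {c} → c ∈ cs → suc (δ ρ c) ≡ base n s c
    digit-top {cs} ρ h {c} m = trans (each-elim model tops cs ρ h m) (max-kind c)

    next-time-num : ∀ ρ y a b → ⟦ model ⟧ (next-time y a b) ρ → y ≡ τ (suc (at-time ρ a)) (at-cell ρ b)
    next-time-num ρ y a b h with next-num (time-unique (suc k')) _ _ ρ h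
    ... | ρ' , same , result = finish result
      where
      cell≡ : at-cell ρ' b ≡ at-cell ρ b
      cell≡ = num-cong pds λ m → same λ m' → time-space-disjoint (suc k') m' m
      finish : _ → y ≡ τ (suc (at-time ρ a)) (at-cell ρ b)
      finish (inj₁ (y≡ , e)) = trans y≡ (cong₂ τ (e (toℕ a)) cell≡)
      finish (inj₂ ((a' , a'≡ , y≡) , e)) =
        trans y≡ (cong₂ τ (trans (cong (num tds (δ ρ')) a'≡) (e (toℕ a))) cell≡)

    next-space-num : ∀ ρ y a b → ⟦ model ⟧ (next-space y a b) ρ →
      suc (at-cell ρ b) < O + O × y ≡ τ (at-time ρ a) (suc (at-cell ρ b))
    next-space-num ρ y a b h with next-num (space-unique (suc k')) _ _ ρ h
    ... | ρ' , same , result = finish result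
      where
      time≡ : at-time ρ' a ≡ at-time ρ a
      time≡ = num-cong tds λ m → same (time-space-disjoint (suc k') m)
      finish : _ → suc (at-cell ρ b) < O + O × y ≡ τ (at-time ρ a) (suc (at-cell ρ b))
      finish (inj₁ (y≡ , e)) =
        subst (_< O + O) (e (toℕ b)) (cell< ρ' b) , trans y≡ (cong₂ τ time≡ (e (toℕ b)))
      finish (inj₂ ((b' , b'≡ , y≡) , e)) =
        subst (_< O + O) cell≡ (cell< ρ' b') , trans y≡ (cong₂ τ time≡ cell≡)
        where
        cell≡ : at-cell ρ' b' ≡ suc (at-cell ρ b)
        cell≡ = trans (cong (num pds (δ ρ')) b'≡) (e (toℕ b))

    at-row-0 : ∀ {P : Tile → Set} ρ a b → toℕ a ≡ 0 → ⟦ model ⟧ (Each zeros tds) ρ →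
      P (τ 0 (at-cell ρ b)) → P (τ (at-time ρ a) (at-cell ρ b))
    at-row-0 {P} ρ a b a≡0 z = subst (λ t → P (τ t (at-cell ρ b)))
      (sym (trans (num-zeros tds (toℕ a) (digit-zero ρ z)) (trans (cong (weight tds *_) a≡0) (ℕ.*-zeroʳ (weight tds)))))

    input-holds : ∀ ρ b → ⟦ model ⟧ (input-axioms (τ 0 (at-cell ρ b)) b) ρ
    input-holds ρ b = started (cell< ρ b) , inside , outside
      where
      p = at-cell ρ b
      i = toℕ (ρ (pv 0F))
      inside : ⟦ model ⟧ (input-segment b) ρ → _
      inside (b≡D , z) =
          (λ i≡0 → subst (λ h → Head h (τ 0 p))
            (trans (cong (_≡ᵇ O) (trans p≡ (trans (cong (O +_) i≡0) (ℕ.+-identityʳ O)))) (≡ᵇ-refl O)) head-p)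
        , (λ i≢0 → subst (λ h → Head h (τ 0 p)) (<⇒≡ᵇ-false (subst (O <_) (sym p≡) (ℕ.m<m+n O (ℕ.n≢0⇒n>0 i≢0))))
            head-p)
        , (λ e → subst (λ m → Sym m (τ 0 p)) e input-p)
        , (λ e → subst (λ m → Sym m (τ 0 p)) e input-p)
        , (λ ≢0 ≢1 → subst (λ m → Sym m (τ 0 p)) (neither ≢0 ≢1) input-p)
        where
        p≡ : p ≡ O + i
        p≡ = segment-num b≡D (digit-zero ρ z)
        head-p : Head (p ≡ᵇ O) (τ 0 p)
        head-p = head (cell< ρ b)
        input-p : Sym (look w i) (τ 0 p)
        input-p = subst (λ p → Sym (look w i) (τ 0 p)) (sym p≡) (input (subst (_< O + O) p≡ (cell< ρ b)))
        neither : look w i ≢ just false → look w i ≢ just true → look w i ≡ nothing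
        neither ≢0 ≢1 with look w i
        ... | nothing = refl
        ... | just false = ⊥-elim (≢0 refl)
        ... | just true = ⊥-elim (≢1 refl)
      outside : (⟦ model ⟧ (input-segment b) ρ → ⊥) → Head false (τ 0 p) × Sym nothing (τ 0 p)
      outside not-in with ℕ.<-≤-connex p O
      ... | inj₁ p<O = subst (λ h → Head h (τ 0 p)) (<⇒≡ᵇ-falseˡ p<O) (head (cell< ρ b)) , left p<O
      ... | inj₂ O≤p with j , O+j≡p ← ℕ.m≤n⇒∃[o]m+o≡n O≤p | ℕ.<-≤-connex j n
      ...   | inj₁ j<n with num-segment (space-range ρ) (sym O+j≡p) j<n
      ...     | _ , b≡D , z = ⊥-elim (not-in (b≡D , each-intro model zeros (tail (suc k')) ρ z))
      -- To the right of the segment the word has ended, since its last position is below n.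
      outside not-in | inj₂ O≤p | inj₂ n≤j =
          subst (λ h → Head h (τ 0 p)) (<⇒≡ᵇ-false (subst (O <_) O+j≡p (ℕ.m<m+n O (ℕ.<-≤-trans (s≤s z≤n) n≤j))))
            (head (cell< ρ b))
        , subst (λ p → Sym nothing (τ 0 p)) O+j≡p
            (subst (λ m → Sym m (τ 0 (O + j))) (after-end (ℕ.<-≤-trans end<n n≤j))
              (input (subst (_< O + O) (sym O+j≡p) (cell< ρ b))))

    tile-holds : ∀ ρ → ⟦ model ⟧ tile-axioms ρ
    tile-holds ρ a b = (τ (at-time ρ a) (at-cell ρ b) , refl) , λ where
      x refl →
          good tt (cell< ρ b)
        , (λ y h → subst (Vert x) (sym (next-time-num ρ y a b h)) (vert tt (cell< ρ b)))
        , (λ y h → subst (Horiz x) (sym (proj₂ (next-space-num ρ y a b h))) (horiz tt (proj₁ (next-space-num ρ y a b h))))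
        , (λ b≡0 z → subst (λ p → First (τ (at-time ρ a) p))
            (sym (trans (num-zeros pds (toℕ b) (digit-zero ρ z)) (trans (cong (weight pds *_) b≡0) (ℕ.*-zeroʳ (weight pds)))))
            (first tt))
        , (λ b≡E z → last tt (trans (num-tops pds (toℕ b) (digit-top ρ z))
            (trans (cong (weight pds *_) b≡E) (ℕ.*-distribˡ-+ (weight pds) D D))))
        , (λ a≡0 z → at-row-0 {λ x → ⟦ model ⟧ (input-axioms x b) ρ} ρ a b a≡0 z (input-holds ρ b))
        , (λ a≡D z → halt (trans (num-tops tds (toℕ a) (digit-top ρ z))
            (trans (cong (weight tds *_) a≡D) (cong (_* D) (trans (weight-time n s {suc k'}) (sym (weight-space n s {suc k'}))))))
            (cell< ρ b))

    model-holds : ∀ ρ → ⟦ model ⟧ axioms ρ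
    model-holds ρ = order-holds ρ , pair-holds ρ , binary-holds ρ , tile-holds ρ

-- The tiling given by a model

count : ∀ {m} {P : Fin m → Set} → (∀ i → Dec (P i)) → ℕ
count {zero}  P? = 0
count {suc m} P? = (if does (P? zero) then 1 else 0) + count (P? ∘ suc)

count-mono : ∀ {m} {P Q : Fin m → Set} (P? : ∀ i → Dec (P i)) (Q? : ∀ i → Dec (Q i)) →
  (∀ i → P i → Q i) → count P? ≤ count Q?
count-mono {zero}  P? Q? h = z≤n
count-mono {suc m} P? Q? h with P? zero | Q? zero
... | yes _ | yes _ = s≤s (count-mono (P? ∘ suc) (Q? ∘ suc) (h ∘ suc))
... | no _  | no _  = count-mono (P? ∘ suc) (Q? ∘ suc) (h ∘ suc)
... | no _  | yes _ = ℕ.m≤n⇒m≤1+n (count-mono (P? ∘ suc) (Q? ∘ suc) (h ∘ suc))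
... | yes p | no ¬q = ⊥-elim (¬q (h zero p))

count-mono-< : ∀ {m} {P Q : Fin m → Set} (P? : ∀ i → Dec (P i)) (Q? : ∀ i → Dec (Q i)) →
  (∀ i → P i → Q i) → ∀ i → Q i → ¬ P i → count P? < count Q?
count-mono-< P? Q? h zero q ¬p with P? zero | Q? zero
... | yes p | _     = ⊥-elim (¬p p)
... | no _  | no ¬q = ⊥-elim (¬q q)
... | no _  | yes _ = s≤s (count-mono (P? ∘ suc) (Q? ∘ suc) (h ∘ suc))
count-mono-< P? Q? h (suc i) q ¬p with P? zero | Q? zero
... | yes _ | yes _ = s≤s (count-mono-< (P? ∘ suc) (Q? ∘ suc) (h ∘ suc) i q ¬p)
... | no _  | no _  = count-mono-< (P? ∘ suc) (Q? ∘ suc) (h ∘ suc) i q ¬p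
... | no _  | yes _ = ℕ.m≤n⇒m≤1+n (count-mono-< (P? ∘ suc) (Q? ∘ suc) (h ∘ suc) i q ¬p)
... | yes p | no ¬q = ⊥-elim (¬q (h zero p))

count-all : ∀ m → count {m} {λ _ → ⊤} (λ _ → yes tt) ≡ m
count-all zero    = refl
count-all (suc m) = cong suc (count-all m)

module Enumerate (n₁ : ℕ) (_≺_ : Fin (suc n₁) → Fin (suc n₁) → Set) (_≺?_ : ∀ a b → Dec (a ≺ b))
  (irrefl : ∀ a → ¬ a ≺ a) (≺-trans : ∀ a b c → a ≺ b → b ≺ c → a ≺ c)
  (total : ∀ a b → a ≡ b ⊎ a ≺ b ⊎ b ≺ a) where

  n : ℕ
  n = suc n₁

  rank : Fin n → ℕ
  rank a = count (_≺? a)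

  rank< : ∀ a → rank a < n
  rank< a = subst (rank a <_) (count-all n)
    (count-mono-< (_≺? a) (λ _ → yes tt) (λ _ _ → tt) a tt (irrefl a))

  rank-mono : ∀ {a b} → a ≺ b → rank a < rank b
  rank-mono {a} {b} a≺b = count-mono-< (_≺? a) (_≺? b) (λ c c≺a → ≺-trans c a b c≺a a≺b) a a≺b (irrefl a)

  rank-injective : ∀ {a b} → rank a ≡ rank b → a ≡ b
  rank-injective {a} {b} e with total a b
  ... | inj₁ a≡b = a≡b
  ... | inj₂ (inj₁ a≺b) = ⊥-elim (ℕ.<-irrefl e (rank-mono a≺b))
  ... | inj₂ (inj₂ b≺a) = ⊥-elim (ℕ.<-irrefl (sym e) (rank-mono b≺a))

  -- If no element had rank i, then `rank` with the value i punched out would inject n elements into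
  -- n - 1.
  unrank : ∀ {i} → i < n → ∃ λ a → rank a ≡ i
  unrank {i} i<n with Fin.any? (λ a → rank a ℕ.≟ i)
  ... | yes found = found
  ... | no missing = ⊥-elim (ℕ.1+n≰n (Fin.injective⇒≤ {f = avoid} avoid-injective))
    where
    f : Fin n → Fin n
    f a = fromℕ< (rank< a)
    i≢f : ∀ a → fromℕ< i<n ≢ f a
    i≢f a e = missing (a , sym (trans (sym (Fin.toℕ-fromℕ< i<n)) (trans (cong toℕ e) (Fin.toℕ-fromℕ< (rank< a)))))
    avoid : Fin n → Fin n₁
    avoid a = punchOut (i≢f a)
    avoid-injective : ∀ {a b} → avoid a ≡ avoid b → a ≡ b
    avoid-injective {a} {b} e = rank-injective (trans (sym (Fin.toℕ-fromℕ< (rank< a)))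
      (trans (cong toℕ (Fin.punchOut-injective (i≢f a) (i≢f b) e)) (Fin.toℕ-fromℕ< (rank< b))))

  abstract
    -- The enumeration is made total by a default value beyond n, so that digits can be turned into
    -- elements before their bounds are known.
    e : ℕ → Fin n
    e i with i ℕ.<? n
    ... | yes i<n = proj₁ (unrank i<n)
    ... | no _    = zero

    rank-e : ∀ {i} → i < n → rank (e i) ≡ i
    rank-e {i} i<n with i ℕ.<? n
    ... | yes i<n' = proj₂ (unrank i<n')
    ... | no i≮n   = ⊥-elim (i≮n i<n)

  e-rank : ∀ a → e (rank a) ≡ a
  e-rank a = rank-injective (rank-e (rank< a))

  e-mono : ∀ {i j} → i < j → j < n → e i ≺ e j
  e-mono {i} {j} i<j j<n with total (e i) (e j)
  ... | inj₂ (inj₁ l) = l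
  ... | inj₁ same = ⊥-elim (ℕ.<-irrefl (trans (sym (rank-e (ℕ.<-trans i<j j<n)))
    (trans (cong rank same) (rank-e j<n))) i<j)
  ... | inj₂ (inj₂ g) = ⊥-elim (ℕ.<-asym i<j
    (subst₂ _<_ (rank-e j<n) (rank-e (ℕ.<-trans i<j j<n)) (rank-mono g)))

  ≺-rank : ∀ {i a} → i < n → e i ≺ a → i < rank a
  ≺-rank {i} {a} i<n h = subst (_< rank a) (rank-e i<n) (rank-mono h)

  rank-≺ : ∀ {i a} → i < n → a ≺ e i → rank a < i
  rank-≺ {i} {a} i<n h = subst (rank a <_) (rank-e i<n) (rank-mono h)

-- Binary words, halving and clamping

val-∷ʳ : ∀ w b acc → val (w List.++ b ∷ []) acc ≡ (if b then suc (2 * val w acc) else 2 * val w acc)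
val-∷ʳ []          false acc = refl
val-∷ʳ []          true  acc = refl
val-∷ʳ (false ∷ w) b     acc = val-∷ʳ w b (2 * acc)
val-∷ʳ (true ∷ w)  b     acc = val-∷ʳ w b (1 + 2 * acc)

look-∷ʳ : ∀ w b {i c} → look (w List.++ b ∷ []) i ≡ just c → look w i ≡ just c ⊎ (i ≡ length w × c ≡ b)
look-∷ʳ []      b {zero}  refl = inj₂ (refl , refl)
look-∷ʳ (x ∷ w) b {zero}  e = inj₁ e
look-∷ʳ (x ∷ w) b {suc i} e with look-∷ʳ w b {i} e
... | inj₁ e = inj₁ e
... | inj₂ (i≡ , c≡) = inj₂ (cong suc i≡ , c≡)

look-nothing : ∀ w {i} → look w i ≡ nothing → length w ≤ i
look-nothing []      e = z≤n
look-nothing (x ∷ w) {suc i} e = s≤s (look-nothing w e)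

look-≥ : ∀ w {i} → length w ≤ i → look w i ≡ nothing
look-≥ []      h = refl
look-≥ (x ∷ w) {suc i} (s≤s h) = look-≥ w h

half : ∀ v → ∃ λ u → v ≡ 2 * u ⊎ v ≡ suc (2 * u)
half zero = 0 , inj₁ refl
half (suc v) with half v
... | u , inj₁ e = u , inj₂ (cong suc e)
... | u , inj₂ e = suc u , inj₁ (trans (cong suc e) (sym (ℕ.*-suc 2 u)))

abstract
  clamp : ∀ {d} → ℕ → Fin (suc d)
  clamp {d} a with a ℕ.<? suc d
  ... | yes a<d = fromℕ< a<d
  ... | no _ = zero

  toℕ-clamp : ∀ {d a} → a < suc d → toℕ (clamp {d} a) ≡ a
  toℕ-clamp {d} {a} a<d with a ℕ.<? suc d
  ... | yes a<d = Fin.toℕ-fromℕ< a<d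
  ... | no a≮d = ⊥-elim (a≮d a<d)

module Extract (k' : ℕ) (𝒯 : TileSystem) (D₀ n₁ : ℕ)
  (I : Axioms.Interp k' 𝒯 D₀ (suc n₁))
  (holds : ∀ ρ → Axioms.⟦_⟧ k' 𝒯 D₀ I (Axioms.axioms k' 𝒯 D₀) ρ) where

  open TileSystem 𝒯
  open Axioms k' 𝒯 D₀
  open Interp I

  ρ₀ : V → Fin (suc n₁)
  ρ₀ _ = zero

  un-holds : Fix → Fin (suc n₁) → Set
  un-holds f a = Fixᴵ f a a a

  bin-holds : Fix → Fin (suc n₁) → Fin (suc n₁) → Set
  bin-holds f a b = Fixᴵ f a b b

  order : ⟦ I ⟧ order-axioms ρ₀
  order = proj₁ (holds ρ₀)

  pairs : ⟦ I ⟧ pair-axioms ρ₀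
  pairs = proj₁ (proj₂ (holds ρ₀))

  binary : ⟦ I ⟧ binary-axioms ρ₀
  binary = proj₁ (proj₂ (proj₂ (holds ρ₀)))

  tiles : ∀ ρ → ⟦ I ⟧ tile-axioms ρ
  tiles ρ = proj₂ (proj₂ (proj₂ (holds ρ)))

  open Enumerate n₁ (bin-holds less) (λ a b → Fixᴵ? less a b b)
    (proj₁ order) (proj₁ (proj₂ order)) (proj₁ (proj₂ (proj₂ order)))

  stp-e : ∀ {i} → suc i < n → bin-holds (stp std) (e i) (e (suc i))
  stp-e {i} i+1<n = proj₁ (proj₂ (proj₂ (proj₂ (proj₂ (proj₂ (proj₂ order)))))) (e i) (e (suc i))
    (e-mono (ℕ.n<1+n i) i+1<n)
    λ a l g → ℕ.<-irrefl refl (ℕ.<-≤-trans (rank-≺ i+1<n g) (≺-rank (ℕ.<-trans (ℕ.n<1+n i) i+1<n) l))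

  zer-e : un-holds (zer std) (e 0)
  zer-e = proj₁ (proj₂ (proj₂ (proj₂ order))) (e 0) λ a l → ℕ.n≮0 (rank-≺ (s≤s z≤n) l)

  zer-exact : ∀ {i} → i < n → un-holds (zer std) (e i) → i ≡ 0
  zer-exact {zero}  i<n z = refl
  zer-exact {suc i} i<n z = ⊥-elim (proj₁ (proj₂ (proj₂ (proj₂ (proj₂ order)))) (e (suc i)) (e 0) z (e-mono (s≤s z≤n) i<n))

  top-e : un-holds (top std) (e n₁)
  top-e = proj₁ (proj₂ (proj₂ (proj₂ (proj₂ (proj₂ order))))) (e n₁)
    λ a l → ℕ.<⇒≱ (≺-rank (ℕ.n<1+n n₁) l) (ℕ.≤-pred (rank< a))

  wrp-e : bin-holds (wrp std) (e n₁) (e 0)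
  wrp-e = proj₂ (proj₂ (proj₂ (proj₂ (proj₂ (proj₂ (proj₂ order)))))) (e n₁) (e 0) top-e zer-e

  -- The base s is read off from the model: it is one more than the rank of an element satisfying
  -- `root`. A code for each pair of numbers below s is then supplied by `pair-axioms`.
  s₁ s : ℕ
  s₁ = rank (proj₁ (proj₁ pairs))
  s = suc s₁

  s≤n : s ≤ n
  s≤n = rank< (proj₁ (proj₁ pairs))

  root-e : un-holds root (e s₁)
  root-e = subst (un-holds root) (sym (e-rank _)) (proj₂ (proj₁ pairs))

  pair-exists : ∀ {h g} → h < s → g < s → ∃ λ z → Fixᴵ pair (e h) (e g) z
  pair-exists {h} {g} h<s g<s = proj₁ (proj₂ pairs) (e h) (e g) (e s₁) root-e (bound h<s) (bound g<s)
    where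
    bound : ∀ {i} → i < s → ¬ bin-holds less (e s₁) (e i)
    bound {i} i<s l = ℕ.<⇒≱ (subst (s₁ <_) (rank-e (ℕ.<-≤-trans i<s s≤n)) (≺-rank s≤n l)) (ℕ.≤-pred i<s)

  abstract
    -- A model may offer several codes for a pair; one is selected. The axioms on `hi` and `lo`
    -- speak of all codes and hence of the selected ones.
    code : ℕ → ℕ → Fin n
    code h g with h ℕ.<? s | g ℕ.<? s
    ... | yes h<s | yes g<s = proj₁ (pair-exists h<s g<s)
    ... | _       | _       = zero

    code-pair : ∀ {h g} → h < s → g < s → Fixᴵ pair (e h) (e g) (code h g)
    code-pair {h} {g} h<s g<s with h ℕ.<? s | g ℕ.<? s
    ... | yes h<s' | yes g<s' = proj₂ (pair-exists h<s' g<s')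
    ... | no h≮s   | _        = ⊥-elim (h≮s h<s)
    ... | yes _    | no g≮s   = ⊥-elim (g≮s g<s)

  hi-axiom = proj₁ (proj₂ (proj₂ pairs))
  lo-axiom = proj₁ (proj₂ (proj₂ (proj₂ pairs)))
  end-axiom = proj₂ (proj₂ (proj₂ (proj₂ pairs)))

  open MixedRadix {Coord k} _≟ᶜ_ (base n s)
  open Segment n s D (suc k') (s≤s z≤n) (s≤s z≤n)

  Valid : Digits → Set
  Valid δ = ∀ c → δ c < base n s c

  env : Digits → V → Fin n
  env δ aux    = zero
  env δ mix    = code (δ hc) (δ gc)
  env δ (tv i) = e (δ (tc i))
  env δ (pv i) = e (δ (pc i))

  env-cong : ∀ {δ δ'} → (∀ c → δ c ≡ δ' c) → ∀ x → env δ x ≡ env δ' x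
  env-cong h aux    = refl
  env-cong h mix    = cong₂ code (h hc) (h gc)
  env-cong h (tv i) = cong e (h (tc i))
  env-cong h (pv i) = cong e (h (pc i))

  env-↦ : ∀ δ c r x → x ≢ cvar c → env (δ [ c ↦ r ]) x ≡ env δ x
  env-↦ δ c r aux ≢ = refl
  env-↦ δ (tc _) r mix ≢ = refl
  env-↦ δ (pc _) r mix ≢ = refl
  env-↦ δ hc r mix ≢ = ⊥-elim (≢ refl)
  env-↦ δ gc r mix ≢ = ⊥-elim (≢ refl)
  env-↦ δ c r (tv i) ≢ = cong e (↦-other δ c r {tc i} λ { refl → ≢ refl })
  env-↦ δ c r (pv i) ≢ = cong e (↦-other δ c r {pc i} λ { refl → ≢ refl })

  step-digit : ∀ {δ} c → Valid δ → suc (δ c) < base n s c →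
    bin-holds (stp (kind c)) (env δ (cvar c)) (env (δ [ c ↦ suc (δ c) ]) (cvar c))
  step-digit {δ} (tc i) ok h rewrite ↦-same δ (tc i) (suc (δ (tc i))) = stp-e h
  step-digit {δ} (pc i) ok h rewrite ↦-same δ (pc i) (suc (δ (pc i))) = stp-e h
  step-digit {δ} hc ok h = proj₁ (hi-axiom _ _ _ _ _ (code-pair (ok hc) (ok gc)) (code-pair h (ok gc)))
    (stp-e (ℕ.<-≤-trans h s≤n))
  step-digit {δ} gc ok h = proj₁ (lo-axiom _ _ _ _ _ (code-pair (ok hc) (ok gc)) (code-pair (ok hc) h))
    (stp-e (ℕ.<-≤-trans h s≤n))

  wrap-digit : ∀ {δ} c → Valid δ → suc (δ c) ≡ base n s c →
    bin-holds (wrp (kind c)) (env δ (cvar c)) (env (δ [ c ↦ 0 ]) (cvar c))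
  wrap-digit {δ} (tc i) ok h rewrite ↦-same δ (tc i) 0 | ℕ.suc-injective h = wrp-e
  wrap-digit {δ} (pc i) ok h rewrite ↦-same δ (pc i) 0 | ℕ.suc-injective h = wrp-e
  wrap-digit {δ} hc ok h = proj₂ (hi-axiom _ _ _ _ _ (code-pair (ok hc) (ok gc)) (code-pair (s≤s z≤n) (ok gc)))
    (subst (λ i → un-holds root (e i)) (sym (ℕ.suc-injective h)) root-e) zer-e
  wrap-digit {δ} gc ok h = proj₂ (lo-axiom _ _ _ _ _ (code-pair (ok hc) (ok gc)) (code-pair (ok hc) (s≤s z≤n)))
    (subst (λ i → un-holds root (e i)) (sym (ℕ.suc-injective h)) root-e) zer-e

  zero-digit : ∀ {δ} c → Valid δ → δ c ≡ 0 → un-holds (zer (kind c)) (env δ (cvar c))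
  zero-digit (tc i) ok h rewrite h = zer-e
  zero-digit (pc i) ok h rewrite h = zer-e
  zero-digit hc ok h = proj₁ (end-axiom _ _ _ (code-pair (ok hc) (ok gc)))
    (subst (λ i → un-holds (zer std) (e i)) (sym h) zer-e)
  zero-digit gc ok h = proj₁ (proj₂ (proj₂ (end-axiom _ _ _ (code-pair (ok hc) (ok gc)))))
    (subst (λ i → un-holds (zer std) (e i)) (sym h) zer-e)

  top-digit : ∀ {δ} c → Valid δ → suc (δ c) ≡ base n s c → un-holds (top (kind c)) (env δ (cvar c))
  top-digit (tc i) ok h rewrite ℕ.suc-injective h = top-e
  top-digit (pc i) ok h rewrite ℕ.suc-injective h = top-e
  top-digit hc ok h = proj₁ (proj₂ (end-axiom _ _ _ (code-pair (ok hc) (ok gc))))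
    (subst (λ i → un-holds root (e i)) (sym (ℕ.suc-injective h)) root-e)
  top-digit gc ok h = proj₁ (proj₂ (proj₂ (proj₂ (end-axiom _ _ _ (code-pair (ok hc) (ok gc))))))
    (subst (λ i → un-holds root (e i)) (sym (ℕ.suc-injective h)) root-e)

  -- The failure of `input-segment` has to be recognised as well, since it is what makes the cells
  -- away from the word blank.
  zero-exact : ∀ {δ c} → c ∈ tail (suc k') → Valid δ → un-holds (zer (kind c)) (env δ (cvar c)) → δ c ≡ 0
  zero-exact {δ} m ok z with ∈-tail⁻ (suc k') m
  ... | inj₁ (i , refl) = zer-exact (ok (pc (suc i))) z
  ... | inj₂ refl = zer-exact (ℕ.<-≤-trans (ok gc) s≤n)
    (proj₂ (proj₂ (proj₂ (proj₂ (end-axiom _ _ _ (code-pair (ok hc) (ok gc)))))) z)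

  infix 4 _∼_

  _∼_ : (V → Fin n) → (V → Fin n) → Set
  ρ ∼ ρ' = ∀ x → x ≢ aux → ρ x ≡ ρ' x

  set-∼ : ∀ {ρ δ} c r → ρ ∼ env δ →
    upd (upd ρ aux (env (δ [ c ↦ r ]) (cvar c))) (cvar c) (env (δ [ c ↦ r ]) (cvar c)) ∼ env (δ [ c ↦ r ])
  set-∼ {ρ} {δ} c r h x x≢aux with x ≟ᵛ cvar c
  ... | yes refl = refl
  ... | no x≢c = trans (upd-other ρ aux _ x x≢aux) (trans (h x x≢aux) (sym (env-↦ δ c r x x≢c)))

  -- Counterpart of `next-num` in an arbitrary model. Whether the lowest digit can still grow
  -- decides which disjunct to take; the target `δ'` stays fixed while δ is changed towards it digit
  -- by digit. The last hypothesis concerns all assignments that agree with `env δ'` off `aux`,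
  -- because each assignment to a digit overwrites `aux`.
  next-intro : ∀ {cs} → Unique cs → ∀ carry φ {ρ δ δ' a a'} → Valid δ → Valid δ' → ρ ∼ env δ →
    (∀ {d} → d ∉ cs → δ' d ≡ δ d) → num cs δ' a' ≡ suc (num cs δ a) →
    (∀ ρ' → ρ' ∼ env δ' → (a' ≡ a → ⟦ I ⟧ φ ρ') × (a' ≡ suc a → ⟦ I ⟧ carry ρ')) →
    ⟦ I ⟧ (Next cs carry φ) ρ
  next-intro [] carry φ {ρ} {δ} {δ'} ok ok' ρ∼ same e h =
    proj₂ (h ρ λ x x≢ → trans (ρ∼ x x≢) (env-cong (λ d → sym (same λ ())) x)) e
  next-intro {c ∷ cs} (c∉ ∷ uniq) carry φ {ρ} {δ} {δ'} {a} {a'} ok ok' ρ∼ same eq h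
    with ℕ.m≤n⇒m<n∨m≡n (ok c)
  ... | inj₁ step< =
    inj₁ (assign-intro I (stp (kind c)) c φ ρ (env δ⁺ (cvar c))
      (subst (λ u → bin-holds (stp (kind c)) u (env δ⁺ (cvar c))) (sym (ρ∼ (cvar c) (cvar≢aux c))) (step-digit c ok step<))
      (proj₁ (h _ λ x x≢ → trans (set-∼ c (suc (δ c)) ρ∼ x x≢) (env-cong agree x)) (proj₂ rest)))
    where
    δ⁺ : Digits
    δ⁺ = δ [ c ↦ suc (δ c) ]
    heads : δ' c ≡ suc (δ c) × num cs δ' a' ≡ num cs δ a
    heads = +*-unique (base n s c) (ok' c) step< eq
    rest : (∀ {d} → d ∈ cs → δ' d ≡ δ d) × a' ≡ a
    rest = num-injective cs (λ {d} _ → ok' d) (λ {d} _ → ok d) (proj₂ heads)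
    agree : ∀ d → δ⁺ d ≡ δ' d
    agree d with d ≟ᶜ c
    ... | yes refl = sym (proj₁ heads)
    ... | no d≢c with DecMembership._∈?_ _≟ᶜ_ d cs
    ...   | yes d∈ = sym (proj₁ rest d∈)
    ...   | no d∉ = sym (same λ { (here d≡c) → d≢c d≡c ; (there d∈) → d∉ d∈ })
  ... | inj₂ top≡ =
    inj₂ (assign-intro I (wrp (kind c)) c (Next cs carry φ) ρ (env δ⁰ (cvar c))
      (subst (λ u → bin-holds (wrp (kind c)) u (env δ⁰ (cvar c))) (sym (ρ∼ (cvar c) (cvar≢aux c))) (wrap-digit c ok top≡))
      (next-intro uniq carry φ {δ = δ⁰} (↦-range c ok (0<base c)) ok' (set-∼ c 0 ρ∼) same'
        (trans (proj₂ heads) (cong suc (num-cong cs λ {d} d∈ → sym (↦-other δ c 0 λ { refl → All.lookup c∉ d∈ refl })))) h))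
    where
    open ≡-Reasoning
    δ⁰ : Digits
    δ⁰ = δ [ c ↦ 0 ]
    heads : δ' c ≡ 0 × num cs δ' a' ≡ suc (num cs δ a)
    heads = +*-unique (base n s c) (ok' c) (0<base c) (begin
      δ' c + base n s c * num cs δ' a'      ≡⟨ eq ⟩
      suc (δ c) + base n s c * num cs δ a   ≡⟨ cong (_+ base n s c * num cs δ a) top≡ ⟩
      base n s c + base n s c * num cs δ a  ≡⟨ ℕ.*-suc (base n s c) _ ⟨
      base n s c * suc (num cs δ a)         ∎)
    same' : ∀ {d} → d ∉ cs → δ' d ≡ δ⁰ d
    same' {d} d∉ with d ≟ᶜ c
    ... | yes refl = proj₁ heads
    ... | no d≢c = same λ { (here d≡c) → d≢c d≡c ; (there d∈) → d∉ d∈ }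

  child₀-axiom = proj₁ (proj₂ binary)
  child₁-axiom = proj₁ (proj₂ (proj₂ binary))
  path-axiom   = proj₁ (proj₂ (proj₂ (proj₂ binary)))
  root-axiom   = proj₁ (proj₂ (proj₂ (proj₂ (proj₂ binary))))
  end-of-word  = proj₂ (proj₂ (proj₂ (proj₂ (proj₂ binary))))

  child₀-e : ∀ {u} → suc (2 * u) < n → bin-holds child₀ (e u) (e (suc (2 * u)))
  child₀-e {zero}  h = proj₁ binary (e 0) (e 1) zer-e (stp-e h)
  child₀-e {suc u} h = subst (λ v → bin-holds child₀ (e (suc u)) (e (suc v))) (sym (ℕ.*-suc 2 u))
    (child₀-axiom (e u) (e (suc (2 * u))) (e (suc u)) (e (suc (suc (2 * u)))) (e (suc (suc (suc (2 * u)))))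
      (child₀-e {u} 2u+1<) (stp-e u+1<) (stp-e 2u+2<) (stp-e h'))
    where
    h' : suc (suc (suc (2 * u))) < n
    h' = subst (λ v → suc v < n) (ℕ.*-suc 2 u) h
    2u+2< : suc (suc (2 * u)) < n
    2u+2< = ℕ.<-trans (ℕ.n<1+n _) h'
    2u+1< : suc (2 * u) < n
    2u+1< = ℕ.<-trans (ℕ.n<1+n _) 2u+2<
    u+1< : suc u < n
    u+1< = ℕ.≤-<-trans (s≤s (ℕ.m≤m+n u (u + 0))) 2u+1<

  child₁-e : ∀ {u} → suc (suc (2 * u)) < n → bin-holds child₁ (e u) (e (suc (suc (2 * u))))
  child₁-e {u} h = child₁-axiom (e u) (e (suc (2 * u))) (e (suc (suc (2 * u))))
    (child₀-e {u} (ℕ.<-trans (ℕ.n<1+n _) h)) (stp-e h)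

  bit : Bool → Fix
  bit false = bit₀
  bit true  = bit₁

  -- A word with last position i for the number v + 1. That its letters are marked in the model is
  -- the direction in which `input-axioms` uses the marks; `no-bits` covers the positions after its
  -- end.
  record Word (i v : ℕ) : Set where
    field
      rest   : List Bool
      length≡ : length (true ∷ rest) ≡ suc i
      value  : val (true ∷ rest) 0 ≡ suc v
      bits   : ∀ {j b} → look (true ∷ rest) j ≡ just b → un-holds (bit b) (e j)

  extend : ∀ {i u} b → Word i u → un-holds (bit b) (e (suc i)) →
    Word (suc i) (if b then suc (suc (2 * u)) else suc (2 * u))
  extend {i} {u} b W h = record
    { rest = rest List.++ b ∷ []
    ; length≡ = cong suc (trans (List.length-++ rest) (trans (ℕ.+-comm (length rest) 1) length≡))
    ; value = trans (val-∷ʳ (true ∷ rest) b 0) (double b)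
    ; bits = λ {j} {c} eq → bits' j c (look-∷ʳ (true ∷ rest) b {j} eq) }
    where
    open Word W
    double : ∀ b → (if b then suc (2 * val (true ∷ rest) 0) else 2 * val (true ∷ rest) 0)
      ≡ suc (if b then suc (suc (2 * u)) else suc (2 * u))
    double false = trans (cong (2 *_) value) (ℕ.*-suc 2 u)
    double true  = cong suc (double false)
    bits' : ∀ j c → look (true ∷ rest) j ≡ just c ⊎ (j ≡ length (true ∷ rest) × c ≡ b) → un-holds (bit c) (e j)
    bits' j c (inj₁ eq) = bits {j} {c} eq
    bits' j c (inj₂ (j≡ , refl)) = subst (λ j → un-holds (bit b) (e j)) (sym (trans j≡ length≡)) h

  -- The element v + 1 is 2u + 1 or 2u + 2, a child of u, and the kind of child is the last bit. The
  -- recursion removes one position at a time. Position 0 forces the number 1, and the number 1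
  -- cannot occur at a later position.
  descend : ∀ i v → i < n → v < n → bin-holds path (e i) (e v) → Word i v
  descend zero v i<n v<n p with proj₁ (root-axiom (e 0) (e v) p) zer-e
  ... | z , b = record
    { rest = []
    ; length≡ = refl
    ; value = cong suc (sym (zer-exact v<n z))
    ; bits = λ { {zero} refl → b } }
  descend (suc i) zero i<n v<n p with zer-exact i<n (proj₂ (root-axiom (e (suc i)) (e 0) p) zer-e)
  ... | ()
  descend (suc i) (suc v) i<n v<n p = split (half v)
    where
    i<n' : i < n
    i<n' = ℕ.<-trans (ℕ.n<1+n i) i<n
    below : ∀ {u} → u ≤ v → u < n
    below u≤v = ℕ.≤-<-trans u≤v (ℕ.<-trans (ℕ.n<1+n v) v<n)
    split : ∃ (λ u → v ≡ 2 * u ⊎ v ≡ suc (2 * u)) → Word (suc i) (suc v)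
    split (u , inj₁ refl) with proj₁ (path-axiom (e (suc i)) (e (suc v)) (e i) (e u) p (stp-e i<n)) (child₀-e {u} v<n)
    ... | b , p' = extend false (descend i u i<n' (below (ℕ.m≤m+n u _)) p') b
    split (u , inj₂ refl) with proj₂ (path-axiom (e (suc i)) (e (suc v)) (e i) (e u) p (stp-e i<n)) (child₁-e {u} v<n)
    ... | b , p' = extend true (descend i u i<n' (below (ℕ.m≤n⇒m≤1+n (ℕ.m≤m+n u _))) p') b

  ℓ : ℕ
  ℓ = rank (proj₁ end-of-word)

  word : Word ℓ n₁
  word = descend ℓ n₁ (rank< _) (ℕ.n<1+n n₁)
    (subst (λ a → bin-holds path a (e n₁)) (sym (e-rank _)) (proj₁ (proj₂ end-of-word) (e n₁) top-e))

  w : List Bool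
  w = true ∷ Word.rest word

  no-bits : ∀ {j} → j < n → look w j ≡ nothing → ¬ un-holds bit₀ (e j) × ¬ un-holds bit₁ (e j)
  no-bits {j} j<n l = proj₂ (proj₂ end-of-word) (e j)
    (subst (λ a → bin-holds less a (e j)) (e-rank _)
      (e-mono (subst (_≤ j) (Word.length≡ word) (look-nothing w l)) j<n))

  look-≥n : ∀ {j} → n ≤ j → look w j ≡ nothing
  look-≥n n≤j = look-≥ w (ℕ.≤-trans (subst (_≤ n) (sym (Word.length≡ word)) (rank< _)) n≤j)

  -- The points of the diagram and their tiles

  record Point (t p : ℕ) : Set where
    field
      δ     : Digits
      a b   : ℕ
      valid : Valid δ
      time≡ : num tds δ a ≡ t
      cell≡ : num pds δ b ≡ p

  base-nonzero : (c : Coord k) → NonZero (base n s c)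
  base-nonzero c = ℕ.>-nonZero (0<base c)

  abstract
    point : ∀ t p → Point t p
    point t p with digits base-nonzero (time-unique (suc k')) (λ _ → 0) 0<base t
    ... | δ₁ , a , ok₁ , t≡ , _ with digits base-nonzero (space-unique (suc k')) δ₁ ok₁ p
    ...   | δ₂ , b , ok₂ , p≡ , same = record
      { δ = δ₂ ; a = a ; b = b ; valid = ok₂ ; cell≡ = p≡
      ; time≡ = trans (num-cong tds λ m → same (time-space-disjoint (suc k') m)) t≡ }

  O : ℕ
  O = weight pds * D

  weights : weight tds ≡ weight pds
  weights = trans (weight-time n s {suc k'}) (sym (weight-space n s {suc k'}))

  module At (t p : ℕ) where
    open Point (point t p) public

    ρ : V → Fin n
    ρ = env δ

    -- Inside the tiling the clamping changes nothing, by `a≡` and `b≡`; outside it only some tile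
    -- is wanted.
    aᶠ : Fin D
    aᶠ = clamp a

    bᶠ : Fin E
    bᶠ = clamp b

    x : Tile
    x = proj₁ (proj₁ (tiles ρ aᶠ bᶠ))

    x-holds : Tilᴵ (x , aᶠ , bᶠ) ρ
    x-holds = proj₂ (proj₁ (tiles ρ aᶠ bᶠ))

    constraints = proj₂ (tiles ρ aᶠ bᶠ) x x-holds

    a≡ : t < O → toℕ aᶠ ≡ a
    a≡ t<O = toℕ-clamp (num<⇒< tds δ (subst₂ _<_ (sym time≡) (cong (_* D) (sym weights)) t<O))

    b≡ : p < O + O → toℕ bᶠ ≡ b
    b≡ p<2O = toℕ-clamp (num<⇒< pds δ (subst₂ _<_ (sym cell≡) (sym (ℕ.*-distribˡ-+ (weight pds) D D)) p<2O))

  tile-at : ℕ → ℕ → Tile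
  tile-at t p = At.x t p

  -- Coordinates are chosen separately for each point. Uniqueness of numerals makes those of one row
  -- agree in their row part; `same-cell` does this for columns.
  same-time : ∀ t p p' → (∀ {c} → c ∈ tds → Point.δ (point t p) c ≡ Point.δ (point t p') c)
    × Point.a (point t p) ≡ Point.a (point t p')
  same-time t p p' = num-injective tds (λ {c} _ → Point.valid (point t p) c) (λ {c} _ → Point.valid (point t p') c)
    (trans (Point.time≡ (point t p)) (sym (Point.time≡ (point t p'))))

  same-cell : ∀ t t' p → (∀ {c} → c ∈ pds → Point.δ (point t p) c ≡ Point.δ (point t' p) c)
    × Point.b (point t p) ≡ Point.b (point t' p)
  same-cell t t' p = num-injective pds (λ {c} _ → Point.valid (point t p) c) (λ {c} _ → Point.valid (point t' p) c)
    (trans (Point.cell≡ (point t p)) (sym (Point.cell≡ (point t' p))))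

  vertical : ∀ {t p} → suc t < O → p < O + O → Vert (tile-at t p) (tile-at (suc t) p)
  vertical {t} {p} t+1< p< = proj₁ (proj₂ X.constraints) Y.x
    (next-intro (time-unique (suc k')) _ _ X.valid Y.valid (λ _ _ → refl) same
      (trans Y.time≡ (cong suc (sym X.time≡)))
      λ ρ' ρ'∼ → (λ a'≡a → holds-at ρ'∼ (cong clamp a'≡a) refl)
               , (λ a'≡ → Y.aᶠ , trans (Y.a≡ t+1<) (trans a'≡ (cong suc (sym (X.a≡ t<)))) , holds-at ρ'∼ refl refl))
    where
    module X = At t p
    module Y = At (suc t) p
    t< : t < O
    t< = ℕ.<-trans (ℕ.n<1+n t) t+1<
    same : ∀ {c} → c ∉ tds → Y.δ c ≡ X.δ c
    same {c} c∉ with coord-cases (suc k') c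
    ... | inj₁ c∈ = ⊥-elim (c∉ c∈)
    ... | inj₂ c∈ = proj₁ (same-cell (suc t) t p) c∈
    holds-at : ∀ {ρ' a} → ρ' ∼ env Y.δ → Y.aᶠ ≡ a → X.b ≡ X.b → Tilᴵ (Y.x , a , X.bᶠ) ρ'
    holds-at {ρ'} ρ'∼ refl _ = Tilᴵ-cong _ (λ x x≢ → sym (ρ'∼ x x≢))
      (subst (λ b → Tilᴵ (Y.x , Y.aᶠ , clamp b) (env Y.δ)) (proj₂ (same-cell (suc t) t p)) Y.x-holds)

  horizontal : ∀ {t p} → t < O → suc p < O + O → Horiz (tile-at t p) (tile-at t (suc p))
  horizontal {t} {p} t< p+1< = proj₁ (proj₂ (proj₂ X.constraints)) Y.x
    (next-intro (space-unique (suc k')) _ _ X.valid Y.valid (λ _ _ → refl) same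
      (trans Y.cell≡ (cong suc (sym X.cell≡)))
      λ ρ' ρ'∼ → (λ b'≡b → holds-at ρ'∼ (cong clamp b'≡b))
               , (λ b'≡ → Y.bᶠ , trans (Y.b≡ p+1<) (trans b'≡ (cong suc (sym (X.b≡ p<)))) , holds-at ρ'∼ refl))
    where
    module X = At t p
    module Y = At t (suc p)
    p< : p < O + O
    p< = ℕ.<-trans (ℕ.n<1+n p) p+1<
    same : ∀ {c} → c ∉ pds → Y.δ c ≡ X.δ c
    same {c} c∉ with coord-cases (suc k') c
    ... | inj₁ c∈ = proj₁ (same-time t (suc p) p) c∈
    ... | inj₂ c∈ = ⊥-elim (c∉ c∈)
    holds-at : ∀ {ρ' b} → ρ' ∼ env Y.δ → Y.bᶠ ≡ b → Tilᴵ (Y.x , X.aᶠ , b) ρ'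
    holds-at {ρ'} ρ'∼ refl = Tilᴵ-cong _ (λ x x≢ → sym (ρ'∼ x x≢))
      (subst (λ a → Tilᴵ (Y.x , clamp a , Y.bᶠ) (env Y.δ)) (proj₂ (same-time t (suc p) p)) Y.x-holds)

  zero-digits : ∀ cs {δ a} → Valid δ → num cs δ a ≡ 0 → (∀ {c} → c ∈ cs → δ c ≡ 0) × a ≡ 0
  zero-digits cs {δ} ok e = num-injective cs {δ} {λ _ → 0} (λ {c} _ → ok c) (λ {c} _ → 0<base c)
    (trans e (sym (trans (num-zeros cs 0 λ _ → refl) (ℕ.*-zeroʳ (weight cs)))))

  top-digits : ∀ cs {δ a d} → Valid δ → suc (num cs δ a) ≡ weight cs * suc d →
    (∀ {c} → c ∈ cs → suc (δ c) ≡ base n s c) × a ≡ d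
  top-digits cs {δ} {a} {d} ok e with num-injective cs {δ} {tops'} {a} {d} (λ {c} _ → ok c) (λ {c} _ → tops'<base c)
    (ℕ.suc-injective (trans e (sym (num-tops cs d λ {c} _ → suc-tops' c))))
    where
    tops' : Digits
    tops' c = ℕ.pred (base n s c)
    suc-tops' : ∀ c → suc (tops' c) ≡ base n s c
    suc-tops' c = ℕ.suc-pred (base n s c) {{base-nonzero c}}
    tops'<base : ∀ c → tops' c < base n s c
    tops'<base c = ℕ.≤-reflexive (suc-tops' c)
  ... | cs≡ , a≡ = (λ {c} m → trans (cong suc (cs≡ m)) (ℕ.suc-pred (base n s c) {{base-nonzero c}})) , a≡

  zeros-hold : ∀ cs {δ} → Valid δ → (∀ {c} → c ∈ cs → δ c ≡ 0) → ⟦ I ⟧ (Each zeros cs) (env δ)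
  zeros-hold cs {δ} ok h = each-intro I zeros cs (env δ) λ {c} m → zero-digit c ok (h m)

  tops-hold : ∀ cs {δ} → Valid δ → (∀ {c} → c ∈ cs → suc (δ c) ≡ base n s c) → ⟦ I ⟧ (Each tops cs) (env δ)
  tops-hold cs {δ} ok h = each-intro I tops cs (env δ) λ {c} m → top-digit c ok (h m)

  first-column : ∀ {t} → t < O → First (tile-at t 0)
  first-column {t} t< with zero-digits pds (Point.valid (point t 0)) (Point.cell≡ (point t 0))
  ... | zs , b≡0 = proj₁ (proj₂ (proj₂ (proj₂ (At.constraints t 0))))
    (trans (At.b≡ t 0 (ℕ.≤-<-trans z≤n (ℕ.<-≤-trans t< (ℕ.m≤m+n O O)))) b≡0)
    (zeros-hold pds (At.valid t 0) zs)

  last-column : ∀ {t p} → t < O → suc p ≡ O + O → Last (tile-at t p)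
  last-column {t} {p} t< e with top-digits pds {d = D₀ + D} (Point.valid (point t p))
    (trans (cong suc (Point.cell≡ (point t p))) (trans e (sym (ℕ.*-distribˡ-+ (weight pds) D D))))
  ... | ts , b≡ = proj₁ (proj₂ (proj₂ (proj₂ (proj₂ (At.constraints t p)))))
    (cong suc (trans (At.b≡ t p (ℕ.≤-reflexive e)) b≡)) (tops-hold pds (At.valid t p) ts)

  last-row : ∀ {t p} → suc t ≡ O → p < O + O → Halt (tile-at t p)
  last-row {t} {p} e p< with top-digits tds {d = D₀} (Point.valid (point t p))
    (trans (cong suc (Point.time≡ (point t p))) (trans e (cong (_* D) (sym weights))))
  ... | ts , a≡ = proj₂ (proj₂ (proj₂ (proj₂ (proj₂ (proj₂ (At.constraints t p))))))
    (cong suc (trans (At.a≡ t p (ℕ.≤-reflexive e)) a≡)) (tops-hold tds (At.valid t p) ts)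

  0<O : 0 < O
  0<O = ℕ.≤-<-trans z≤n (num<weight* pds {λ _ → 0} (λ {c} _ → 0<base c) {0} {D} (s≤s z≤n))

  first-row : ∀ p → ⟦ I ⟧ (input-axioms (tile-at 0 p) (At.bᶠ 0 p)) (env (At.δ 0 p))
  first-row p with zero-digits tds (Point.valid (point 0 p)) (Point.time≡ (point 0 p))
  ... | zs , a≡0 = proj₁ (proj₂ (proj₂ (proj₂ (proj₂ (proj₂ (At.constraints 0 p))))))
    (trans (At.a≡ 0 p 0<O) a≡0) (zeros-hold tds (At.valid 0 p) zs)

  inside : ∀ {p i} → p ≡ O + i → p < O + O → i < n →
    ⟦ I ⟧ (input-segment (At.bᶠ 0 p)) (env (At.δ 0 p)) × At.δ 0 p (pc 0F) ≡ i
  inside {p} {i} p≡ p< i<n with num-segment (λ {c} _ → At.valid 0 p c) (trans (At.cell≡ 0 p) p≡) i<n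
  ... | i≡ , b≡D , zs = (trans (At.b≡ 0 p p<) b≡D , zeros-hold (tail (suc k')) (At.valid 0 p) zs) , i≡

  inside⁻ : ∀ {p} → p < O + O → ⟦ I ⟧ (input-segment (At.bᶠ 0 p)) (env (At.δ 0 p)) → Σ ℕ λ i → p ≡ O + i × i < n
  inside⁻ {p} p< (b≡D , zs) = At.δ 0 p (pc 0F) , trans (sym (At.cell≡ 0 p))
      (segment-num (trans (sym (At.b≡ 0 p p<)) b≡D)
        λ m → zero-exact m (At.valid 0 p) (each-elim I zeros (tail (suc k')) (env (At.δ 0 p)) zs m))
    , At.valid 0 p (pc 0F)

  outside : ∀ {p} → p < O + O → (∀ i → i < n → p ≢ O + i) → Head false (tile-at 0 p) × Sym nothing (tile-at 0 p)
  outside {p} p< away = proj₂ (proj₂ (first-row p)) λ seg → case inside⁻ p< seg of λ (i , p≡ , i<n) → away i i<n p≡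

  head-row : ∀ {p} → p < O + O → Head (p ≡ᵇ O) (tile-at 0 p)
  head-row {p} p< with ℕ.<-≤-connex p O
  ... | inj₁ p<O = subst (λ h → Head h (tile-at 0 p)) (sym (<⇒≡ᵇ-falseˡ p<O))
    (proj₁ (outside p< λ i _ p≡ → ℕ.<⇒≱ p<O (subst (O ≤_) (sym p≡) (ℕ.m≤m+n O i))))
  ... | inj₂ O≤p with ℕ.m≤n⇒∃[o]m+o≡n O≤p
  ...   | zero , O+i≡p with inside (sym O+i≡p) p< (s≤s z≤n)
  ...     | seg , i≡ = subst (λ h → Head h (tile-at 0 p))
    (sym (trans (cong (_≡ᵇ O) (trans (sym O+i≡p) (ℕ.+-identityʳ O))) (≡ᵇ-refl O)))
    (proj₁ (proj₁ (proj₂ (first-row p)) seg) (subst (λ i → un-holds (zer std) (e i)) (sym i≡) zer-e))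
  head-row {p} p< | inj₂ O≤p | suc i , O+i≡p = subst (λ h → Head h (tile-at 0 p))
    (sym (<⇒≡ᵇ-false (subst (O <_) O+i≡p (ℕ.m<m+n O (s≤s z≤n))))) (no-head (ℕ.<-≤-connex (suc i) n))
    where
    no-head : suc i < n ⊎ n ≤ suc i → Head false (tile-at 0 p)
    no-head (inj₂ n≤i) = proj₁ (outside p< λ j j<n p≡ →
      ℕ.<⇒≱ (subst (_< n) (ℕ.+-cancelˡ-≡ O j (suc i) (trans (sym p≡) (sym O+i≡p))) j<n) n≤i)
    no-head (inj₁ i<n) with inside (sym O+i≡p) p< i<n
    ... | seg , i≡ = proj₁ (proj₂ (proj₁ (proj₂ (first-row p)) seg)) λ z →
      case zer-exact i<n (subst (λ i → un-holds (zer std) (e i)) i≡ z) of λ ()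

  input-row : ∀ {i} → O + i < O + O → Sym (look w i) (tile-at 0 (O + i))
  input-row {i} p< with ℕ.<-≤-connex i n
  ... | inj₂ n≤i = subst (λ m → Sym m (tile-at 0 (O + i))) (sym (look-≥n n≤i))
    (proj₂ (outside p< λ j j<n p≡ → ℕ.<⇒≱ (subst (_< n) (ℕ.+-cancelˡ-≡ O j i (sym p≡)) j<n) n≤i))
  ... | inj₁ i<n with inside refl p< i<n
  ...   | seg , i≡ = symbol (look w i) refl
    where
    letters = proj₁ (proj₂ (first-row (O + i))) seg
    at-i : ∀ {f} → un-holds f (e i) → un-holds f (e (At.δ 0 (O + i) (pc 0F)))
    at-i {f} = subst (λ i → un-holds f (e i)) (sym i≡)
    at-i⁻ : ∀ {f} → un-holds f (e (At.δ 0 (O + i) (pc 0F))) → un-holds f (e i)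
    at-i⁻ {f} = subst (λ i → un-holds f (e i)) i≡
    symbol : ∀ m → look w i ≡ m → Sym m (tile-at 0 (O + i))
    symbol (just false) l = proj₁ (proj₂ (proj₂ letters)) (at-i {bit₀} (Word.bits word {i} l))
    symbol (just true)  l = proj₁ (proj₂ (proj₂ (proj₂ letters))) (at-i {bit₁} (Word.bits word {i} l))
    symbol nothing      l = proj₂ (proj₂ (proj₂ (proj₂ letters)))
      (λ h → proj₁ (no-bits i<n l) (at-i⁻ {bit₀} h)) (λ h → proj₂ (no-bits i<n l) (at-i⁻ {bit₁} h))

  extracted : Tiling 𝒯 (_< O) O w
  extracted = record
    { τ = tile-at
    ; good = λ {t} {p} _ _ → proj₁ (At.constraints t p)
    ; vert = vertical
    ; horiz = horizontal
    ; first = first-column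
    ; last = last-column
    ; started = λ {p} _ → proj₁ (first-row p)
    ; head = head-row
    ; input = input-row
    ; left = λ {p} p<O → proj₂ (outside (ℕ.<-≤-trans p<O (ℕ.m≤m+n O O))
        λ i _ p≡ → ℕ.<⇒≱ p<O (subst (O ≤_) (sym p≡) (ℕ.m≤m+n O i)))
    ; halt = last-row }

  binary-word : BinRep w (suc n₁)
  binary-word = Word.value word

-- Binary representations and the time bound

binary-digits : ∀ v → Σ (List Bool) λ bs → val (true ∷ bs) 0 ≡ suc v
binary-digits = <-rec _ step-down
  where
  step-down : ∀ v → (∀ {u} → u < v → Σ (List Bool) λ bs → val (true ∷ bs) 0 ≡ suc u) →
    Σ (List Bool) λ bs → val (true ∷ bs) 0 ≡ suc v
  step-down zero    rec = [] , refl
  step-down (suc v) rec with half v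
  ... | u , inj₁ refl with rec {u} (s≤s (ℕ.m≤m+n u _))
  ...   | bs , e = bs List.++ false ∷ [] , trans (val-∷ʳ (true ∷ bs) false 0) (trans (cong (2 *_) e) (ℕ.*-suc 2 u))
  step-down (suc v) rec | u , inj₂ refl with rec {u} (s≤s (ℕ.m≤n⇒m≤1+n (ℕ.m≤m+n u _)))
  ...   | bs , e = bs List.++ true ∷ [] ,
    trans (val-∷ʳ (true ∷ bs) true 0) (cong suc (trans (cong (2 *_) e) (ℕ.*-suc 2 u)))

prefix : ℕ → List Bool → ℕ → ℕ
prefix acc bs       zero    = acc
prefix acc []       (suc i) = acc
prefix acc (b ∷ bs) (suc i) = prefix (if b then suc (2 * acc) else 2 * acc) bs i

prefix-suc : ∀ acc bs {i} → i < length bs → Σ Bool λ b → look bs i ≡ just b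
  × prefix acc bs (suc i) ≡ (if b then suc (2 * prefix acc bs i) else 2 * prefix acc bs i)
prefix-suc acc (b ∷ bs) {zero}  h = b , refl , refl
prefix-suc acc (b ∷ bs) {suc i} (s≤s h) = prefix-suc _ bs h

prefix-all : ∀ acc bs → prefix acc bs (length bs) ≡ val bs acc
prefix-all acc [] = refl
prefix-all acc (false ∷ bs) = prefix-all _ bs
prefix-all acc (true ∷ bs)  = prefix-all _ bs

prefixes : ∀ bs {n} → val (true ∷ bs) 0 ≡ n → Prefixes (true ∷ bs) n
prefixes bs e = record
  { end = length bs
  ; value = prefix 1 bs
  ; zeroth = refl , refl
  ; next = prefix-suc 1 bs
  ; total = trans (prefix-all 1 bs) e
  ; after-end = λ h → look-≥ (true ∷ bs) h }

-- With `acc` equal to 1 and the bits after the leading one, this bounds n below by 2^(ℓ - 1), where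
-- ℓ is the length of the input.
acc*2^length≤val : ∀ bs acc → acc * 2 ^ length bs ≤ val bs acc
acc*2^length≤val []       acc = ℕ.≤-reflexive (ℕ.*-identityʳ acc)
acc*2^length≤val (b ∷ bs) acc = ℕ.≤-trans (ℕ.≤-reflexive double) (bit b)
  where
  double : acc * (2 * 2 ^ length bs) ≡ 2 * acc * 2 ^ length bs
  double = trans (sym (ℕ.*-assoc acc 2 _)) (cong (_* 2 ^ length bs) (ℕ.*-comm acc 2))
  bit : ∀ b → 2 * acc * 2 ^ length bs ≤ val (b ∷ bs) acc
  bit false = acc*2^length≤val bs (2 * acc)
  bit true  = ℕ.≤-trans (ℕ.*-monoˡ-≤ (2 ^ length bs) (ℕ.n≤1+n (2 * acc))) (acc*2^length≤val bs (1 + 2 * acc))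

sqrt : ∀ n → Σ ℕ λ s → s * s ≤ n × n < suc s * suc s
sqrt zero = 0 , z≤n , s≤s z≤n
sqrt (suc n) with sqrt n
... | s , lower , upper with ℕ.<-≤-connex (suc n) (suc s * suc s)
...   | inj₁ h = s , ℕ.m≤n⇒m≤1+n lower , h
...   | inj₂ h = suc s , h , ℕ.<-≤-trans (s≤s upper) (ℕ.≤-trans (ℕ.≤-reflexive (ℕ.+-comm 1 _))
  (ℕ.≤-trans (ℕ.+-monoʳ-≤ (suc s * suc s) {1} {suc (suc s)} (s≤s z≤n))
    (ℕ.≤-trans (ℕ.≤-reflexive (ℕ.+-comm (suc s * suc s) (suc (suc s))))
      (ℕ.+-monoʳ-≤ (suc (suc s)) (ℕ.*-monoʳ-≤ (suc s) (ℕ.n≤1+n (suc s)))))))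

^-distribʳ-* : ∀ o m n → (m * n) ^ o ≡ m ^ o * n ^ o
^-distribʳ-* zero    m n = refl
^-distribʳ-* (suc o) m n =
  trans (cong (m * n *_) (^-distribʳ-* o m n)) (ℕ.[m*n]*[o*p]≡[m*o]*[n*p] m n (m ^ o) (n ^ o))

-- d·2^{(2k+1)ℓ} ≤ d·(2n)^{2k+1} ≤ d·2^{2k+1}·n^{2k}·4s², since n < (s + 1)² ≤ 4s².
time-bound : ∀ k d t ℓ n s → t ^ 2 ≤ d * 2 ^ ((2 * k + 1) * ℓ) → 2 ^ ℓ ≤ 2 * n → 0 < n → 0 < s →
  n < suc s * suc s → t < n ^ k * s * suc (d * 2 ^ (2 * k + 1) * 4)
time-bound k d t ℓ n s t²≤ 2^ℓ≤ 0<n 0<s n< = ℕ.≰⇒> λ WD≤t → ℕ.<⇒≱ t²<[WD]² (ℕ.^-monoˡ-≤ 2 WD≤t)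
  where
  open ℕ.≤-Reasoning
  p = 2 * k + 1
  W = n ^ k * s
  D₀ = d * 2 ^ p * 4
  0<W : 0 < W
  0<W = ℕ.*-mono-≤ (ℕ.m^n>0 n {{ℕ.>-nonZero 0<n}} k) 0<s
  n≤4s² : n ≤ 4 * s ^ 2
  n≤4s² = begin
    n                      ≤⟨ ℕ.<⇒≤ n< ⟩
    suc s * suc s          ≤⟨ ℕ.*-mono-≤ 1+s≤2s 1+s≤2s ⟩
    (2 * s) * (2 * s)      ≡⟨ cong (2 * s *_) (ℕ.*-identityʳ (2 * s)) ⟨
    (2 * s) ^ 2            ≡⟨ ^-distribʳ-* 2 2 s ⟩
    4 * s ^ 2              ∎
    where
    1+s≤2s : suc s ≤ 2 * s
    1+s≤2s = ℕ.≤-trans (ℕ.+-monoˡ-≤ s 0<s) (ℕ.≤-reflexive (cong (s +_) (sym (ℕ.+-identityʳ s))))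
  n^p≤ : n ^ p ≤ 4 * W ^ 2
  n^p≤ = begin
    n ^ (2 * k + 1)             ≡⟨ ℕ.^-distribˡ-+-* n (2 * k) 1 ⟩
    n ^ (2 * k) * n ^ 1         ≡⟨ cong₂ _*_ (trans (cong (n ^_) (ℕ.*-comm 2 k)) (sym (ℕ.^-*-assoc n k 2))) (ℕ.*-identityʳ n) ⟩
    (n ^ k) ^ 2 * n             ≤⟨ ℕ.*-monoʳ-≤ ((n ^ k) ^ 2) n≤4s² ⟩
    (n ^ k) ^ 2 * (4 * s ^ 2)   ≡⟨ ℕ.*-assoc ((n ^ k) ^ 2) 4 (s ^ 2) ⟨
    (n ^ k) ^ 2 * 4 * s ^ 2     ≡⟨ cong (_* s ^ 2) (ℕ.*-comm ((n ^ k) ^ 2) 4) ⟩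
    4 * (n ^ k) ^ 2 * s ^ 2     ≡⟨ ℕ.*-assoc 4 ((n ^ k) ^ 2) (s ^ 2) ⟩
    4 * ((n ^ k) ^ 2 * s ^ 2)   ≡⟨ cong (4 *_) (^-distribʳ-* 2 (n ^ k) s) ⟨
    4 * W ^ 2                   ∎
  t²<[WD]² : t ^ 2 < (W * suc D₀) ^ 2
  t²<[WD]² = begin-strict
    t ^ 2                          ≤⟨ t²≤ ⟩
    d * 2 ^ (p * ℓ)                ≡⟨ cong (d *_) (trans (cong (2 ^_) (ℕ.*-comm p ℓ)) (sym (ℕ.^-*-assoc 2 ℓ p))) ⟩
    d * (2 ^ ℓ) ^ p                ≤⟨ ℕ.*-monoʳ-≤ d (ℕ.^-monoˡ-≤ p 2^ℓ≤) ⟩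
    d * (2 * n) ^ p                ≡⟨ cong (d *_) (^-distribʳ-* p 2 n) ⟩
    d * (2 ^ p * n ^ p)            ≡⟨ ℕ.*-assoc d (2 ^ p) (n ^ p) ⟨
    d * 2 ^ p * n ^ p              ≤⟨ ℕ.*-monoʳ-≤ (d * 2 ^ p) n^p≤ ⟩
    d * 2 ^ p * (4 * W ^ 2)        ≡⟨ ℕ.*-assoc (d * 2 ^ p) 4 (W ^ 2) ⟨
    -- The added one in the constant makes the bound strict, also when d is 0.
    D₀ * W ^ 2                     <⟨ ℕ.*-monoˡ-< (W ^ 2) {{ℕ.>-nonZero (ℕ.m^n>0 W {{ℕ.>-nonZero 0<W}} 2)}} (ℕ.n<1+n D₀) ⟩
    suc D₀ * W ^ 2                 ≤⟨ ℕ.*-monoˡ-≤ (W ^ 2) (ℕ.m≤m*n (suc D₀) (suc D₀ * 1)) ⟩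
    suc D₀ ^ 2 * W ^ 2             ≡⟨ ℕ.*-comm (suc D₀ ^ 2) (W ^ 2) ⟩
    W ^ 2 * suc D₀ ^ 2             ≡⟨ ^-distribʳ-* 2 W (suc D₀) ⟨
    (W * suc D₀) ^ 2               ∎

BinRep-functional : ∀ {w m n} → BinRep w m → BinRep w n → m ≡ n
BinRep-functional {true ∷ _} e e' = trans (sym e) e'

-- In `complete` the size of the tiling is prescribed by the time bound. In `sound` it is
-- existential, because it depends on the base s that the model has chosen.
record TileSpectrum (k' : ℕ) (𝒯 : TileSystem) (D : ℕ) : Set₁ where
  field
    σ        : Vocab
    Φ        : Formula (2 + (suc (suc k') + suc (suc k'))) σ
    closed   : Sentence Φ
    complete : ∀ {v s} → 0 < s → s * s ≤ suc v → ∀ {bs} → val (true ∷ bs) 0 ≡ suc v →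
      Tiling 𝒯 (λ _ → ⊤) (suc v ^ suc (suc k') * s * D) (true ∷ bs) → Spec Φ (suc v)
    sound    : ∀ {v} → Spec Φ (suc v) → Σ ℕ λ o → Σ (List Bool) λ w →
      0 < o × Tiling 𝒯 (_< o) o w × BinRep w (suc v)

abstract
  tile-spectrum : ∀ k' 𝒯 D₀ → TileSpectrum k' 𝒯 (suc D₀)
  tile-spectrum k' 𝒯 D₀ = record
    { σ = σ
    ; Φ = sentence axioms
    ; closed = sentence-closed axioms
    ; complete = complete
    ; sound = sound }
    where
    open Axioms k' 𝒯 D₀
    complete : ∀ {v s} → 0 < s → s * s ≤ suc v → ∀ {bs} → val (true ∷ bs) 0 ≡ suc v →
      Tiling 𝒯 (λ _ → ⊤) (suc v ^ k * s * D) (true ∷ bs) → Spec (sentence axioms) (suc v)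
    complete {v} {suc s₁} _ s²≤n {bs} e T = s≤s z≤n , structure model , model-complete model axioms model-holds
      where
      open Model k' 𝒯 D₀ v s₁ s²≤n (true ∷ bs) (prefixes bs e) using (module WithTiling)
      open WithTiling (subst (λ W → Tiling 𝒯 (λ _ → ⊤) (W * D) (true ∷ bs)) (sym (weight-space (suc v) (suc s₁) {suc k'})) T)
    sound : ∀ {v} → Spec (sentence axioms) (suc v) → Σ ℕ λ o → Σ (List Bool) λ w →
      0 < o × Tiling 𝒯 (_< o) o w × BinRep w (suc v)
    sound {v} (_ , 𝔄 , 𝔄⊨Φ) = O , w , 0<O , extracted , binary-word
      where open Extract k' 𝒯 D₀ v (interp 𝔄) (model-sound 𝔄 axioms 𝔄⊨Φ)

theorem4p1 : (k : ℕ) → 2 ≤ k → (A : ℕ → Set) →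
    NTIME-2^ (2 * k + 1) 2 A → InSpec (2 * k + 2) A
theorem4p1 k@(suc (suc k')) (s≤s (s≤s z≤n)) A (positive , M , d , sound , complete , bounded) =
  subst (λ m → InSpec m A) K≡ (Spectrum.σ , Spectrum.Φ , Spectrum.closed , λ n → A⇒Spec n , Spec⇒A n)
  where
  D₀ : ℕ
  D₀ = d * 2 ^ (2 * k + 1) * 4
  module Spectrum = TileSpectrum (tile-spectrum k' (TM.M-tiles M) D₀)
  K≡ : 2 + (k + k) ≡ 2 * k + 2
  K≡ = trans (ℕ.+-comm 2 (k + k)) (cong (λ m → k + m + 2) (sym (ℕ.+-identityʳ k)))
  A⇒Spec : ∀ n → A n → Spec Spectrum.Φ n
  A⇒Spec zero    a = ⊥-elim (ℕ.n≮0 (positive 0 a))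
  A⇒Spec (suc v) a = from-root (binary-digits v) (sqrt (suc v))
    where
    from-root : (Σ (List Bool) λ bs → val (true ∷ bs) 0 ≡ suc v) →
      (Σ ℕ λ s → s * s ≤ suc v × suc v < suc s * suc s) → Spec Spectrum.Φ (suc v)
    from-root _        (zero , _ , s≤s ())
    from-root (bs , e) (s@(suc _) , s²≤n , n<[s+1]²) with complete (true ∷ bs) (suc v) a e
    ... | t , c , run , acc = Spectrum.complete (s≤s z≤n) s²≤n e
      -- The accepting run is one of the computation paths covered by the time bound, and so it has
      -- fewer than n^k·s·D steps.
      (TM.run-tiling M _ run acc (time-bound k d t (length (true ∷ bs)) (suc v) s
        (bounded (true ∷ bs) t c run) 2^length (s≤s z≤n) (s≤s z≤n) n<[s+1]²))
      where
      2^length : 2 ^ length (true ∷ bs) ≤ 2 * suc v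
      2^length = ℕ.*-monoʳ-≤ 2 (ℕ.≤-trans (ℕ.≤-reflexive (sym (ℕ.+-identityʳ (2 ^ length bs))))
        (ℕ.≤-trans (acc*2^length≤val bs 1) (ℕ.≤-reflexive e)))
  Spec⇒A : ∀ n → Spec Spectrum.Φ n → A n
  Spec⇒A (suc v) model with Spectrum.sound model
  ... | o , w , 0<o , T , rep with sound w (TM.Sound.accepts M o 0<o T)
  ...   | N , a , rep' = subst A (BinRep-functional rep' rep) a
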